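{- Let $\mathcal{P}^0_{\mathcal{A}}\subset\mathcal{A}$ be the set of elements of the form $(a_p\bmod p)_p$ where $(a_n)_{n\ge 0}$ is a recurrent sequence of rational numbers. Suppose $\alpha\in\mathcal{P}^0_{\mathcal{A}}$. Then there exists a non-zero polynomial $f(x)\in\mathbb{Q}[x]$ such that $f(\alpha)=0$ in $\mathcal{A}$, and every such $f(x)$ has a rational root.
   Context: $\mathcal{A}=\left(\prod_p\mathbb{F}_p\right)/\left(\bigoplus_p\mathbb{F}_p\right)$ over all rational primes $p$: elements are sequences $(a_p)_p$, $a_p\in\mathbb{F}_p$, two sequences being equal if they agree for all sufficiently large $p$ (so $a_p$ need only be defined for large $p$). $\mathbb{Q}$ embeds diagonally in $\mathcal{A}$, so $f(\alpha)$ makes sense for $f\in\mathbb{Q}[x]$. A recurrent sequence is a sequence satisfying a linear recurrence relation with constant coefficients. -}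

module Defs where

open import Data.Nat using (ℕ; zero; suc; _≥_)
open import Data.Nat.Primality using (Prime)
open import Data.Fin using (Fin; zero; suc)
open import Data.Integer using (+_)
open import Data.Integer.Divisibility using (_∣_)
open import Data.Rational using (ℚ; 0ℚ; _+_; _*_; _-_; ↥_)
open import Data.List using (List; foldr)
open import Data.List.Relation.Unary.Any using (Any)
open import Data.Product using (∃; Σ)
open import Relation.Binary.PropositionalEquality using (_≡_)
open import Relation.Nullary using (¬_)

finSum : (k : ℕ) → (Fin k → ℚ) → ℚ
finSum zero    g = 0ℚ
finSum (suc k) g = g zero + finSum k (λ i → g (suc i))

IsRecurrent : (ℕ → ℚ) → Set
IsRecurrent a =
  ∃ λ (k : ℕ) → Σ (Fin k → ℚ) λ c →
    ∀ n → a (n Data.Nat.+ k) ≡ finSum k (λ i → c i * a (n Data.Nat.+ Data.Fin.toℕ i))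

-- Polynomials in ℚ[x]: coefficient lists, lowest degree first.
Poly : Set
Poly = List ℚ

NonZeroPoly : Poly → Set
NonZeroPoly f = Any (λ c → ¬ (c ≡ 0ℚ)) f

eval : Poly → ℚ → ℚ
eval f x = foldr (λ c acc → c + x * acc) 0ℚ f

-- Model of 𝒜 = (∏_p F_p)/(⊕_p F_p): an element is given by a sequence
-- x : ℕ → ℚ whose p-th term is p-integral for large p, read modulo p via
-- ℤ_(p)/pℤ_(p) ≅ F_p.  Reduction mod p of a p-integral rational q vanishes
-- iff p divides the numerator of q (in lowest terms).
ZeroModP : ℕ → ℚ → Set
ZeroModP p q = (+ p) ∣ (↥ q)

_≈𝒜_ : (ℕ → ℚ) → (ℕ → ℚ) → Set
x ≈𝒜 y = ∃ λ (N : ℕ) → ∀ p → Prime p → p ≥ N → ZeroModP p (x p - y p)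

-- f(α) = 0 in 𝒜, where α = (a_p mod p)_p.
-- (f(α))_p = f(a_p) mod p, since reduction ℤ_(p) → F_p is a ring map.
PolyVanishesAt : Poly → (ℕ → ℚ) → Set
PolyVanishesAt f a = (λ p → eval f (a p)) ≈𝒜 (λ _ → 0ℚ)

{-# OPTIONS --safe #-}
module Submission where

-- Write h for the characteristic polynomial of the recurrence and t_1, ..., t_s for its roots.
-- First h is made separable: if g = gcd(h, h′), then subtracting from a suitable terms n c_(n-1),
-- which vanish modulo n, leaves a solution of a recurrence of lower degree. After scaling, h is
-- monic over ℤ and U h + V h′ = Δ ≠ 0. In a ring where h splits this gives
-- Δ a_n = Σ c_i t_i^n with c_i independent of n. Modulo p the elements t_i^p are again roots of h
-- (Frobenius), so Δ a_p is a specialisation of β = Σ c_i z_i in the ring S[z_1, ..., z_s]/(h(z_i)),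
-- which has finite rank over ℤ; any integer relation between the powers of β kills Δ a_p mod p
-- for every p. If h splits into linear factors over 𝔽_p, then t_i^p = t_i, hence a_p ≡ a_1, so it
-- suffices to find infinitely many such p: a polynomial vanishing at all a_p then vanishes at the
-- rational number a_1. Such p are the large prime divisors of the values g(v), where g is the
-- minimal polynomial of a primitive element θ of a domain K generated by the roots of h, since
-- θ ↦ v defines a homomorphism from a localisation of ℤ[θ] to 𝔽_p. Vanishing of a given rational
-- number is decidable, so K and θ are only needed to exist up to double negation.

open import Algebra.Bundles using (CommutativeRing; RawRing)
import Algebra.Properties.AbelianGroup
import Algebra.Properties.CommutativeSemiring.Binomial
import Algebra.Properties.CommutativeSemiring.Exp
import Algebra.Properties.Monoid.Mult.TCOptimised
import Algebra.Properties.Ring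
import Algebra.Properties.Semiring.Binomial
import Algebra.Properties.Semiring.Mult
import Algebra.Properties.Semiring.Mult.TCOptimised
import Algebra.Properties.Semiring.Sum
import Algebra.Solver.Ring as RingSolver
open import Algebra.Solver.Ring.AlmostCommutativeRing using (AlmostCommutativeRing; fromCommutativeRing; _-Raw-AlmostCommutative⟶_; Induced-equivalence)
open import Data.Empty using (⊥; ⊥-elim)
open import Data.Fin.Base as Fin using (Fin; zero; suc; toℕ; fromℕ; inject₁; punchIn)
open import Data.Fin.Properties as Fin using (any?)
open import Data.Integer.Base as ℤ using (ℤ; +_; -[1+_]; _⊖_)
import Data.Integer.Divisibility as ℤ
import Data.Integer.Divisibility.Signed as ℤˢ
import Data.Integer.Properties as ℤ
open import Data.List.Base as List using (List; []; _∷_; map; foldr; length)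
open import Data.List.Relation.Unary.All as All using (All; []; _∷_)
open import Data.List.Relation.Unary.Any as Any using (Any; here; there)
open import Data.Maybe.Base using (Maybe; just; nothing)
open import Data.Nat.Base as ℕ using (ℕ; zero; suc; _≤_; _<_; z≤n; s≤s; _!; _∸_)
open import Data.Nat.Combinatorics using (nCk≡n!/k![n-k]!; k![n∸k]!∣n!; nCn≡1)
open import Data.Nat.Combinatorics.Base using () renaming (_C_ to _choose_)
import Data.Nat.Coprimality as Coprime
open import Data.Nat.DivMod using (m*[n/m]≡n)
import Data.Nat.Divisibility as ℕ
import Data.Nat.ListAction as ℕ
open import Data.Nat.Primality using (Prime; euclidsLemma; ¬prime[0]; ¬prime[1])
open import Data.Nat.Primality.Factorisation using (factorise; PrimeFactorisation)
import Data.Nat.Properties as ℕ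
open import Data.Product using (_,_; _×_; ∃; proj₁; proj₂; Σ)
open import Data.Rational.Base as ℚ using (ℚ; 0ℚ; 1ℚ; mkℚ; ↥_; ↧_; 1/_)
import Data.Rational.Properties as ℚ
import Data.Rational.Unnormalised.Base as ℚᵘ
import Data.Rational.Unnormalised.Properties as ℚᵘ
open import Data.Sum using (_⊎_; inj₁; inj₂; [_,_]′)
open import Data.Vec.Base as Vec using (Vec; []; _∷_; lookup; insertAt; removeAt; zipWith; toList; replicate; fromList)
open import Data.Vec.Properties using (lookup-map; insertAt-punchIn; map-id; map-∘)
open import Level using (0ℓ)
open import Relation.Binary.Definitions using (WeaklyDecidable; tri<; tri≈; tri>)
open import Relation.Binary.PropositionalEquality as ≡ using (_≡_; _≢_)
open import Relation.Nullary using (¬_; Dec; yes; no; ¬?)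
open import Relation.Nullary.Decidable using (decidable-stable)

-- The polynomial `f` and the rational root must be exhibited, so both come from rings built
-- explicitly out of `h`; the domain `K` enters only in the proof that a given rational number
-- vanishes. The splitting ring `S` arises by adjoining formal roots one at a time, without
-- factoring `h`, and is in general not a domain. Hence a root of `h` in `S` modulo `p` need not be
-- one of the t_i, and one cannot argue that Frobenius permutes the roots. This is why β is formed
-- with independent roots z_i, which may be specialised to any system of roots. The ring of β does
-- not depend on `p`, so a single relation serves all primes. Primes that split `h` could be taken
-- from Chebotarev's theorem; the prime divisors of the values of an integer polynomial are an
-- elementary substitute. Making the recurrence separable and integral replaces a_p by an integer
-- sequence `b` with κ a_p ≡ b_p modulo p for large p, so the root finally obtained is b_1 / κ.

Ring : Set₁
Ring = CommutativeRing 0ℓ 0ℓ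

∣_∣ : Ring → Set
∣ R ∣ = CommutativeRing.Carrier R

open RingSolver using (con; :-_)

module _ {Coeff : RawRing 0ℓ 0ℓ} {A : AlmostCommutativeRing 0ℓ 0ℓ} {φ : Coeff -Raw-AlmostCommutative⟶ A}
  {_≟_ : WeaklyDecidable (Induced-equivalence φ)} {n : ℕ} where
  private Expr = RingSolver.Polynomial Coeff A φ _≟_ n

  infixl 8 _:*_
  infixl 7 _:+_ _:-_
  infix  4 _:=_

  _:+_ _:*_ _:-_ : Expr → Expr → Expr
  _:+_ = RingSolver.op RingSolver.[+]
  _:*_ = RingSolver.op RingSolver.[*]
  x :- y = x :+ :- y

  _:=_ : Expr → Expr → Expr × Expr
  _:=_ = _,_

-- Commutative rings, their integers and homomorphisms

module Kit (R : Ring) where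
  open CommutativeRing R public using
    ( Carrier; _≈_; _+_; _*_; -_; _-_; 0#; 1#; refl; sym; trans; reflexive; setoid
    ; +-cong; +-congˡ; +-congʳ; +-assoc; +-comm; +-identityˡ; +-identityʳ; -‿cong; -‿inverseˡ; -‿inverseʳ
    ; *-cong; *-congˡ; *-congʳ; *-assoc; *-comm; *-identityˡ; *-identityʳ; distribˡ; distribʳ; zeroˡ; zeroʳ
    ; semiring; commutativeSemiring; +-monoid; +-abelianGroup )
  open import Relation.Binary.Reasoning.Setoid setoid public
    using (begin_; step-≈-⟩; step-≈-⟨; step-≡-⟩; step-≡-⟨; _∎)
  open import Algebra.Properties.Semiring.Exp semiring public using (_^_; ^-congˡ)
  private
    module M = Algebra.Properties.Semiring.Mult.TCOptimised semiring
    module P = Algebra.Properties.Ring (CommutativeRing.ring R)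
    module G = Algebra.Properties.AbelianGroup +-abelianGroup

  -- With the optimised multiple, `ι (+ 1)` reduces to `1#` and `ι (+ 0)` to `0#`, so the integer
  -- constants of the ring solver agree with the constants of the ring by computation.
  ι : ℤ → Carrier
  ι (+ n)    = n M.× 1#
  ι -[1+ n ] = - (suc n M.× 1#)

  private
    ι-neg : ∀ i → ι (ℤ.- i) ≈ - ι i
    ι-neg (+ zero)  = sym P.-0#≈0#
    ι-neg (+ suc n) = refl
    ι-neg -[1+ n ]  = sym (P.-‿involutive _)

    ι-⊖ : ∀ m n → ι (m ⊖ n) ≈ m M.× 1# + - (n M.× 1#)
    ι-⊖ zero zero = sym (-‿inverseʳ 0#)
    ι-⊖ zero (suc n) = sym (+-identityˡ _)
    ι-⊖ (suc m) zero = sym (trans (+-congˡ P.-0#≈0#) (+-identityʳ _))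
    ι-⊖ (suc m) (suc n) = begin
      ι (suc m ⊖ suc n)                         ≡⟨ ≡.cong ι (ℤ.[1+m]⊖[1+n]≡m⊖n m n) ⟩
      ι (m ⊖ n)                                 ≈⟨ ι-⊖ m n ⟩
      x + - y                                   ≈⟨ +-congˡ (+-identityˡ (- y)) ⟨
      x + (0# + - y)                            ≈⟨ +-congˡ (+-congʳ (-‿inverseʳ 1#)) ⟨
      x + ((1# + - 1#) + - y)                   ≈⟨ +-congˡ (+-assoc _ _ _) ⟩
      x + (1# + (- 1# + - y))                   ≈⟨ +-assoc _ _ _ ⟨
      (x + 1#) + (- 1# + - y)                   ≈⟨ +-cong (+-comm x 1#) (G.⁻¹-∙-comm 1# y) ⟩
      (1# + x) + - (1# + y)                     ≈⟨ +-cong (M.1+× m 1#) (-‿cong (M.1+× n 1#)) ⟨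
      suc m M.× 1# + - (suc n M.× 1#)           ∎
      where x = m M.× 1# ; y = n M.× 1#

    ι-+ : ∀ i j → ι (i ℤ.+ j) ≈ ι i + ι j
    ι-+ (+ m) (+ n) = M.×-homo-+ 1# m n
    ι-+ (+ m) -[1+ n ] = ι-⊖ m (suc n)
    ι-+ -[1+ m ] (+ n) = trans (ι-⊖ n (suc m)) (+-comm _ _)
    ι-+ -[1+ m ] -[1+ n ] = begin
      ι (-[1+ m ] ℤ.+ -[1+ n ])        ≡⟨ ≡.cong ι (ℤ.neg-distrib-+ (+ suc m) (+ suc n)) ⟨
      ι (ℤ.- (+ suc m ℤ.+ + suc n))    ≈⟨ ι-neg (+ suc m ℤ.+ + suc n) ⟩
      - ι (+ suc m ℤ.+ + suc n)        ≈⟨ -‿cong (M.×-homo-+ 1# (suc m) (suc n)) ⟩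
      - (ι (+ suc m) + ι (+ suc n))    ≈⟨ G.⁻¹-∙-comm _ _ ⟨
      - ι (+ suc m) + - ι (+ suc n)    ∎

    ι-*⁺ : ∀ m j → ι (+ m ℤ.* j) ≈ ι (+ m) * ι j
    ι-*⁺ m (+ n) = trans (reflexive (≡.cong ι (≡.sym (ℤ.pos-* m n)))) (M.×1-homo-* m n)
    ι-*⁺ m -[1+ n ] = begin
      ι (+ m ℤ.* (ℤ.- + suc n))    ≡⟨ ≡.cong ι (ℤ.neg-distribʳ-* (+ m) (+ suc n)) ⟨
      ι (ℤ.- (+ m ℤ.* + suc n))    ≈⟨ ι-neg (+ m ℤ.* + suc n) ⟩
      - ι (+ m ℤ.* + suc n)        ≈⟨ -‿cong (ι-*⁺ m (+ suc n)) ⟩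
      - (ι (+ m) * ι (+ suc n))    ≈⟨ P.-‿distribʳ-* _ _ ⟩
      ι (+ m) * - ι (+ suc n)      ∎

    ι-* : ∀ i j → ι (i ℤ.* j) ≈ ι i * ι j
    ι-* (+ m) j = ι-*⁺ m j
    ι-* -[1+ m ] j = begin
      ι ((ℤ.- + suc m) ℤ.* j)      ≡⟨ ≡.cong ι (ℤ.neg-distribˡ-* (+ suc m) j) ⟨
      ι (ℤ.- (+ suc m ℤ.* j))      ≈⟨ ι-neg (+ suc m ℤ.* j) ⟩
      - ι (+ suc m ℤ.* j)          ≈⟨ -‿cong (ι-*⁺ (suc m) j) ⟩
      - (ι (+ suc m) * ι j)        ≈⟨ P.-‿distribˡ-* _ _ ⟩
      - ι (+ suc m) * ι j          ∎

  ι-morphism : CommutativeRing.rawRing ℤ.+-*-commutativeRing -Raw-AlmostCommutative⟶ fromCommutativeRing R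
  ι-morphism = record
    { ⟦_⟧ = ι ; +-homo = ι-+ ; *-homo = ι-* ; -‿homo = ι-neg
    ; 0-homo = refl ; 1-homo = refl }

  open _-Raw-AlmostCommutative⟶_ ι-morphism public
    using () renaming (+-homo to ι-+-homo; *-homo to ι-*-homo; -‿homo to ι-neg-homo)

  ι-cong : ∀ {i j} → i ≡ j → ι i ≈ ι j
  ι-cong e = reflexive (≡.cong ι e)

  ι-decide : ∀ i j → Maybe (ι i ≈ ι j)
  ι-decide i j with i ℤ.≟ j
  ... | yes e = just (ι-cong e)
  ... | no _  = nothing

  solve = RingSolver.solve (CommutativeRing.rawRing ℤ.+-*-commutativeRing) (fromCommutativeRing R) ι-morphism ι-decide

record Hom (A B : Ring) : Set where
  private
    module A = Kit A
    module B = Kit B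
  field
    fun    : A.Carrier → B.Carrier
    cong   : ∀ {x y} → x A.≈ y → fun x B.≈ fun y
    +-homo : ∀ x y → fun (x A.+ y) B.≈ fun x B.+ fun y
    *-homo : ∀ x y → fun (x A.* y) B.≈ fun x B.* fun y
    1-homo : fun A.1# B.≈ B.1#

  0-homo : fun A.0# B.≈ B.0#
  0-homo = begin
    z              ≈⟨ B.solve 1 (λ z → z := z :+ z :- z) B.refl z ⟩
    z + z - z      ≈⟨ B.+-congʳ (+-homo A.0# A.0#) ⟨
    fun (A.0# A.+ A.0#) - z ≈⟨ B.+-congʳ (cong (A.+-identityˡ A.0#)) ⟩
    z - z          ≈⟨ B.-‿inverseʳ z ⟩
    B.0#           ∎
    where open B ; z = fun A.0#

  neg-homo : ∀ x → fun (A.- x) B.≈ B.- fun x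
  neg-homo x = begin
    y                   ≈⟨ B.solve 2 (λ y x → y := (y :+ x) :- x) B.refl y (fun x) ⟩
    (y + fun x) - fun x ≈⟨ B.+-congʳ (+-homo (A.- x) x) ⟨
    fun (A.- x A.+ x) - fun x ≈⟨ B.+-congʳ (B.trans (cong (A.-‿inverseˡ x)) 0-homo) ⟩
    0# - fun x          ≈⟨ B.+-identityˡ _ ⟩
    - fun x             ∎
    where open B ; y = fun (A.- x)

  ^-homo : ∀ x n → fun (x A.^ n) B.≈ fun x B.^ n
  ^-homo x zero = 1-homo
  ^-homo x (suc n) = B.trans (*-homo x _) (B.*-congˡ (^-homo x n))

  ι⁺-homo : ∀ n → fun (A.ι (+ n)) B.≈ B.ι (+ n)
  ι⁺-homo zero = 0-homo
  ι⁺-homo (suc n) = begin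
    fun (A.ι (+ suc n))            ≈⟨ cong (A.ι-+-homo (+ 1) (+ n)) ⟩
    fun (A.1# A.+ A.ι (+ n))       ≈⟨ +-homo _ _ ⟩
    fun A.1# + fun (A.ι (+ n))     ≈⟨ +-cong 1-homo (ι⁺-homo n) ⟩
    1# + B.ι (+ n)                 ≈⟨ B.ι-+-homo (+ 1) (+ n) ⟨
    B.ι (+ suc n)                  ∎
    where open B

  ι-homo : ∀ m → fun (A.ι m) B.≈ B.ι m
  ι-homo (+ n) = ι⁺-homo n
  ι-homo -[1+ n ] = B.trans (neg-homo _) (B.-‿cong (ι⁺-homo (suc n)))

infixr 9 _∘ʰ_
_∘ʰ_ : ∀ {A B C} → Hom B C → Hom A B → Hom A C
_∘ʰ_ {A} {B} {C} g f = record
  { fun = λ x → G.fun (F.fun x)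
  ; cong = λ e → G.cong (F.cong e)
  ; +-homo = λ x y → C.trans (G.cong (F.+-homo x y)) (G.+-homo _ _)
  ; *-homo = λ x y → C.trans (G.cong (F.*-homo x y)) (G.*-homo _ _)
  ; 1-homo = C.trans (G.cong F.1-homo) G.1-homo }
  where
  module F = Hom f
  module G = Hom g
  module C = Kit C

idʰ : ∀ {A} → Hom A A
idʰ {A} = record { fun = λ x → x ; cong = λ e → e ; +-homo = λ _ _ → A.refl ; *-homo = λ _ _ → A.refl ; 1-homo = A.refl }
  where module A = Kit A

ℤᴿ : Ring
ℤᴿ = ℤ.+-*-commutativeRing

ιʰ : ∀ A → Hom ℤᴿ A
ιʰ A = record { fun = A.ι ; cong = A.ι-cong ; +-homo = A.ι-+-homo ; *-homo = A.ι-*-homo ; 1-homo = A.refl }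
  where module A = Kit A

-- Polynomials as operators on sequences

module Polynomial (R : Ring) where
  open Kit R
  private variable
    P P′ Q Q′ : List Carrier

  coeff : List Carrier → ℕ → Carrier
  coeff []      _       = 0#
  coeff (c ∷ P) zero    = c
  coeff (c ∷ P) (suc i) = coeff P i

  infix 4 _≋_
  -- Trailing zeros cannot be stripped where vanishing in the ring is undecidable, so lists are
  -- compared through their coefficients.
  record _≋_ (P Q : List Carrier) : Set where
    constructor pw
    field at : ∀ i → coeff P i ≈ coeff Q i
  open _≋_ public

  -- A polynomial in the shift operator E, applied to the sequence a.
  act : List Carrier → (ℕ → Carrier) → ℕ → Carrier
  act []      a n = 0#
  act (c ∷ P) a n = c * a n + act P a (suc n)

  infixl 6 _⊞_
  infixl 7 _⊠_
  _⊞_ : List Carrier → List Carrier → List Carrier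
  []      ⊞ Q       = Q
  (c ∷ P) ⊞ []      = c ∷ P
  (c ∷ P) ⊞ (d ∷ Q) = (c + d) ∷ (P ⊞ Q)

  scale : Carrier → List Carrier → List Carrier
  scale c = map (c *_)

  neg : List Carrier → List Carrier
  neg = map (-_)

  _⊠_ : List Carrier → List Carrier → List Carrier
  []      ⊠ Q = []
  (c ∷ P) ⊠ Q = scale c Q ⊞ (0# ∷ P ⊠ Q)

  eval : List Carrier → Carrier → Carrier
  eval P x = foldr (λ c acc → c + x * acc) 0# P

  act-congʳ : ∀ P {a b} → (∀ n → a n ≈ b n) → ∀ n → act P a n ≈ act P b n
  act-congʳ []      e n = refl
  act-congʳ (c ∷ P) e n = +-cong (*-congˡ (e n)) (act-congʳ P e (suc n))

  act-shift : ∀ P a n → act P (λ m → a (suc m)) n ≈ act P a (suc n)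
  act-shift []      a n = refl
  act-shift (c ∷ P) a n = +-congˡ (act-shift P a (suc n))

  act-+ʳ : ∀ P a b n → act P (λ m → a m + b m) n ≈ act P a n + act P b n
  act-+ʳ [] a b n = sym (+-identityˡ _)
  act-+ʳ (c ∷ P) a b n = trans (+-congˡ (act-+ʳ P a b (suc n)))
    (solve 5 (λ c x y u v → c :* (x :+ y) :+ (u :+ v) := (c :* x :+ u) :+ (c :* y :+ v)) refl c (a n) (b n) _ _)

  act-*ʳ : ∀ P k a n → act P (λ m → k * a m) n ≈ k * act P a n
  act-*ʳ [] k a n = sym (zeroʳ k)
  act-*ʳ (c ∷ P) k a n = trans (+-congˡ (act-*ʳ P k a (suc n)))
    (solve 4 (λ c k x u → c :* (k :* x) :+ k :* u := k :* (c :* x :+ u)) refl c k (a n) _)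

  act-*ʳʳ : ∀ P k a n → act P (λ m → a m * k) n ≈ act P a n * k
  act-*ʳʳ P k a n = trans (act-congʳ P (λ m → *-comm (a m) k) n) (trans (act-*ʳ P k a n) (*-comm _ _))

  act-0ʳ : ∀ P {a} → (∀ n → a n ≈ 0#) → ∀ n → act P a n ≈ 0#
  act-0ʳ [] e n = refl
  act-0ʳ (c ∷ P) e n = trans (+-cong (trans (*-congˡ (e n)) (zeroʳ c)) (act-0ʳ P e (suc n))) (+-identityˡ _)

  act-0ˡ : (∀ i → coeff P i ≈ 0#) → ∀ a n → act P a n ≈ 0#
  act-0ˡ {[]} e a n = refl
  act-0ˡ {c ∷ P} e a n = trans (+-cong (trans (*-congʳ (e 0)) (zeroˡ _)) (act-0ˡ {P} (λ i → e (suc i)) a (suc n))) (+-identityˡ _)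

  act-congˡ : P ≋ Q → ∀ a n → act P a n ≈ act Q a n
  act-congˡ {[]} {Q} e a n = sym (act-0ˡ {Q} (λ i → sym (at e i)) a n)
  act-congˡ {c ∷ P} {[]} e a n = act-0ˡ {c ∷ P} (at e) a n
  act-congˡ {c ∷ P} {d ∷ Q} e a n = +-cong (*-congʳ (at e 0)) (act-congˡ {P} {Q} (pw (λ i → at e (suc i))) a (suc n))

  act-⊞ : ∀ P Q a n → act (P ⊞ Q) a n ≈ act P a n + act Q a n
  act-⊞ [] Q a n = sym (+-identityˡ _)
  act-⊞ (c ∷ P) [] a n = sym (+-identityʳ _)
  act-⊞ (c ∷ P) (d ∷ Q) a n = trans (+-congˡ (act-⊞ P Q a (suc n)))
    (solve 5 (λ c d x u v → (c :+ d) :* x :+ (u :+ v) := (c :* x :+ u) :+ (d :* x :+ v)) refl c d (a n) _ _)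

  act-scale : ∀ k P a n → act (scale k P) a n ≈ k * act P a n
  act-scale k [] a n = sym (zeroʳ k)
  act-scale k (c ∷ P) a n = trans (+-congˡ (act-scale k P a (suc n)))
    (solve 4 (λ c k x u → (k :* c) :* x :+ k :* u := k :* (c :* x :+ u)) refl c k (a n) _)

  act-neg : ∀ P a n → act (neg P) a n ≈ - act P a n
  act-neg [] a n = solve 0 (con (+ 0) := :- con (+ 0)) refl
  act-neg (c ∷ P) a n = trans (+-congˡ (act-neg P a (suc n)))
    (solve 3 (λ c x u → (:- c) :* x :+ :- u := :- (c :* x :+ u)) refl c (a n) _)

  act-⊠ : ∀ P Q a n → act (P ⊠ Q) a n ≈ act P (act Q a) n
  act-⊠ [] Q a n = refl
  act-⊠ (c ∷ P) Q a n = begin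
    act (scale c Q ⊞ (0# ∷ P ⊠ Q)) a n               ≈⟨ act-⊞ (scale c Q) _ a n ⟩
    act (scale c Q) a n + (0# * a n + act (P ⊠ Q) a (suc n)) ≈⟨ +-cong (act-scale c Q a n) (trans (+-congʳ (zeroˡ _)) (trans (+-identityˡ _) (act-⊠ P Q a (suc n)))) ⟩
    c * act Q a n + act P (act Q a) (suc n)          ∎

  act-comm : ∀ P Q a n → act P (act Q a) n ≈ act Q (act P a) n
  act-comm [] Q a n = sym (act-0ʳ Q (λ _ → refl) n)
  act-comm (c ∷ P) Q a n = begin
    c * act Q a n + act P (act Q a) (suc n)                  ≈⟨ +-cong (act-*ʳ Q c a n) (sym (act-comm P Q a (suc n))) ⟨
    act Q (λ m → c * a m) n + act Q (act P a) (suc n)        ≈⟨ +-congˡ (act-shift Q (act P a) n) ⟨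
    act Q (λ m → c * a m) n + act Q (λ m → act P a (suc m)) n ≈⟨ act-+ʳ Q _ _ n ⟨
    act Q (act (c ∷ P) a) n                                  ∎

  unit : ℕ → ℕ → Carrier
  unit zero    zero    = 1#
  unit zero    (suc k) = 0#
  unit (suc i) zero    = 0#
  unit (suc i) (suc k) = unit i k

  act-unit : ∀ P i → act P (unit i) 0 ≈ coeff P i
  act-unit [] i = refl
  act-unit (c ∷ P) zero = begin
    c * 1# + act P (unit 0) 1               ≈⟨ +-cong (*-identityʳ c) (sym (act-shift P (unit 0) 0)) ⟩
    c + act P (λ m → unit 0 (suc m)) 0      ≈⟨ +-congˡ (act-0ʳ P (λ _ → refl) 0) ⟩
    c + 0#                                  ≈⟨ +-identityʳ c ⟩
    c                                       ∎
  act-unit (c ∷ P) (suc i) = begin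
    c * 0# + act P (unit (suc i)) 1         ≈⟨ +-cong (zeroʳ c) (sym (act-shift P (unit (suc i)) 0)) ⟩
    0# + act P (unit i) 0                   ≈⟨ +-identityˡ _ ⟩
    act P (unit i) 0                        ≈⟨ act-unit P i ⟩
    coeff P i                               ∎

  -- Acting on the indicator sequence of `i` returns the coefficient of index `i`. Consequently each
  -- ring law for polynomials follows from the corresponding law for operators, where the product is
  -- composition and associativity is immediate.
  act-ext : (∀ a → act P a 0 ≈ act Q a 0) → P ≋ Q
  act-ext {P} {Q} e = pw λ i → trans (sym (act-unit P i)) (trans (e (unit i)) (act-unit Q i))

  ⊞-cong : P ≋ P′ → Q ≋ Q′ → P ⊞ Q ≋ P′ ⊞ Q′
  ⊞-cong {P} {P′} {Q} {Q′} e f = act-ext λ a → trans (act-⊞ P Q a 0) (trans (+-cong (act-congˡ e a 0) (act-congˡ f a 0)) (sym (act-⊞ P′ Q′ a 0)))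

  ⊠-cong : P ≋ P′ → Q ≋ Q′ → P ⊠ Q ≋ P′ ⊠ Q′
  ⊠-cong {P} {P′} {Q} {Q′} e f = act-ext λ a → trans (act-⊠ P Q a 0)
    (trans (act-congˡ e _ 0) (trans (act-congʳ P′ (act-congˡ f a) 0) (sym (act-⊠ P′ Q′ a 0))))

  neg-cong : P ≋ Q → neg P ≋ neg Q
  neg-cong {P} {Q} e = act-ext λ a → trans (act-neg P a 0) (trans (-‿cong (act-congˡ e a 0)) (sym (act-neg Q a 0)))

  act-1 : ∀ a n → act (1# ∷ []) a n ≈ a n
  act-1 a n = trans (+-identityʳ _) (*-identityˡ _)

  poly : Ring
  poly = record
    { Carrier = List Carrier ; _≈_ = _≋_ ; _+_ = _⊞_ ; _*_ = _⊠_ ; -_ = neg ; 0# = [] ; 1# = 1# ∷ []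
    ; isCommutativeRing = record
      { isRing = record
        { +-isAbelianGroup = record
          { isGroup = record
            { isMonoid = record
              { isSemigroup = record
                { isMagma = record
                  { isEquivalence = record
                    { refl = pw λ i → refl ; sym = λ e → pw λ i → sym (at e i) ; trans = λ e f → pw λ i → trans (at e i) (at f i) }
                  ; ∙-cong = ⊞-cong }
                ; assoc = λ P Q S → act-ext λ a → trans (act-⊞ (P ⊞ Q) S a 0) (trans (+-congʳ (act-⊞ P Q a 0))
                    (trans (+-assoc _ _ _) (sym (trans (act-⊞ P (Q ⊞ S) a 0) (+-congˡ (act-⊞ Q S a 0)))))) }
              ; identity = (λ P → pw λ i → refl) , (λ P → act-ext λ a → trans (act-⊞ P [] a 0) (+-identityʳ _)) }
            ; inverse = (λ P → act-ext λ a → trans (act-⊞ (neg P) P a 0) (trans (+-congʳ (act-neg P a 0)) (-‿inverseˡ _)))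
                      , (λ P → act-ext λ a → trans (act-⊞ P (neg P) a 0) (trans (+-congˡ (act-neg P a 0)) (-‿inverseʳ _)))
            ; ⁻¹-cong = neg-cong }
          ; comm = λ P Q → act-ext λ a → trans (act-⊞ P Q a 0) (trans (+-comm _ _) (sym (act-⊞ Q P a 0))) }
        ; *-cong = ⊠-cong
        ; *-assoc = λ P Q S → act-ext λ a → trans (act-⊠ (P ⊠ Q) S a 0) (trans (act-⊠ P Q _ 0)
            (sym (trans (act-⊠ P (Q ⊠ S) a 0) (act-congʳ P (act-⊠ Q S a) 0))))
        ; *-identity = (λ P → act-ext λ a → trans (act-⊠ (1# ∷ []) P a 0) (act-1 (act P a) 0))
                     , (λ P → act-ext λ a → trans (act-⊠ P (1# ∷ []) a 0) (act-congʳ P (act-1 a) 0))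
        ; distrib = (λ P Q S → act-ext λ a → trans (act-⊠ P (Q ⊞ S) a 0) (trans (act-congʳ P (act-⊞ Q S a) 0)
                      (trans (act-+ʳ P _ _ 0) (sym (trans (act-⊞ (P ⊠ Q) (P ⊠ S) a 0) (+-cong (act-⊠ P Q a 0) (act-⊠ P S a 0)))))))
                  , (λ P Q S → act-ext λ a → trans (act-⊠ (Q ⊞ S) P a 0) (trans (act-⊞ Q S _ 0)
                      (sym (trans (act-⊞ (Q ⊠ P) (S ⊠ P) a 0) (+-cong (act-⊠ Q P a 0) (act-⊠ S P a 0)))))) }
      ; *-comm = λ P Q → act-ext λ a → trans (act-⊠ P Q a 0) (trans (act-comm P Q a 0) (sym (act-⊠ Q P a 0))) } }

  coeff-⊞ : ∀ P Q i → coeff (P ⊞ Q) i ≈ coeff P i + coeff Q i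
  coeff-⊞ P Q i = trans (sym (act-unit (P ⊞ Q) i)) (trans (act-⊞ P Q _ 0) (+-cong (act-unit P i) (act-unit Q i)))

  coeff-scale : ∀ k P i → coeff (scale k P) i ≈ k * coeff P i
  coeff-scale k P i = trans (sym (act-unit (scale k P) i)) (trans (act-scale k P _ 0) (*-congˡ (act-unit P i)))

  coeff-neg : ∀ P i → coeff (neg P) i ≈ - coeff P i
  coeff-neg P i = trans (sym (act-unit (neg P) i)) (trans (act-neg P _ 0) (-‿cong (act-unit P i)))

  ∷-cong : ∀ {c d} → c ≈ d → P ≋ Q → c ∷ P ≋ d ∷ Q
  ∷-cong e f = pw λ { zero → e ; (suc i) → at f i }

  -- The sequence of powers of `x` is an eigenvector of the shift with eigenvalue `x`. Evaluation
  -- thereby becomes an instance of `act`, and its multiplicativity an instance of `act-⊠`.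
  act-pow : ∀ P x n → act P (x ^_) n ≈ (x ^ n) * eval P x
  act-pow [] x n = sym (zeroʳ _)
  act-pow (c ∷ P) x n = trans (+-congˡ (act-pow P x (suc n)))
    (solve 4 (λ c u x v → c :* u :+ (x :* u) :* v := u :* (c :+ x :* v)) refl c (x ^ n) x _)

  eval-act : ∀ P x → eval P x ≈ act P (x ^_) 0
  eval-act P x = sym (trans (act-pow P x 0) (*-identityˡ _))

  evalʰ : Carrier → Hom poly R
  evalʰ x = record
    { fun = λ P → eval P x
    ; cong = λ {P} {Q} e → trans (eval-act P x) (trans (act-congˡ e _ 0) (sym (eval-act Q x)))
    ; +-homo = λ P Q → trans (eval-act (P ⊞ Q) x) (trans (act-⊞ P Q _ 0) (sym (+-cong (eval-act P x) (eval-act Q x))))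
    ; *-homo = λ P Q → begin
        eval (P ⊠ Q) x                    ≈⟨ eval-act (P ⊠ Q) x ⟩
        act (P ⊠ Q) (x ^_) 0              ≈⟨ act-⊠ P Q _ 0 ⟩
        act P (act Q (x ^_)) 0            ≈⟨ act-congʳ P (act-pow Q x) 0 ⟩
        act P (λ n → (x ^ n) * eval Q x) 0 ≈⟨ act-*ʳʳ P (eval Q x) _ 0 ⟩
        act P (x ^_) 0 * eval Q x         ≈⟨ *-congʳ (eval-act P x) ⟨
        eval P x * eval Q x               ∎
    ; 1-homo = trans (+-congˡ (zeroʳ x)) (+-identityʳ _) }

  eval-congʳ : ∀ P {x y} → x ≈ y → eval P x ≈ eval P y
  eval-congʳ [] e = refl
  eval-congʳ (c ∷ P) e = +-congˡ (*-cong e (eval-congʳ P e))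

  C : Carrier → List Carrier
  C c = c ∷ []

  Cʰ : Hom R poly
  Cʰ = record
    { fun = C ; cong = λ e → ∷-cong e (pw λ i → refl) ; +-homo = λ x y → pw λ i → refl
    ; *-homo = λ x y → pw λ { zero → sym (+-identityʳ _) ; (suc zero) → refl ; (suc (suc i)) → refl } ; 1-homo = pw λ i → refl }

  X : List Carrier
  X = 0# ∷ 1# ∷ []

  X-⊠ : ∀ P → X ⊠ P ≋ 0# ∷ P
  X-⊠ P = act-ext λ a → begin
    act (X ⊠ P) a 0                    ≈⟨ act-⊠ X P a 0 ⟩
    0# * act P a 0 + (1# * act P a 1 + 0#) ≈⟨ solve 2 (λ x y → con (+ 0) :* x :+ (con (+ 1) :* y :+ con (+ 0)) := y) refl _ _ ⟩
    act P a 1                          ≈⟨ trans (+-congʳ (zeroˡ _)) (+-identityˡ _) ⟨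
    0# * a 0 + act P a 1               ∎

  scale-⊠ : ∀ c P → C c ⊠ P ≋ scale c P
  scale-⊠ c P = act-ext λ a → trans (act-⊠ (C c) P a 0) (trans (+-identityʳ _) (sym (act-scale c P a 0)))

  ∷-split : ∀ c P → c ∷ P ≋ C c ⊞ X ⊠ P
  ∷-split c P = act-ext λ a → sym (trans (act-⊞ (C c) (X ⊠ P) a 0) (trans (+-congˡ (act-congˡ (X-⊠ P) a 0))
    (solve 3 (λ x y z → (x :* y :+ con (+ 0)) :+ (con (+ 0) :* y :+ z) := x :* y :+ z) refl c (a 0) (act P a 1))))

  eval-X : ∀ x → eval X x ≈ x
  eval-X x = solve 1 (λ x → con (+ 0) :+ x :* (con (+ 1) :+ x :* con (+ 0)) := x) refl x

  eval-C : ∀ c x → eval (C c) x ≈ c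
  eval-C c x = trans (+-congˡ (zeroʳ x)) (+-identityʳ c)

module _ {A B : Ring} (f : Hom A B) where
  private
    module A = Kit A
    module B = Kit B
    module F = Hom f
    module PA = Polynomial A
    module PB = Polynomial B

  coeff-map : ∀ P i → PB.coeff (map F.fun P) i B.≈ F.fun (PA.coeff P i)
  coeff-map [] i = B.sym F.0-homo
  coeff-map (c ∷ P) zero = B.refl
  coeff-map (c ∷ P) (suc i) = coeff-map P i

  eval-map : ∀ P x → F.fun (PA.eval P x) B.≈ PB.eval (map F.fun P) (F.fun x)
  eval-map [] x = F.0-homo
  eval-map (c ∷ P) x = B.trans (F.+-homo _ _) (B.+-congˡ (B.trans (F.*-homo _ _) (B.*-congˡ (eval-map P x))))

  act-map : ∀ P a n → F.fun (PA.act P a n) B.≈ PB.act (map F.fun P) (λ m → F.fun (a m)) n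
  act-map [] a n = F.0-homo
  act-map (c ∷ P) a n = B.trans (F.+-homo _ _) (B.+-cong (F.*-homo _ _) (act-map P a (suc n)))

mapʰ : ∀ {A B} → Hom A B → Hom (Polynomial.poly A) (Polynomial.poly B)
mapʰ {A} {B} f = record
  { fun = map F.fun
  ; cong = λ {P} {Q} e → PB.pw λ i → B.trans (coeff-map f P i) (B.trans (F.cong (PA.at e i)) (B.sym (coeff-map f Q i)))
  ; +-homo = map-⊞
  ; *-homo = map-⊠
  ; 1-homo = PB.∷-cong F.1-homo (PB.pw λ i → B.refl) }
  where
  module A = Kit A
  module B = Kit B
  module F = Hom f
  module PA = Polynomial A
  module PB = Polynomial B
  module LB = Kit (Polynomial.poly B)
  map-⊞ : ∀ P Q → map F.fun (P PA.⊞ Q) PB.≋ map F.fun P PB.⊞ map F.fun Q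
  map-⊞ [] Q = LB.refl
  map-⊞ (c ∷ P) [] = LB.refl
  map-⊞ (c ∷ P) (d ∷ Q) = PB.∷-cong (F.+-homo c d) (map-⊞ P Q)
  map-scale : ∀ c P → map F.fun (PA.scale c P) PB.≋ PB.scale (F.fun c) (map F.fun P)
  map-scale c [] = LB.refl
  map-scale c (d ∷ P) = PB.∷-cong (F.*-homo c d) (map-scale c P)
  map-⊠ : ∀ P Q → map F.fun (P PA.⊠ Q) PB.≋ map F.fun P PB.⊠ map F.fun Q
  map-⊠ [] Q = LB.refl
  map-⊠ (c ∷ P) Q = LB.trans (map-⊞ (PA.scale c Q) _) (LB.+-cong (map-scale c Q) (PB.∷-cong F.0-homo (map-⊠ P Q)))

map-cong : ∀ {A B} (f g : Hom A B) → (let module B = Kit B) → (∀ x → Hom.fun f x B.≈ Hom.fun g x) →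
  ∀ P → Polynomial._≋_ B (map (Hom.fun f) P) (map (Hom.fun g) P)
map-cong {A} {B} f g e P = Polynomial.pw λ i → B.trans (coeff-map f P i) (B.trans (e _) (B.sym (coeff-map g P i)))
  where module B = Kit B

-- Degrees, division, derivatives and linear factors

module Degree (R : Ring) where
  open Kit R
  open Polynomial R
  module L = Kit poly

  -- Only an upper bound on the degree: an exact degree would require knowing which coefficients
  -- vanish.
  DegLt : List Carrier → ℕ → Set
  DegLt P n = ∀ i → n ≤ i → coeff P i ≈ 0#

  degLt-length : ∀ P → DegLt P (length P)
  degLt-length [] i _ = refl
  degLt-length (c ∷ P) (suc i) (s≤s l) = degLt-length P i l

  degLt-cong : ∀ {P Q n} → P ≋ Q → DegLt P n → DegLt Q n
  degLt-cong e d i k = trans (sym (at e i)) (d i k)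

  degLt-⊞ : ∀ {P Q n} → DegLt P n → DegLt Q n → DegLt (P ⊞ Q) n
  degLt-⊞ {P} {Q} d e i k = trans (coeff-⊞ P Q i) (trans (+-cong (d i k) (e i k)) (+-identityˡ 0#))

  coeff-C⊠ : ∀ c P i → coeff (C c ⊠ P) i ≈ c * coeff P i
  coeff-C⊠ c P i = trans (at (scale-⊠ c P) i) (coeff-scale c P i)

  degLt-⊠ : ∀ P Q {n m} → DegLt P (suc n) → DegLt Q (suc m) →
    DegLt (P ⊠ Q) (suc (n ℕ.+ m)) × coeff (P ⊠ Q) (n ℕ.+ m) ≈ coeff P n * coeff Q m
  degLt-⊠ [] Q d e = (λ i k → refl) , sym (zeroˡ _)
  degLt-⊠ (c ∷ P) Q {zero} {m} d e = (λ i k → trans (eq i) (trans (*-congˡ (e i k)) (zeroʳ c))) , eq m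
    where
    eq : ∀ i → coeff ((c ∷ P) ⊠ Q) i ≈ c * coeff Q i
    eq i = trans (at (⊠-cong {Q = Q} (∷-cong {P} {[]} {c} refl (pw λ i → d (suc i) (s≤s z≤n))) L.refl) i) (coeff-C⊠ c Q i)
  degLt-⊠ (c ∷ P) Q {suc n} {m} d e = deg , top
    where
    IH = degLt-⊠ P Q {n} {m} (λ i k → d (suc i) (s≤s k)) e
    split : ∀ i → coeff ((c ∷ P) ⊠ Q) (suc i) ≈ c * coeff Q (suc i) + coeff (P ⊠ Q) i
    split i = trans (coeff-⊞ (scale c Q) (0# ∷ P ⊠ Q) (suc i)) (+-congʳ (coeff-scale c Q (suc i)))
    high : ∀ i → m ≤ i → c * coeff Q (suc i) ≈ 0#
    high i k = trans (*-congˡ (e (suc i) (s≤s k))) (zeroʳ c)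
    deg : DegLt ((c ∷ P) ⊠ Q) (suc (suc n ℕ.+ m))
    deg (suc i) (s≤s k) = trans (split i) (trans (+-cong (high i (ℕ.≤-trans (ℕ.m≤n+m m (suc n)) k)) (proj₁ IH i k)) (+-identityˡ 0#))
    top : coeff ((c ∷ P) ⊠ Q) (suc n ℕ.+ m) ≈ coeff P n * coeff Q m
    top = trans (split (n ℕ.+ m)) (trans (+-cong (high (n ℕ.+ m) (ℕ.m≤n+m m n)) (proj₂ IH)) (+-identityˡ _))

  record PseudoDivision (f d : List Carrier) (n : ℕ) : Set where
    constructor division
    field
      exponent  : ℕ
      quotient  : List Carrier
      remainder : List Carrier
      equation  : C (coeff d n ^ exponent) ⊠ f ≋ quotient ⊠ d ⊞ remainder
      degree    : DegLt remainder n

  -- Each step multiplies by the formal leading coefficient `l` of `d` instead of dividing by it, so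
  -- the algorithm runs in every commutative ring. For monic `d` the power of `l` is one and this is
  -- ordinary division.
  pseudoDivide : ∀ f {d n} → DegLt d (suc n) → PseudoDivision f d n
  pseudoDivide [] dd = division 0 [] [] (L.zeroʳ (C 1#)) (λ i k → refl)
  pseudoDivide (x ∷ f) {d} {n} dd = division (suc e) q r eq deg
    where
    open PseudoDivision (pseudoDivide f {d} {n} dd) renaming (exponent to e; quotient to q′; remainder to r′; equation to eq′; degree to deg′)
    l = coeff d n
    -- This is l^e x + X r′, whose degree is at most `n`. Its coefficient `y` at X^n is removed by
    -- passing to l r₁ - y d, where the two contributions l y and y l cancel.
    r₁ = (l ^ e) * x ∷ r′
    y = coeff r₁ n
    q = C l ⊠ (X ⊠ q′) ⊞ C y
    r = C l ⊠ r₁ ⊞ neg (C y ⊠ d)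
    eq : C (l ^ suc e) ⊠ (x ∷ f) ≋ q ⊠ d ⊞ r
    eq = L.trans (L.*-cong (Hom.*-homo Cʰ l (l ^ e)) (∷-split x f)) (L.trans
      (L.solve 5 (λ l L x X f → (l :* L) :* (x :+ X :* f) := l :* (L :* x :+ X :* (L :* f))) L.refl (C l) (C (l ^ e)) (C x) X f)
      (L.trans (L.*-congˡ {C l} (L.+-congˡ {C (l ^ e) ⊠ C x} (L.*-congˡ {X} eq′)))
      (L.trans (L.solve 7 (λ l Lx X q d r y → l :* (Lx :+ X :* (q :* d :+ r)) :=
          (l :* (X :* q) :+ y) :* d :+ (l :* (Lx :+ X :* r) :- y :* d)) L.refl (C l) (C (l ^ e) ⊠ C x) X q′ d r′ (C y))
       (L.+-congˡ {q ⊠ d} (L.+-congʳ {neg (C y ⊠ d)} (L.*-congˡ {C l} (L.sym (L.trans (∷-split _ r′) (L.+-congʳ {X ⊠ r′} (Hom.*-homo Cʰ (l ^ e) x))))))))))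
    coeff-r : ∀ i → coeff r i ≈ l * coeff r₁ i - y * coeff d i
    coeff-r i = trans (coeff-⊞ (C l ⊠ r₁) (neg (C y ⊠ d)) i) (+-cong (coeff-C⊠ l r₁ i) (trans (coeff-neg (C y ⊠ d) i) (-‿cong (coeff-C⊠ y d i))))
    deg₁ : DegLt r₁ (suc n)
    deg₁ (suc i) (s≤s k) = deg′ i k
    deg : DegLt r n
    deg i k with n ℕ.≟ i
    ... | yes ≡.refl = trans (coeff-r n) (solve 2 (λ l y → l :* y :- y :* l := con (+ 0)) refl l y)
    ... | no n≢i = trans (coeff-r i) (trans (+-cong (*-congˡ (deg₁ i n<i)) (-‿cong (*-congˡ (dd i n<i))))
            (solve 2 (λ l y → l :* con (+ 0) :- y :* con (+ 0) := con (+ 0)) refl l y))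
      where n<i = ℕ.≤∧≢⇒< k n≢i

  D : List Carrier → List Carrier
  D []      = []
  D (c ∷ P) = P ⊞ (0# ∷ D P)

  coeff-D : ∀ P i → coeff (D P) i ≈ ι (+ suc i) * coeff P (suc i)
  coeff-D [] i = sym (zeroʳ _)
  coeff-D (c ∷ P) zero = trans (coeff-⊞ P _ 0) (trans (+-identityʳ _) (sym (*-identityˡ _)))
  coeff-D (c ∷ P) (suc i) = trans (coeff-⊞ P _ (suc i)) (trans (+-congˡ (coeff-D P i))
    (sym (trans (*-congʳ (ι-+-homo (+ 1) (+ suc i))) (trans (distribʳ _ _ _) (+-congʳ (*-identityˡ _))))))

  D-cong : ∀ {P Q} → P ≋ Q → D P ≋ D Q
  D-cong {P} {Q} e = pw λ i → trans (coeff-D P i) (trans (*-congˡ (at e (suc i))) (sym (coeff-D Q i)))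

  D-⊞ : ∀ P Q → D (P ⊞ Q) ≋ D P ⊞ D Q
  D-⊞ P Q = pw λ i → trans (coeff-D (P ⊞ Q) i) (trans (*-congˡ (coeff-⊞ P Q (suc i))) (trans (distribˡ _ _ _)
    (sym (trans (coeff-⊞ (D P) (D Q) i) (+-cong (coeff-D P i) (coeff-D Q i))))))

  D-C⊠ : ∀ c P → D (C c ⊠ P) ≋ C c ⊠ D P
  D-C⊠ c P = pw λ i → trans (coeff-D (C c ⊠ P) i) (trans (*-congˡ (coeff-C⊠ c P (suc i)))
    (trans (solve 3 (λ x y z → x :* (y :* z) := y :* (x :* z)) refl _ c _)
    (sym (trans (coeff-C⊠ c (D P) i) (*-congˡ (coeff-D P i))))))

  D-X⊠ : ∀ P → D (X ⊠ P) ≋ P ⊞ X ⊠ D P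
  D-X⊠ P = L.trans (D-cong (X-⊠ P)) (L.+-congˡ {P} (L.sym (X-⊠ (D P))))

  D-⊠ : ∀ P Q → D (P ⊠ Q) ≋ D P ⊠ Q ⊞ P ⊠ D Q
  D-⊠ [] Q = L.refl
  D-⊠ (c ∷ P) Q = L.trans (D-cong (L.*-congʳ {Q} (∷-split c P))) (L.trans
    (D-cong (L.solve 4 (λ c X P Q → (c :+ X :* P) :* Q := c :* Q :+ X :* (P :* Q)) L.refl (C c) X P Q)) (L.trans
    (D-⊞ (C c ⊠ Q) (X ⊠ (P ⊠ Q))) (L.trans (L.+-cong (D-C⊠ c Q) (L.trans (D-X⊠ (P ⊠ Q)) (L.+-congˡ {P ⊠ Q} (L.*-congˡ {X} (D-⊠ P Q))))) (L.trans
    (L.solve 6 (λ c X P Q P′ Q′ → c :* Q′ :+ (P :* Q :+ X :* (P′ :* Q :+ P :* Q′)) :=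
        (P :+ X :* P′) :* Q :+ (c :+ X :* P) :* Q′) L.refl (C c) X P Q (D P) (D Q))
    (L.+-cong (L.*-congʳ {Q} (L.+-congˡ {P} (X-⊠ (D P)))) (L.*-congʳ {D Q} (L.sym (∷-split c P))))))))

  lin : Carrier → List Carrier
  lin t = (- t) ∷ 1# ∷ []

  lin≋ : ∀ t → lin t ≋ X ⊞ neg (C t)
  lin≋ t = pw λ { zero → sym (+-identityˡ _) ; (suc i) → refl }

  eval-lin : ∀ t x → eval (lin t) x ≈ x - t
  eval-lin t x = solve 2 (λ t x → :- t :+ x :* (con (+ 1) :+ x :* con (+ 0)) := x :- t) refl t x

  linProduct : List Carrier → List Carrier
  linProduct = foldr (λ t P → lin t ⊠ P) (C 1#)

  -- Horner's scheme.
  quo : List Carrier → Carrier → List Carrier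
  quo []      t = []
  quo (c ∷ P) t = eval P t ∷ quo P t

  quo-spec : ∀ P t → P ≋ lin t ⊠ quo P t ⊞ C (eval P t)
  quo-spec [] t = pw λ { zero → sym (+-identityˡ _)
                       ; (suc zero) → refl ; (suc (suc i)) → refl }
  quo-spec (c ∷ P) t = L.sym (L.trans (L.+-cong (L.*-cong (lin≋ t) (∷-split v (quo P t))) (L.trans (Hom.+-homo Cʰ c (t * v)) (L.+-congˡ {C c} (Hom.*-homo Cʰ t v)))) (L.trans
      (L.solve 5 (λ X t v q c → (X :- t) :* (v :+ X :* q) :+ (c :+ t :* v) := c :+ X :* ((X :- t) :* q :+ v)) L.refl X (C t) (C v) (quo P t) (C c))
      (L.trans (L.+-congˡ {C c} (L.*-congˡ {X} (L.sym (L.trans (quo-spec P t) (L.+-congʳ {C v} (L.*-congʳ {quo P t} (lin≋ t)))))))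
      (L.sym (∷-split c P)))))
    where v = eval P t

  factor : ∀ P t → eval P t ≈ 0# → P ≋ lin t ⊠ quo P t
  factor P t e = L.trans (quo-spec P t) (L.trans (L.+-congˡ {lin t ⊠ quo P t} (pw λ { zero → e ; (suc i) → refl })) (L.+-identityʳ (lin t ⊠ quo P t)))

  eval-0 : ∀ {P} t → P ≋ [] → eval P t ≈ 0#
  eval-0 t e = Hom.cong (evalʰ t) e

  eval-deg0 : ∀ {P} t → DegLt P 1 → eval P t ≈ coeff P 0
  eval-deg0 {P} t d = trans (Hom.cong (evalʰ t) {P} {C (coeff P 0)} (pw λ { zero → refl ; (suc i) → d (suc i) (s≤s z≤n) })) (eval-C _ t)

  quo-deg : ∀ P t {n} → DegLt P (suc n) → DegLt (quo P t) n
  quo-deg [] t d i k = refl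
  quo-deg (c ∷ P) t d zero z≤n = eval-0 {P} t (pw λ i → d (suc i) (s≤s z≤n))
  quo-deg (c ∷ P) t {n} d (suc i) k = quo-deg P t {i} (λ j l → d (suc j) (s≤s (ℕ.≤-trans k l))) i ℕ.≤-refl

  quo-top : ∀ P t {n} → DegLt P (suc (suc n)) → coeff (quo P t) n ≈ coeff P (suc n)
  quo-top [] t d = refl
  quo-top (c ∷ P) t {zero} d = eval-deg0 {P} t (λ j l → d (suc j) (s≤s l))
  quo-top (c ∷ P) t {suc n} d = quo-top P t (λ j l → d (suc j) (s≤s l))

module _ {A B : Ring} (f : Hom A B) where
  private
    module A = Kit A
    module B = Kit B
    module F = Hom f
    module PA = Polynomial A
    module PB = Polynomial B
    module DA = Degree A
    module DB = Degree B

  map-D : ∀ P → map F.fun (DA.D P) PB.≋ DB.D (map F.fun P)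
  map-D P = PB.pw λ i → B.trans (coeff-map f (DA.D P) i) (B.trans (F.cong (DA.coeff-D P i)) (B.trans (F.*-homo _ _)
    (B.trans (B.*-cong (F.ι-homo (+ suc i)) (B.sym (coeff-map f P (suc i)))) (B.sym (DB.coeff-D (map F.fun P) i)))))

  map-linProduct : ∀ ts → map F.fun (DA.linProduct ts) PB.≋ DB.linProduct (map F.fun ts)
  map-linProduct [] = Hom.1-homo (mapʰ f)
  map-linProduct (t ∷ ts) = DB.L.trans (Hom.*-homo (mapʰ f) (DA.lin t) (DA.linProduct ts))
    (PB.⊠-cong {map F.fun (DA.lin t)} {DB.lin (F.fun t)} {map F.fun (DA.linProduct ts)} (PB.∷-cong (F.neg-homo t) (PB.∷-cong {[]} {[]} F.1-homo (PB.pw λ i → B.refl))) (map-linProduct ts))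

  degLt-map : ∀ P {n} → DA.DegLt P n → DB.DegLt (map F.fun P) n
  degLt-map P d i k = B.trans (coeff-map f P i) (B.trans (F.cong (d i k)) F.0-homo)

-- Quotient rings and subrings

record Ideal (R : Ring) : Set₁ where
  private module R = Kit R
  field
    Mem      : R.Carrier → Set
    respects : ∀ {x y} → x R.≈ y → Mem x → Mem y
    zero-mem : Mem R.0#
    add      : ∀ {x y} → Mem x → Mem y → Mem (x R.+ y)
    absorb   : ∀ r {x} → Mem x → Mem (r R.* x)

module Quotient (R : Ring) (J : Ideal R) where
  open Kit R
  open Ideal J

  infix 4 _∼_
  record _∼_ (x y : Carrier) : Set where
    constructor diff
    field member : Mem (x - y)
  open _∼_ public

  private
    by : ∀ {x y z} → Mem z → z ≈ x - y → x ∼ y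
    by m e = diff (respects e m)

  ≈⇒∼ : ∀ {x y} → x ≈ y → x ∼ y
  ≈⇒∼ {x} {y} e = by zero-mem (trans (sym (-‿inverseʳ y)) (+-congʳ (sym e)))

  ring/ : Ring
  ring/ = record
    { Carrier = Carrier ; _≈_ = _∼_ ; _+_ = _+_ ; _*_ = _*_ ; -_ = -_ ; 0# = 0# ; 1# = 1#
    ; isCommutativeRing = record
      { isRing = record
        { +-isAbelianGroup = record
          { isGroup = record
            { isMonoid = record
              { isSemigroup = record
                { isMagma = record
                  { isEquivalence = record
                    { refl = ≈⇒∼ refl
                    ; sym = λ {x} {y} e → by (absorb (- 1#) (member e)) (solve 2 (λ x y → con -[1+ 0 ] :* (x :- y) := y :- x) refl x y)
                    ; trans = λ {x} {y} {z} e f → by (add (member e) (member f)) (solve 3 (λ x y z → (x :- y) :+ (y :- z) := x :- z) refl x y z) }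
                  ; ∙-cong = λ {x} {y} {u} {v} e f → by (add (member e) (member f)) (solve 4 (λ x y u v → (x :- y) :+ (u :- v) := (x :+ u) :- (y :+ v)) refl x y u v) }
                ; assoc = λ x y z → ≈⇒∼ (+-assoc x y z) }
              ; identity = (λ x → ≈⇒∼ (+-identityˡ x)) , (λ x → ≈⇒∼ (+-identityʳ x)) }
            ; inverse = (λ x → ≈⇒∼ (-‿inverseˡ x)) , (λ x → ≈⇒∼ (-‿inverseʳ x))
            ; ⁻¹-cong = λ {x} {y} e → by (absorb (- 1#) (member e)) (solve 2 (λ x y → con -[1+ 0 ] :* (x :- y) := (:- x) :- (:- y)) refl x y) }
          ; comm = λ x y → ≈⇒∼ (+-comm x y) }
        ; *-cong = λ {x} {y} {u} {v} e f → by (add (absorb u (member e)) (absorb y (member f))) (solve 4 (λ x y u v → u :* (x :- y) :+ y :* (u :- v) := (x :* u) :- (y :* v)) refl x y u v)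
        ; *-assoc = λ x y z → ≈⇒∼ (*-assoc x y z)
        ; *-identity = (λ x → ≈⇒∼ (*-identityˡ x)) , (λ x → ≈⇒∼ (*-identityʳ x))
        ; distrib = (λ x y z → ≈⇒∼ (distribˡ x y z)) , (λ x y z → ≈⇒∼ (distribʳ x y z)) }
      ; *-comm = λ x y → ≈⇒∼ (*-comm x y) } }

  proj : Hom R ring/
  proj = record { fun = λ x → x ; cong = ≈⇒∼ ; +-homo = λ _ _ → ≈⇒∼ refl ; *-homo = λ _ _ → ≈⇒∼ refl ; 1-homo = ≈⇒∼ refl }

  lift : ∀ {B} (f : Hom R B) → (∀ x → Mem x → CommutativeRing._≈_ B (Hom.fun f x) (CommutativeRing.0# B)) → Hom ring/ B
  lift {B} f vanish = record
    { fun = F.fun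
    ; cong = λ {x} {y} e → B.trans (B.solve 2 (λ x y → x := (x :+ :- y) :+ y) B.refl (F.fun x) (F.fun y))
        (B.trans (B.+-congʳ (B.trans (B.+-congˡ (B.sym (F.neg-homo y))) (B.trans (B.sym (F.+-homo x (- y))) (vanish _ (member e))))) (B.+-identityˡ _))
    ; +-homo = F.+-homo ; *-homo = F.*-homo ; 1-homo = F.1-homo }
    where
    module B = Kit B
    module F = Hom f

  mem⇒∼0 : ∀ {x} → Mem x → x ∼ 0#
  mem⇒∼0 {x} m = by m (solve 1 (λ x → x := x :- con (+ 0)) refl x)

  ∼0⇒mem : ∀ {x} → x ∼ 0# → Mem x
  ∼0⇒mem {x} e = respects (solve 1 (λ x → x :- con (+ 0) := x) refl x) (member e)

principal : ∀ R → ∣ R ∣ → Ideal R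
principal R g = record
  { Mem = λ x → ∃ λ q → x ≈ q * g
  ; respects = λ { e (q , f) → q , trans (sym e) f }
  ; zero-mem = 0# , sym (zeroˡ g)
  ; add = λ { (q , e) (r , f) → q + r , trans (+-cong e f) (sym (distribʳ g q r)) }
  ; absorb = λ { r (q , e) → r * q , trans (*-congˡ e) (sym (*-assoc r q g)) } }
  where open Kit R

kernel : ∀ {A B} → Hom A B → Ideal A
kernel {A} {B} f = record
  { Mem = λ x → fun x ≈ 0#
  ; respects = λ e m → trans (sym (cong e)) m
  ; zero-mem = 0-homo
  ; add = λ m n → trans (+-homo _ _) (trans (+-cong m n) (+-identityˡ 0#))
  ; absorb = λ r m → trans (*-homo _ _) (trans (*-congˡ m) (zeroʳ _)) }
  where
  open Kit B
  open Hom f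

record Closed (R : Ring) (P : ∣ R ∣ → Set) : Set where
  open Kit R
  field
    +-closed : ∀ {x y} → P x → P y → P (x + y)
    *-closed : ∀ {x y} → P x → P y → P (x * y)
    neg-closed : ∀ {x} → P x → P (- x)
    1-closed : P 1#
    0-closed : P 0#

module Subring (R : Ring) {P : ∣ R ∣ → Set} (closed : Closed R P) where
  open Kit R
  open Closed closed

  infix 4 _≐_
  -- Equality ignores the evidence, so `P` may carry data; the localised ring later stores a chosen
  -- fraction there.
  record _≐_ (x y : Σ Carrier P) : Set where
    constructor same
    field equal : proj₁ x ≈ proj₁ y
  open _≐_ public

  sub : Ring
  sub = record
    { Carrier = Σ Carrier P ; _≈_ = _≐_
    ; _+_ = λ { (x , p) (y , q) → x + y , +-closed p q }
    ; _*_ = λ { (x , p) (y , q) → x * y , *-closed p q }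
    ; -_ = λ { (x , p) → - x , neg-closed p } ; 0# = 0# , 0-closed ; 1# = 1# , 1-closed
    ; isCommutativeRing = record
      { isRing = record
        { +-isAbelianGroup = record
          { isGroup = record
            { isMonoid = record
              { isSemigroup = record
                { isMagma = record
                  { isEquivalence = record
                    { refl = same refl ; sym = λ e → same (sym (equal e)) ; trans = λ e f → same (trans (equal e) (equal f)) }
                  ; ∙-cong = λ e f → same (+-cong (equal e) (equal f)) }
                ; assoc = λ x y z → same (+-assoc _ _ _) }
              ; identity = (λ x → same (+-identityˡ _)) , (λ x → same (+-identityʳ _)) }
            ; inverse = (λ x → same (-‿inverseˡ _)) , (λ x → same (-‿inverseʳ _))
            ; ⁻¹-cong = λ e → same (-‿cong (equal e)) }
          ; comm = λ x y → same (+-comm _ _) }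
        ; *-cong = λ e f → same (*-cong (equal e) (equal f))
        ; *-assoc = λ x y z → same (*-assoc _ _ _)
        ; *-identity = (λ x → same (*-identityˡ _)) , (λ x → same (*-identityʳ _))
        ; distrib = (λ x y z → same (distribˡ _ _ _)) , (λ x y z → same (distribʳ _ _ _)) }
      ; *-comm = λ x y → same (*-comm _ _) } }

  include : Hom sub R
  include = record { fun = proj₁ ; cong = equal ; +-homo = λ _ _ → refl ; *-homo = λ _ _ → refl ; 1-homo = refl }

-- Linear dependence over ℤ

NonZeroVec : ∀ {n} → Vec ℤ n → Set
NonZeroVec cs = ∃ λ i → lookup cs i ≢ + 0

NonZeroPolyℤ : List ℤ → Set
NonZeroPolyℤ f = ∃ λ i → Polynomial.coeff ℤᴿ f i ≢ + 0

module Combination (R : Ring) where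
  open Kit R

  comb : ∀ {n} → Vec ℤ n → Vec Carrier n → Carrier
  comb []       []       = 0#
  comb (c ∷ cs) (w ∷ ws) = ι c * w + comb cs ws

  comb-zero : ∀ {n} (ws : Vec Carrier n) → comb (replicate n (+ 0)) ws ≈ 0#
  comb-zero [] = refl
  comb-zero (w ∷ ws) = trans (+-cong (zeroˡ w) (comb-zero ws)) (+-identityˡ 0#)

  comb-++ : ∀ {m n} (cs : Vec ℤ m) (ds : Vec ℤ n) vs ws → comb (cs Vec.++ ds) (vs Vec.++ ws) ≈ comb cs vs + comb ds ws
  comb-++ [] ds [] ws = sym (+-identityˡ _)
  comb-++ (c ∷ cs) ds (v ∷ vs) ws = trans (+-congˡ (comb-++ cs ds vs ws)) (sym (+-assoc _ _ _))

  comb-*ˡ : ∀ {n} x (cs : Vec ℤ n) ws → x * comb cs ws ≈ comb cs (Vec.map (x *_) ws)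
  comb-*ˡ x [] [] = zeroʳ x
  comb-*ˡ x (c ∷ cs) (w ∷ ws) = trans (solve 4 (λ x c w s → x :* (c :* w :+ s) := c :* (x :* w) :+ x :* s) refl x (ι c) w _)
    (+-congˡ (comb-*ˡ x cs ws))

  comb-linear : ∀ {n} a b (cs ds : Vec ℤ n) ws →
    comb (zipWith (λ x y → a ℤ.* x ℤ.- b ℤ.* y) cs ds) ws ≈ ι a * comb cs ws - ι b * comb ds ws
  comb-linear a b [] [] [] = solve 2 (λ a b → con (+ 0) := a :* con (+ 0) :- b :* con (+ 0)) refl (ι a) (ι b)
  comb-linear a b (c ∷ cs) (d ∷ ds) (w ∷ ws) = trans
    (+-cong (*-congʳ (trans (ι-+-homo (a ℤ.* c) _) (+-cong (ι-*-homo a c) (trans (ι-neg-homo (b ℤ.* d)) (-‿cong (ι-*-homo b d)))))) (comb-linear a b cs ds ws))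
    (solve 7 (λ a b c d w u v → (a :* c :- b :* d) :* w :+ (a :* u :- b :* v) := a :* (c :* w :+ u) :- b :* (d :* w :+ v)) refl
      (ι a) (ι b) (ι c) (ι d) w _ _)

  comb-congʳ : ∀ {n} (cs : Vec ℤ n) {A : Set} (M : Vec A n) (f g : A → Carrier) →
    (∀ i → f (lookup M i) ≈ g (lookup M i)) → comb cs (Vec.map f M) ≈ comb cs (Vec.map g M)
  comb-congʳ [] [] f g e = refl
  comb-congʳ (c ∷ cs) (x ∷ M) f g e = +-cong (*-congˡ (e zero)) (comb-congʳ cs M f g (λ i → e (suc i)))

  comb-insertAt : ∀ {n} {A : Set} (f : A → Carrier) (cs : Vec ℤ n) (M : Vec A (suc n)) i c →
    comb (insertAt cs i c) (Vec.map f M) ≈ ι c * f (lookup M i) + comb cs (Vec.map f (removeAt M i))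
  comb-insertAt f cs (x ∷ M) zero c = refl
  comb-insertAt f (d ∷ cs) (x ∷ M@(_ ∷ _)) (suc i) c = trans (+-congˡ (comb-insertAt f cs M i c))
    (solve 3 (λ x y z → x :+ (y :+ z) := y :+ (x :+ z)) refl _ _ _)

  module _ {d} (w : Carrier) (ws : Vec Carrier d) where
    private
      h : Vec ℤ (suc d) → ℤ
      h = Vec.head
      ⟦_⟧ : Vec ℤ (suc d) → Carrier
      ⟦ r ⟧ = comb r (w ∷ ws)

    eliminate : ℤ → Vec ℤ (suc d) → Vec ℤ (suc d) → Vec ℤ d
    eliminate a p r = zipWith (λ x y → a ℤ.* x ℤ.- h r ℤ.* y) (Vec.tail r) (Vec.tail p)

    comb-eliminate : ∀ p r → comb (eliminate (h p) p r) ws ≈ ι (h p) * ⟦ r ⟧ - ι (h r) * ⟦ p ⟧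
    comb-eliminate (a ∷ p) (b ∷ r) = trans (comb-linear a b r p ws)
      (solve 5 (λ a b u v w → a :* u :- b :* v := a :* (b :* w :+ u) :- b :* (a :* w :+ v)) refl (ι a) (ι b) _ _ w)

    weight : ∀ {n} → Vec ℤ n → Vec (Vec ℤ (suc d)) n → ℤ
    weight [] [] = + 0
    weight (c ∷ cs) (r ∷ N) = c ℤ.* h r ℤ.+ weight cs N

    comb-eliminated : ∀ {n} p (cs : Vec ℤ n) N →
      comb cs (Vec.map (λ r → comb (eliminate (h p) p r) ws) N) ≈
      comb (Vec.map (h p ℤ.*_) cs) (Vec.map ⟦_⟧ N) - ι (weight cs N) * ⟦ p ⟧
    comb-eliminated p [] [] = solve 1 (λ p → con (+ 0) := con (+ 0) :- con (+ 0) :* p) refl ⟦ p ⟧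
    comb-eliminated p (c ∷ cs) (r ∷ N) = trans (+-cong (*-congˡ (comb-eliminate p r)) (comb-eliminated p cs N))
      (trans (solve 7 (λ c a r b p s t → c :* (a :* r :- b :* p) :+ (s :- t :* p) := ((a :* c) :* r :+ s) :- (c :* b :+ t) :* p) refl
        (ι c) (ι (h p)) ⟦ r ⟧ (ι (h r)) ⟦ p ⟧ _ (ι (weight cs N)))
      (+-cong (+-congʳ (*-congʳ (sym (ι-*-homo (h p) c)))) (-‿cong (*-congʳ
        (sym (trans (ι-+-homo (c ℤ.* h r) _) (+-congʳ (ι-*-homo c (h r)))))))))

  -- Fraction-free Gaussian elimination over ℤ. A row `p` with nonzero head a replaces every other
  -- row `r` by a r - (head r) p, which has head zero and lives in one dimension less.
  dependence : ∀ {d} (ws : Vec Carrier d) (M : Vec (Vec ℤ d) (suc d)) →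
    ∃ λ cs → NonZeroVec cs × comb cs (Vec.map (λ r → comb r ws) M) ≈ 0#
  dependence [] ([] ∷ []) = (+ 1 ∷ []) , (zero , λ ()) , trans (+-congʳ (zeroʳ _)) (+-identityˡ 0#)
  dependence {suc d} (w ∷ ws) M with any? (λ i → ¬? (Vec.head (lookup M i) ℤ.≟ + 0))
  -- A relation with coefficients c_j between the eliminated rows pulls back to one with a c_j on
  -- the original rows and -t on the pivot, t being the sum of the c_j (head r_j). It stays
  -- nontrivial because a ≠ 0 and ℤ has no zero divisors.
  ... | yes (i , a≢0) = insertAt cs′ i (ℤ.- t) , (punchIn i j , nz) , eq
    where
    p = lookup M i
    N = removeAt M i
    IH = dependence ws (Vec.map (eliminate w ws (Vec.head p) p) N)
    cs = proj₁ IH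
    cs′ = Vec.map (Vec.head p ℤ.*_) cs
    t = weight w ws cs N
    j = proj₁ (proj₁ (proj₂ IH))
    nz : lookup (insertAt cs′ i (ℤ.- t)) (punchIn i j) ≢ + 0
    nz e = [ a≢0 , proj₂ (proj₁ (proj₂ IH)) ]′ (ℤ.i*j≡0⇒i≡0∨j≡0 _
      (≡.trans (≡.sym (lookup-map j (Vec.head p ℤ.*_) cs)) (≡.trans (≡.sym (insertAt-punchIn cs′ i (ℤ.- t) j)) e)))
    eq : comb (insertAt cs′ i (ℤ.- t)) (Vec.map (λ r → comb r (w ∷ ws)) M) ≈ 0#
    eq = begin
      comb (insertAt cs′ i (ℤ.- t)) (Vec.map (λ r → comb r (w ∷ ws)) M)   ≈⟨ comb-insertAt _ cs′ M i (ℤ.- t) ⟩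
      ι (ℤ.- t) * comb p (w ∷ ws) + s                      ≈⟨ trans (+-congʳ (*-congʳ (ι-neg-homo t))) (solve 3 (λ t p s → (:- t) :* p :+ s := s :- t :* p) refl (ι t) _ s) ⟩
      s - ι t * comb p (w ∷ ws)                            ≈⟨ comb-eliminated w ws p cs N ⟨
      comb cs (Vec.map (λ r → comb (eliminate w ws (Vec.head p) p r) ws) N)  ≡⟨ ≡.cong (comb cs) (map-∘ (λ r → comb r ws) (eliminate w ws (Vec.head p) p) N) ⟩
      comb cs (Vec.map (λ r → comb r ws) (Vec.map (eliminate w ws (Vec.head p) p) N)) ≈⟨ proj₂ (proj₂ IH) ⟩
      0# ∎
      where
      s = comb cs′ (Vec.map (λ r → comb r (w ∷ ws)) N)
  -- All heads vanish, so the rows already lie in dimension `d`, and one row more than necessary is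
  -- at hand: the first gets coefficient zero.
  dependence {suc d} (w ∷ ws) M@(_ ∷ N) | no ¬p = + 0 ∷ cs , (suc (proj₁ nz) , proj₂ nz) , trans (+-congʳ (zeroˡ _)) (trans (+-identityˡ _) eq)
    where
    IH = dependence ws (Vec.map Vec.tail N)
    cs = proj₁ IH
    nz = proj₁ (proj₂ IH)
    drop-head : ∀ r → Vec.head r ≡ + 0 → comb r (w ∷ ws) ≈ comb (Vec.tail r) ws
    drop-head (_ ∷ r) ≡.refl = trans (+-congʳ (zeroˡ w)) (+-identityˡ _)
    eq : comb cs (Vec.map (λ r → comb r (w ∷ ws)) N) ≈ 0#
    eq = trans (comb-congʳ cs N _ _ (λ i → drop-head (lookup N i) (decidable-stable (_ ℤ.≟ _) (λ h → ¬p (suc i , h)))))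
      (trans (reflexive (≡.cong (comb cs) (map-∘ (λ r → comb r ws) Vec.tail N))) (proj₂ (proj₂ IH)))

-- A bound on the rank over ℤ: it is less than `n`. In contrast to a finite spanning family, this
-- property passes to subrings as well as to quotients.
Dependent : Ring → ℕ → Set
Dependent R n = ∀ (vs : Vec ∣ R ∣ n) → ∃ λ cs → NonZeroVec cs × comb cs vs ≈ 0#
  where
  open Kit R
  open Combination R

record Spanned (R : Ring) : Set where
  open Kit R
  open Combination R
  field
    {dim} : ℕ
    gens  : Vec Carrier dim
    span  : ∀ x → ∃ λ cs → x ≈ comb cs gens

module _ {A B : Ring} (f : Hom A B) where
  private
    module A = Kit A
    module B = Kit B
    module F = Hom f
    module CA = Combination A
    module CB = Combination B

  comb-homo : ∀ {n} (cs : Vec ℤ n) ws → F.fun (CA.comb cs ws) B.≈ CB.comb cs (Vec.map F.fun ws)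
  comb-homo [] [] = F.0-homo
  comb-homo (c ∷ cs) (w ∷ ws) = B.trans (F.+-homo _ _) (B.+-cong (B.trans (F.*-homo _ _) (B.*-congʳ (F.ι-homo c))) (comb-homo cs ws))

module _ (R : Ring) where
  open Kit R
  open Combination R
  open Polynomial R

  spanned⇒dependent : (s : Spanned R) → Dependent R (suc (Spanned.dim s))
  spanned⇒dependent s vs = proj₁ dep , proj₁ (proj₂ dep) , trans (expand (proj₁ dep) vs) (proj₂ (proj₂ dep))
    where
    open Spanned s
    dep = dependence gens (Vec.map (λ v → proj₁ (span v)) vs)
    expand : ∀ {n} (cs : Vec ℤ n) vs → comb cs vs ≈ comb cs (Vec.map (λ r → comb r gens) (Vec.map (λ v → proj₁ (span v)) vs))
    expand [] [] = refl
    expand (c ∷ cs) (v ∷ vs) = +-cong (*-congˡ (proj₂ (span v))) (expand cs vs)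

  powers : ∀ n → Carrier → Carrier → Vec Carrier n
  powers zero    y x = []
  powers (suc n) y x = y ∷ powers n (x * y) x

  comb-powers : ∀ {n} (cs : Vec ℤ n) y x → comb cs (powers n y x) ≈ y * eval (List.map ι (toList cs)) x
  comb-powers [] y x = sym (zeroʳ y)
  comb-powers (c ∷ cs) y x = trans (+-congˡ (comb-powers cs (x * y) x))
    (solve 4 (λ c y x v → c :* y :+ (x :* y) :* v := y :* (c :+ x :* v)) refl (ι c) y x _)

  coeff-toList : ∀ {n} (cs : Vec ℤ n) i → Polynomial.coeff ℤᴿ (toList cs) (toℕ i) ≡ lookup cs i
  coeff-toList (c ∷ cs) zero = ≡.refl
  coeff-toList (c ∷ cs) (suc i) = coeff-toList cs i

  algebraic : ∀ {n} → Dependent R n → ∀ x → ∃ λ f → NonZeroPolyℤ f × eval (List.map ι f) x ≈ 0#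
  algebraic dep x with dep (powers _ 1# x)
  ... | cs , (i , nz) , e = toList cs , (toℕ i , λ z → nz (≡.trans (≡.sym (coeff-toList cs i)) z)) ,
        trans (sym (*-identityˡ _)) (trans (sym (comb-powers cs 1# x)) e)

-- Splitting rings

Monic : (A : Ring) → List ∣ A ∣ → ℕ → Set
Monic A h m = DegLt h (suc m) × coeff h m ≈ 1#
  where
  open Kit A
  open Polynomial A
  open Degree A

monic-map : ∀ {A B} (f : Hom A B) h {m} → Monic A h m → Monic B (map (Hom.fun f) h) m
monic-map {A} {B} f h {m} (d , e) = degLt-map f h d , B.trans (coeff-map f h m) (B.trans (F.cong e) F.1-homo)
  where
  module B = Kit B
  module F = Hom f

-- Only additivity and 1 ↦ 1 are required: this suffices to see that an integer divisible by p
-- in S is divisible by p in ℤ.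
record Retraction (S A : Ring) : Set where
  private
    module S = Kit S
    module A = Kit A
  field
    fun    : S.Carrier → A.Carrier
    cong   : ∀ {x y} → x S.≈ y → fun x A.≈ fun y
    +-homo : ∀ x y → fun (x S.+ y) A.≈ fun x A.+ fun y
    1-homo : fun S.1# A.≈ A.1#

  0-homo : fun S.0# A.≈ A.0#
  0-homo = begin
    z              ≈⟨ A.solve 1 (λ z → z := z :+ z :- z) A.refl z ⟩
    z + z - z      ≈⟨ A.+-congʳ (+-homo S.0# S.0#) ⟨
    fun (S.0# S.+ S.0#) - z ≈⟨ A.+-congʳ (cong (S.+-identityˡ S.0#)) ⟩
    z - z          ≈⟨ A.-‿inverseʳ z ⟩
    A.0#           ∎
    where open A ; z = fun S.0#

  ι⁺-linear : ∀ n x → fun (S.ι (+ n) S.* x) A.≈ A.ι (+ n) A.* fun x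
  ι⁺-linear zero x = A.trans (cong (S.zeroˡ x)) (A.trans 0-homo (A.sym (A.zeroˡ _)))
  ι⁺-linear (suc n) x = begin
    fun (S.ι (+ suc n) S.* x)         ≈⟨ cong (S.trans (S.*-congʳ (S.ι-+-homo (+ 1) (+ n))) (S.trans (S.distribʳ x _ _) (S.+-congʳ (S.*-identityˡ x)))) ⟩
    fun (x S.+ S.ι (+ n) S.* x)       ≈⟨ +-homo _ _ ⟩
    fun x + fun (S.ι (+ n) S.* x)     ≈⟨ +-cong (sym (*-identityˡ _)) (ι⁺-linear n x) ⟩
    1# * fun x + A.ι (+ n) * fun x    ≈⟨ trans (*-congʳ (A.ι-+-homo (+ 1) (+ n))) (A.distribʳ (fun x) _ _) ⟨
    A.ι (+ suc n) * fun x             ∎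
    where open A

  ι-linear : ∀ m x → fun (S.ι m S.* x) A.≈ A.ι m A.* fun x
  ι-linear (+ n) x = ι⁺-linear n x
  ι-linear -[1+ n ] x = begin
    u                     ≈⟨ solve 2 (λ u v → u := (u :+ v) :- v) refl u v ⟩
    (u + v) - v           ≈⟨ +-cong (sym (+-homo _ _)) (-‿cong (ι⁺-linear (suc n) x)) ⟩
    fun (S.ι -[1+ n ] S.* x S.+ S.ι (+ suc n) S.* x) - A.ι (+ suc n) * fun x
      ≈⟨ +-congʳ (trans (cong (S.solve 2 (λ k x → (:- k) :* x :+ k :* x := con (+ 0)) S.refl (S.ι (+ suc n)) x)) 0-homo) ⟩
    0# - A.ι (+ suc n) * fun x   ≈⟨ solve 2 (λ k x → con (+ 0) :- k :* x := (:- k) :* x) refl _ _ ⟩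
    A.ι -[1+ n ] * fun x ∎
    where open A ; u = fun (S.ι -[1+ n ] S.* x) ; v = fun (S.ι (+ suc n) S.* x)

  ι-homo : ∀ m → fun (S.ι m) A.≈ A.ι m
  ι-homo m = A.trans (cong (S.sym (S.*-identityʳ _))) (A.trans (ι-linear m S.1#) (A.trans (A.*-congˡ 1-homo) (A.*-identityʳ _)))

module Adjoin (A : Ring) (h : List ∣ A ∣) {m : ℕ} (monic : Monic A h m) where
  open Kit A
  open Polynomial A
  open Degree A
  open Combination poly using () renaming (comb to combP; comb-++ to combP-++; comb-*ˡ to combP-*ˡ; comb-zero to combP-zero)

  divide : ∀ f → ∃ λ q → ∃ λ r → f ≋ q ⊠ h ⊞ r × DegLt r m
  divide f = quotient , remainder , L.trans (L.sym unscale) equation , degree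
    where
    open PseudoDivision (pseudoDivide f {h} {m} (proj₁ monic))
    one^ : ∀ e → coeff h m ^ e ≈ 1#
    one^ zero = refl
    one^ (suc e) = trans (*-cong (proj₂ monic) (one^ e)) (*-identityˡ 1#)
    unscale : C (coeff h m ^ exponent) ⊠ f ≋ f
    unscale = L.trans (L.*-congʳ {f} (Hom.cong Cʰ (one^ exponent))) (L.*-identityˡ f)

  -- Monicity of `h` makes the top coefficient of `q` reappear as a coefficient of q h beyond the
  -- degree of `r`, so it vanishes, and the degree bound on `q` can be lowered down to zero. This
  -- gives uniqueness of remainders without any domain hypothesis.
  multiple-degree : ∀ q r → q ⊠ h ≋ r → DegLt r m → q ≋ []
  multiple-degree q r e d = pw λ i → go (List.length q) (degLt-length q) i z≤n
    where
    go : ∀ k → DegLt q k → DegLt q 0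
    go zero dq = dq
    go (suc k) dq = go k λ i k≤i → [ (λ k<i → dq i k<i) , (λ { ≡.refl → top }) ]′ (ℕ.m≤n⇒m<n∨m≡n k≤i)
      where
      top : coeff q k ≈ 0#
      top = begin
        coeff q k                 ≈⟨ trans (*-congˡ (proj₂ monic)) (*-identityʳ _) ⟨
        coeff q k * coeff h m     ≈⟨ proj₂ (degLt-⊠ q h {k} {m} dq (proj₁ monic)) ⟨
        coeff (q ⊠ h) (k ℕ.+ m)   ≈⟨ at e (k ℕ.+ m) ⟩
        coeff r (k ℕ.+ m)         ≈⟨ d (k ℕ.+ m) (ℕ.m≤n+m m k) ⟩
        0#                        ∎

  open Quotient poly (principal poly h) public using () renaming (ring/ to adjoin; proj to projection; _∼_ to _≈ʰ_; diff to diffʰ; member to memberʰ)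
  private
    open Quotient poly (principal poly h)
    module Q = Kit adjoin

  embed : Hom A adjoin
  embed = projection ∘ʰ Cʰ

  root : ∣ adjoin ∣
  root = X

  eval-root : ∀ P → Polynomial.eval adjoin (map (Hom.fun embed) P) root Q.≈ P
  eval-root [] = Q.refl
  eval-root (c ∷ P) = Q.trans (Q.+-congˡ {C c} (Q.*-congˡ {X} (eval-root P))) (≈⇒∼ (L.sym (∷-split c P)))

  root-spec : Polynomial.eval adjoin (map (Hom.fun embed) h) root Q.≈ []
  root-spec = Q.trans (eval-root h) (mem⇒∼0 {h} (C 1# , L.sym (L.*-identityˡ h)))

  extend : ∀ {B} (φ : Hom A B) x → CommutativeRing._≈_ B (Polynomial.eval B (map (Hom.fun φ) h) x) (CommutativeRing.0# B) →
    ∃ λ (ψ : Hom adjoin B) → (∀ a → CommutativeRing._≈_ B (Hom.fun ψ (Hom.fun embed a)) (Hom.fun φ a)) × CommutativeRing._≈_ B (Hom.fun ψ root) x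
  extend {B} φ x e = lift ev vanish , (λ a → Polynomial.eval-C B _ x) ,
      B.trans (B.+-cong F.0-homo (B.*-congˡ (B.+-congʳ F.1-homo))) (Polynomial.eval-X B x)
    where
    module B = Kit B
    module F = Hom φ
    ev : Hom poly B
    ev = Polynomial.evalʰ B x ∘ʰ mapʰ φ
    vanish : ∀ P → Ideal.Mem (principal poly h) P → Hom.fun ev P B.≈ B.0#
    vanish P (q , f) = B.trans (Hom.cong ev f) (B.trans (Hom.*-homo ev q h) (B.trans (B.*-congˡ e) (B.zeroʳ _)))

  spanBelow : (s : Spanned A) (k : ℕ) → Vec (List Carrier) (k ℕ.* Spanned.dim s)
  spanBelow s zero = []
  spanBelow s (suc k) = Vec.map C (Spanned.gens s) Vec.++ Vec.map (X ⊠_) (spanBelow s k)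

  spanBelow-spec : ∀ s k r → DegLt r k → ∃ λ cs → r ≋ combP cs (spanBelow s k)
  spanBelow-spec s zero r d = [] , pw (λ i → d i z≤n)
  spanBelow-spec s (suc k) [] d = replicate _ (+ 0) , L.sym (combP-zero (spanBelow s (suc k)))
  spanBelow-spec s (suc k) (c ∷ r) d = proj₁ low Vec.++ proj₁ high ,
      L.trans (∷-split c r) (L.sym (L.trans (combP-++ (proj₁ low) (proj₁ high) _ _)
        (L.+-cong (L.sym (L.trans (Hom.cong Cʰ (proj₂ low)) (comb-homo Cʰ (proj₁ low) (Spanned.gens s))))
                  (L.sym (L.trans (L.*-congˡ {X} (proj₂ high)) (combP-*ˡ X (proj₁ high) (spanBelow s k)))))))
    where
    low = Spanned.span s c
    high = spanBelow-spec s k r (λ i k≤i → d (suc i) (s≤s k≤i))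

  adjoin-spanned : Spanned A → Spanned adjoin
  -- The mapped identity is the projection to the quotient, which leaves elements unchanged; written
  -- this way the generators have the form delivered by `comb-homo`.
  adjoin-spanned s = record { gens = Vec.map (λ P → P) (spanBelow s m) ; span = λ P →
    let (q , r , e , d) = divide P
        (cs , f) = spanBelow-spec s m r d
    in cs , Q.trans (diffʰ (q , L.trans (L.+-congʳ {neg r} e) (L.solve 2 (λ a r → a :+ r :- r := a) L.refl (q ⊠ h) r)))
         (Q.trans (≈⇒∼ f) (comb-homo projection cs (spanBelow s m))) }

-- Take the constant coefficient of the remainder modulo `h`. Uniqueness of remainders makes it well
-- defined and additive, and since `h` has positive degree the polynomial 1 is its own remainder.
retraction : ∀ A h {m} (monic : Monic A h (suc m)) → Retraction (Adjoin.adjoin A h monic) A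
retraction A h {m} monic = record
  { fun = λ P → coeff (rem P) 0
  ; cong = λ {P} {Q} e → unique P Q e
  ; +-homo = λ P Q → trans (sym (unique′ (P ⊞ Q) (rem P ⊞ rem Q) (q P ⊞ q Q)
       (L.trans (L.+-cong (spec P) (spec Q)) (L.solve 5 (λ a b h r s → (a :* h :+ r) :+ (b :* h :+ s) := (a :+ b) :* h :+ (r :+ s)) L.refl (q P) (q Q) h (rem P) (rem Q)))
       (degLt-⊞ {rem P} {rem Q} (deg P) (deg Q)))) (coeff-⊞ (rem P) (rem Q) 0)
  ; 1-homo = sym (unique′ (C 1#) (C 1#) [] L.refl (λ { (suc i) _ → refl })) }
  where
  open Kit A
  open Polynomial A
  open Degree A
  open Adjoin A h monic
  q rem : List Carrier → List Carrier
  q P = proj₁ (divide P)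
  rem P = proj₁ (proj₂ (divide P))
  spec : ∀ P → P ≋ q P ⊠ h ⊞ rem P
  spec P = proj₁ (proj₂ (proj₂ (divide P)))
  deg : ∀ P → DegLt (rem P) (suc m)
  deg P = proj₂ (proj₂ (proj₂ (divide P)))
  same-remainder : ∀ a b r s → a ⊠ h ⊞ r ≋ b ⊠ h ⊞ s → DegLt r (suc m) → DegLt s (suc m) → r ≋ s
  same-remainder a b r s e dr ds = L.trans (L.solve 2 (λ r s → r := (r :- s) :+ s) L.refl r s)
      (L.+-congʳ {s} (L.trans (L.sym ab) (L.*-congʳ {h} (multiple-degree (b ⊞ neg a) (r ⊞ neg s) ab (degLt-⊞ {r} {neg s} dr (λ i k → trans (coeff-neg s i) (trans (-‿cong (ds i k)) (solve 0 (:- con (+ 0) := con (+ 0)) refl))))))))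
    where
    ab : (b ⊞ neg a) ⊠ h ≋ r ⊞ neg s
    ab = L.trans (L.solve 4 (λ a b h s → (b :- a) :* h := (b :* h :+ s) :- (a :* h :+ s)) L.refl a b h s)
      (L.trans (L.+-congʳ {neg (a ⊠ h ⊞ s)} (L.sym e)) (L.solve 4 (λ a r h s → (a :* h :+ r) :- (a :* h :+ s) := r :- s) L.refl a r h s))
  unique′ : ∀ P r a → P ≋ a ⊠ h ⊞ r → DegLt r (suc m) → coeff r 0 ≈ coeff (rem P) 0
  unique′ P r a e d = at (same-remainder a (q P) r (rem P) (L.trans (L.sym e) (spec P)) d (deg P)) 0
  unique : ∀ P Q → P ≈ʰ Q → coeff (rem P) 0 ≈ coeff (rem Q) 0
  unique P Q e with memberʰ e
  ... | s , f = unique′ Q (rem P) (q P ⊞ neg s) (L.trans (L.solve 2 (λ P Q → Q := P :- (P :- Q)) L.refl P Q)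
      (L.trans (L.+-cong (spec P) (L.-‿cong f)) (L.solve 4 (λ a h r s → (a :* h :+ r) :- s :* h := (a :- s) :* h :+ r) L.refl (q P) h (rem P) s))) (deg P)

record Splitting (A : Ring) (h : List ∣ A ∣) : Set₁ where
  field
    S       : Ring
    embed   : Hom A S
    roots   : List ∣ S ∣
    splits  : Polynomial._≋_ S (map (Hom.fun embed) h) (Degree.linProduct S roots)
    retract : Retraction S A
    spanned : Spanned A → Spanned S

-- In A[X]/(h) the class of X is a root whether or not `h` is irreducible. Dividing by the
-- corresponding linear factor leaves a monic polynomial of degree one less, to which the
-- construction is applied again.
split : ∀ n A h → Monic A h n → Splitting A h
split zero A h (d , e) = record
  { S = A ; embed = idʰ ; roots = []
  ; splits = Polynomial.pw λ { zero → A.trans (coeff-map (idʰ {A}) h 0) e ; (suc i) → A.trans (coeff-map (idʰ {A}) h (suc i)) (d (suc i) (s≤s z≤n)) }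
  ; retract = record { fun = λ x → x ; cong = λ e → e ; +-homo = λ _ _ → A.refl ; 1-homo = A.refl }
  ; spanned = λ s → s }
  where module A = Kit A
split (suc n) A h monic = record
  { S = S.S ; embed = S.embed ∘ʰ embed ; roots = Hom.fun S.embed root ∷ S.roots
  ; splits = LS.trans (map-composite h) (LS.trans (Hom.cong (mapʰ S.embed) (factor hA root root-spec)) (LS.trans (Hom.*-homo (mapʰ S.embed) (lin root) h′)
      (PS.⊠-cong {map (Hom.fun S.embed) (lin root)} {Degree.lin S.S (Hom.fun S.embed root)} {map (Hom.fun S.embed) h′}
         (PS.∷-cong (Hom.neg-homo S.embed root) (PS.∷-cong {[]} {[]} (Hom.1-homo S.embed) LS.refl)) S.splits)))
  ; retract = record
    { fun = λ x → R₁.fun (R₂.fun x) ; cong = λ e → R₁.cong (R₂.cong e)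
    ; +-homo = λ x y → A.trans (R₁.cong (R₂.+-homo x y)) (R₁.+-homo (R₂.fun x) (R₂.fun y))
    ; 1-homo = A.trans (R₁.cong R₂.1-homo) R₁.1-homo }
  ; spanned = λ s → S.spanned (adjoin-spanned s) }
  where
  open Adjoin A h monic
  open Degree adjoin
  module A = Kit A
  hA = map (Hom.fun embed) h
  h′ = quo hA root
  module S = Splitting (split n adjoin h′
    (quo-deg hA root (proj₁ (monic-map embed h monic)) , Kit.trans adjoin (quo-top hA root (proj₁ (monic-map embed h monic))) (proj₂ (monic-map embed h monic))))
  module PS = Polynomial S.S
  module LS = Kit (Polynomial.poly S.S)
  module R₁ = Retraction (retraction A h monic)
  module R₂ = Retraction S.retract
  map-composite : ∀ P → map (Hom.fun (S.embed ∘ʰ embed)) P PS.≋ map (Hom.fun S.embed) (map (Hom.fun embed) P)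
  map-composite [] = LS.refl
  map-composite (c ∷ P) = PS.∷-cong (Kit.refl S.S) (map-composite P)

-- This is A[z_1, ..., z_k]/(h(z_1), ..., h(z_k)), with `extend` as its universal property: the
-- images of the z_i may be any roots of `h`, unrelated to one another and possibly repeated.
record FreeRoots (A : Ring) (h : List ∣ A ∣) (k : ℕ) : Set₁ where
  field
    B       : Ring
    embed   : Hom A B
    roots   : Vec ∣ B ∣ k
    spanned : Spanned A → Spanned B
    extend  : ∀ {T} (φ : Hom A T) (xs : Vec ∣ T ∣ k) → (let open Kit T) →
      (∀ i → Polynomial.eval T (map (Hom.fun φ) h) (lookup xs i) ≈ 0#) →
      ∃ λ (ψ : Hom B T) → (∀ a → Hom.fun ψ (Hom.fun embed a) ≈ Hom.fun φ a) × (∀ i → Hom.fun ψ (lookup roots i) ≈ lookup xs i)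

freeRoots : ∀ k A h {m} → Monic A h m → FreeRoots A h k
freeRoots zero A h monic = record
  { B = A ; embed = idʰ ; roots = [] ; spanned = λ s → s ; extend = λ {T} φ xs e → φ , (λ a → Kit.refl T) , λ () }
freeRoots (suc k) A h monic = record
  { B = F.B ; embed = F.embed ∘ʰ embed ; roots = Hom.fun F.embed root ∷ F.roots
  ; spanned = λ s → F.spanned (adjoin-spanned s)
  ; extend = λ { {T} φ (x ∷ xs) e →
      let module T = Kit T
          (φ′ , φ′-embed , φ′-root) = extend φ x (e zero)
          map-φ′ = λ P → coeff-ext T φ φ′ φ′-embed P
          (ψ , ψ-embed , ψ-roots) = F.extend φ′ xs (λ i → T.trans (Hom.cong (Polynomial.evalʰ T (lookup xs i)) (map-φ′ h)) (e (suc i)))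
      in ψ , (λ a → T.trans (ψ-embed _) (φ′-embed a)) , λ { zero → T.trans (ψ-embed _) φ′-root ; (suc i) → ψ-roots i } } }
  where
  open Adjoin A h monic
  module F = FreeRoots (freeRoots k adjoin (map (Hom.fun embed) h) (monic-map embed h monic))
  coeff-ext : ∀ T (φ : Hom A T) (φ′ : Hom adjoin T) → (∀ a → CommutativeRing._≈_ T (Hom.fun φ′ (Hom.fun embed a)) (Hom.fun φ a)) →
    ∀ P → Polynomial._≋_ T (map (Hom.fun φ′) (map (Hom.fun embed) P)) (map (Hom.fun φ) P)
  coeff-ext T φ φ′ e [] = Kit.refl (Polynomial.poly T)
  coeff-ext T φ φ′ e (c ∷ P) = Polynomial.∷-cong T (e c) (coeff-ext T φ φ′ e P)

-- Frobenius and the trace formula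

p∤k! : ∀ {p} → Prime p → ∀ k → k < p → ¬ p ℕ.∣ k !
p∤k! pr zero k<p d = ¬1 pr (ℕ.∣1⇒≡1 d)
  where
  ¬1 : ∀ {p} → Prime p → p ≢ 1
  ¬1 pr ≡.refl = ¬prime[1] pr
p∤k! pr (suc k) k<p d with euclidsLemma (suc k) (k !) pr d
... | inj₁ e = ℕ.<⇒≱ k<p (ℕ.∣⇒≤ e)
... | inj₂ e = p∤k! pr k (ℕ.<-trans (ℕ.n<1+n k) k<p) e

-- The prime divides p! = k! (p - k)! C(p, k) but neither of the two factorials, whose factors are
-- all smaller than `p`.
p∣pCk : ∀ {p} → Prime p → ∀ {k} → 0 < k → k < p → p ℕ.∣ p choose k
p∣pCk {zero} pr = ⊥-elim (¬prime[0] pr)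
p∣pCk {p@(suc p-1)} pr {k} 0<k k<p = [ (λ d → ⊥-elim ([ p∤k! pr k k<p , p∤k! pr (p ∸ k) (ℕ.∸-monoʳ-< {p} {k} {0} 0<k k≤p) ]′ (euclidsLemma (k !) _ pr d))) , (λ d → d) ]′
    (euclidsLemma (k ! ℕ.* (p ∸ k) !) (p choose k) pr (≡.subst (p ℕ.∣_) (≡.sym eq) (ℕ.m∣m*n (p-1 !))))
  where
  k≤p = ℕ.<⇒≤ k<p
  instance _ = k ℕ.!* (p ∸ k) !≢0
  eq : (k ! ℕ.* (p ∸ k) !) ℕ.* (p choose k) ≡ p !
  eq = ≡.trans (≡.cong (k ! ℕ.* (p ∸ k) ! ℕ.*_) (nCk≡n!/k![n-k]! k≤p)) (m*[n/m]≡n (k![n∸k]!∣n! k≤p))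

module Frobenius (R : Ring) {p : ℕ} (pr : Prime p) (char : CommutativeRing._≈_ R (Kit.ι R (+ p)) (CommutativeRing.0# R)) where
  open Kit R
  private
    module B = Algebra.Properties.CommutativeSemiring.Binomial commutativeSemiring
    open Algebra.Properties.Semiring.Mult semiring renaming (_×_ to _·_)
    open Algebra.Properties.Semiring.Sum semiring
    module T = Algebra.Properties.Monoid.Mult.TCOptimised +-monoid

    multiple : ∀ {c} → p ℕ.∣ c → ∀ z → c · z ≈ 0#
    multiple (ℕ.divides q ≡.refl) z = begin
      (q ℕ.* p) · z        ≈⟨ ×-assocˡ z q p ⟨
      q · (p · z)          ≈⟨ ×-congʳ q (trans (×-congʳ p (sym (*-identityˡ z))) (sym (×-assoc-* p 1# z))) ⟩
      q · ((p · 1#) * z)   ≈⟨ ×-congʳ q (trans (*-congʳ (trans (T.×ᵤ≈× p 1#) char)) (zeroˡ z)) ⟩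
      q · 0#               ≈⟨ ×-zeroʳ q ⟩
      0#                   ∎
      where
      ×-zeroʳ : ∀ q → q · 0# ≈ 0#
      ×-zeroʳ zero = refl
      ×-zeroʳ (suc q) = trans (+-identityˡ _) (×-zeroʳ q)

    sum-zero : ∀ {n} (t : Fin n → Carrier) → (∀ i → t i ≈ 0#) → sum t ≈ 0#
    sum-zero {zero} t e = refl
    sum-zero {suc n} t e = trans (+-cong (e zero) (sum-zero (λ i → t (suc i)) (λ i → e (suc i)))) (+-identityˡ 0#)

    dream : ∀ q → p ≡ suc q → ∀ x y → (x + y) ^ suc q ≈ x ^ suc q + y ^ suc q
    dream q e x y = begin
      (x + y) ^ suc q                        ≈⟨ B.theorem (suc q) x y ⟩
      t zero + sum (λ i → t (suc i))         ≈⟨ +-congˡ (sum-init-last (λ i → t (suc i))) ⟩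
      t zero + (sum (λ i → t (suc (inject₁ i))) + t (suc (fromℕ q))) ≈⟨ +-cong first (+-cong (sum-zero _ middle) last) ⟩
      y ^ suc q + (0# + x ^ suc q)           ≈⟨ solve 2 (λ x y → y :+ (con (+ 0) :+ x) := x :+ y) refl _ _ ⟩
      x ^ suc q + y ^ suc q                  ∎
      where
      t : Fin (suc (suc q)) → Carrier
      t = Algebra.Properties.Semiring.Binomial.binomialTerm semiring x y (suc q)
      first : t zero ≈ y ^ suc q
      first = trans (+-identityʳ _) (*-identityˡ _)
      middle : ∀ i → t (suc (inject₁ i)) ≈ 0#
      middle i = multiple (≡.subst (λ n → p ℕ.∣ n choose suc (toℕ (inject₁ i))) e (p∣pCk pr (s≤s z≤n)
        (≡.subst₂ (λ a b → suc a < b) (≡.sym (Fin.toℕ-inject₁ i)) (≡.sym e) (s≤s (Fin.toℕ<n i))))) _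
      last : t (suc (fromℕ q)) ≈ x ^ suc q
      last rewrite Fin.toℕ-fromℕ q | nCn≡1 (suc q) | ℕ.n∸n≡0 q = trans (+-identityʳ _) (*-identityʳ _)

  frobenius : Hom R R
  frobenius = record
    { fun = _^ p
    ; cong = ^-congˡ p
    ; +-homo = additive p ≡.refl
    ; *-homo = λ x y → Algebra.Properties.CommutativeSemiring.Exp.^-distrib-* commutativeSemiring x y p
    ; 1-homo = 1^ p }
    where
    additive : ∀ m → p ≡ m → ∀ x y → (x + y) ^ m ≈ x ^ m + y ^ m
    additive zero ≡.refl = ⊥-elim (¬prime[0] pr)
    additive (suc q) e = dream q e
    1^ : ∀ n → 1# ^ n ≈ 1#
    1^ zero = refl
    1^ (suc n) = trans (*-identityˡ _) (1^ n)

  -- Fermat's little theorem: the Frobenius map is a ring homomorphism, and every homomorphism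
  -- respects the images of integers.
  ι^p : ∀ m → ι m ^ p ≈ ι m
  ι^p = Hom.ι-homo frobenius

ι⁺-ℤ : ∀ n → Kit.ι ℤᴿ (+ n) ≡ + n
ι⁺-ℤ zero = ≡.refl
ι⁺-ℤ (suc n) = ≡.trans (Kit.ι-+-homo ℤᴿ (+ 1) (+ n)) (≡.cong (ℤ._+_ (+ 1)) (ι⁺-ℤ n))

ι-ℤ : ∀ m → Kit.ι ℤᴿ m ≡ m
ι-ℤ (+ n) = ι⁺-ℤ n
ι-ℤ -[1+ n ] = ≡.cong ℤ.-_ (ι⁺-ℤ (suc n))

module _ {A : Ring} (f : Hom ℤᴿ A) where
  open Kit A

  ℤ-initial : ∀ m → Hom.fun f m ≈ ι m
  ℤ-initial m = trans (Hom.cong f (≡.sym (ι-ℤ m))) (Hom.ι-homo f m)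

module _ {A B : Ring} (f : Hom A B) where
  private
    module A = Kit A
    module B = Kit B

  map-ι : ∀ P → Polynomial._≋_ B (map (Hom.fun f) (map A.ι P)) (map B.ι P)
  map-ι [] = Kit.refl (Polynomial.poly B)
  map-ι (c ∷ P) = Polynomial.∷-cong B (Hom.ι-homo f c) (map-ι P)

splits-ι : ∀ {h} (sp : Splitting ℤᴿ h) → (let open Splitting sp) → Polynomial._≋_ S (map (Kit.ι S) h) (Degree.linProduct S roots)
splits-ι {h} sp = Kit.trans (Polynomial.poly S) (map-cong (ιʰ S) embed (λ m → Kit.sym S (ℤ-initial embed m)) h) splits
  where open Splitting sp

module Dot (R : Ring) where
  open Kit R
  open Polynomial R
  open Degree R

  dot : ∀ {n} → Vec Carrier n → Vec Carrier n → Carrier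
  dot [] [] = 0#
  dot (c ∷ cs) (x ∷ xs) = c * x + dot cs xs

  dot-congʳ : ∀ {n} (cs xs ys : Vec Carrier n) → (∀ i → lookup xs i ≈ lookup ys i) → dot cs xs ≈ dot cs ys
  dot-congʳ [] [] [] e = refl
  dot-congʳ (c ∷ cs) (x ∷ xs) (y ∷ ys) e = +-cong (*-congˡ (e zero)) (dot-congʳ cs xs ys (λ i → e (suc i)))

  dot-congˡ : ∀ {n} (cs ds xs : Vec Carrier n) → (∀ i → lookup cs i ≈ lookup ds i) → dot cs xs ≈ dot ds xs
  dot-congˡ [] [] [] e = refl
  dot-congˡ (c ∷ cs) (d ∷ ds) (x ∷ xs) e = +-cong (*-congʳ (e zero)) (dot-congˡ cs ds xs (λ i → e (suc i)))

  geometric : ∀ t a → (∀ n → act (lin t) a n ≈ 0#) → ∀ n → a n ≈ a 0 * t ^ n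
  geometric t a e zero = sym (*-identityʳ _)
  geometric t a e (suc n) = begin
    a (suc n)             ≈⟨ solve 3 (λ t x y → y := ((:- t) :* x :+ (con (+ 1) :* y :+ con (+ 0))) :+ t :* x) refl t (a n) (a (suc n)) ⟩
    act (lin t) a n + t * a n  ≈⟨ trans (+-congʳ (e n)) (+-identityˡ _) ⟩
    t * a n               ≈⟨ *-congˡ (geometric t a e n) ⟩
    t * (a 0 * t ^ n)     ≈⟨ solve 3 (λ t a u → t :* (a :* u) := a :* (t :* u)) refl t (a 0) (t ^ n) ⟩
    a 0 * (t * t ^ n)     ∎

  -- The derivative of a product of linear factors is the sum of the products with one factor
  -- left out, and each of these turns a solution of the recurrence into a geometric sequence.
  derivative-powers : ∀ ts a → (∀ n → act (linProduct ts) a n ≈ 0#) →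
    ∃ λ cs → ∀ n → act (D (linProduct ts)) a n ≈ dot cs (Vec.map (_^ n) (fromList ts))
  derivative-powers [] a e = [] , λ n → trans (+-identityʳ _) (zeroˡ _)
  derivative-powers (t ∷ ts) a e = s 0 ∷ proj₁ IH , λ n → begin
      act (D (lin t ⊠ M)) a n                                  ≈⟨ act-congˡ {D (lin t ⊠ M)} {M ⊞ lin t ⊠ D M} D≋ a n ⟩
      act (M ⊞ lin t ⊠ D M) a n                                ≈⟨ act-⊞ M (lin t ⊠ D M) a n ⟩
      s n + act (lin t ⊠ D M) a n                              ≈⟨ +-cong (geometric t s killed n) (trans (act-⊠ (lin t) (D M) a n) (act-comm (lin t) (D M) a n)) ⟩
      s 0 * t ^ n + act (D M) (act (lin t) a) n                ≈⟨ +-congˡ (proj₂ IH n) ⟩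
      s 0 * t ^ n + dot (proj₁ IH) (Vec.map (_^ n) (fromList ts)) ∎
    where
    M = linProduct ts
    s = act M a
    killed : ∀ n → act (lin t) s n ≈ 0#
    killed n = trans (sym (act-⊠ (lin t) M a n)) (e n)
    IH = derivative-powers ts (act (lin t) a) (λ n → trans (act-comm M (lin t) a n) (killed n))
    D-lin : D (lin t) ≋ C 1#
    D-lin = pw λ { zero → +-identityʳ _ ; (suc zero) → refl ; (suc (suc i)) → refl }
    D≋ : D (lin t ⊠ M) ≋ M ⊞ lin t ⊠ D M
    D≋ = L.trans (D-⊠ (lin t) M) (L.+-congʳ {lin t ⊠ D M} (L.trans (L.*-congʳ {M} D-lin) (L.*-identityˡ M)))

  act-powers : ∀ V {k} (cs ts : Vec Carrier k) n →
    act V (λ m → dot cs (Vec.map (_^ m) ts)) n ≈ dot (Vec.zipWith (λ c t → c * eval V t) cs ts) (Vec.map (_^ n) ts)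
  act-powers V [] [] n = act-0ʳ V (λ _ → refl) n
  act-powers V (c ∷ cs) (t ∷ ts) n = trans (act-+ʳ V _ _ n) (+-cong
    (trans (act-*ʳ V c (t ^_) n) (trans (*-congˡ (act-pow V t n)) (solve 3 (λ c u v → c :* (u :* v) := (c :* v) :* u) refl c _ _)))
    (act-powers V cs ts n))

  eval-linProduct : ∀ ts i → eval (linProduct ts) (lookup (fromList ts) i) ≈ 0#
  eval-linProduct (t ∷ ts) zero = trans (Hom.*-homo (evalʰ t) (lin t) (linProduct ts)) (trans (*-congʳ (trans (eval-lin t t) (-‿inverseʳ t))) (zeroˡ _))
  eval-linProduct (t ∷ ts) (suc i) = trans (Hom.*-homo (evalʰ _) (lin t) (linProduct ts)) (trans (*-congˡ (eval-linProduct ts i)) (zeroʳ _))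

module _ {A B : Ring} (f : Hom A B) where
  private
    module A = Kit A
    module B = Kit B

  dot-homo : ∀ {n} (cs xs : Vec A.Carrier n) → Hom.fun f (Dot.dot A cs xs) B.≈ Dot.dot B (Vec.map (Hom.fun f) cs) (Vec.map (Hom.fun f) xs)
  dot-homo [] [] = Hom.0-homo f
  dot-homo (c ∷ cs) (x ∷ xs) = B.trans (Hom.+-homo f _ _) (B.+-cong (Hom.*-homo f c x) (dot-homo cs xs))

-- Separable integer recurrences at prime indices

record SeparableRecurrence : Set where
  private
    module Pℤ = Polynomial ℤᴿ
    module Dℤ = Degree ℤᴿ
  field
    h      : List ℤ
    {deg}  : ℕ
    monic  : Monic ℤᴿ h deg
    U V    : List ℤ
    Δ      : ℤ
    Δ≢0    : Δ ≢ + 0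
    bezout : U Pℤ.⊠ h Pℤ.⊞ V Pℤ.⊠ Dℤ.D h Pℤ.≋ Pℤ.C Δ
    b      : ℕ → ℤ
    killed : ∀ n → Pℤ.act h b n ≡ + 0

module _ (rec : SeparableRecurrence) where
  open SeparableRecurrence rec
  private
    module Z = Kit ℤᴿ
    module Pℤ = Polynomial ℤᴿ
    module Dℤ = Degree ℤᴿ

  -- Let both sides of the Bezout identity act on `b`; the summand containing `h` contributes
  -- nothing. The derivative is wanted because `derivative-powers` expands its action into geometric
  -- sequences.
  Δb : ∀ n → Δ ℤ.* b n ≡ Pℤ.act V (Pℤ.act (Dℤ.D h) b) n
  Δb n = begin
    Δ * b n                                             ≡⟨ +-identityʳ _ ⟨
    Pℤ.act (Pℤ.C Δ) b n                                 ≡⟨ Pℤ.act-congˡ bezout b n ⟨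
    Pℤ.act (U Pℤ.⊠ h Pℤ.⊞ V Pℤ.⊠ Dℤ.D h) b n            ≡⟨ Pℤ.act-⊞ (U Pℤ.⊠ h) _ b n ⟩
    Pℤ.act (U Pℤ.⊠ h) b n + Pℤ.act (V Pℤ.⊠ Dℤ.D h) b n  ≡⟨ +-cong (trans (Pℤ.act-⊠ U h b n) (Pℤ.act-0ʳ U killed n)) (Pℤ.act-⊠ V (Dℤ.D h) b n) ⟩
    + 0 + Pℤ.act V (Pℤ.act (Dℤ.D h) b) n                ≡⟨ +-identityˡ _ ⟩
    Pℤ.act V (Pℤ.act (Dℤ.D h) b) n                      ∎
    where
    open Z using (_*_; _+_; +-identityʳ; +-identityˡ; trans; +-cong)
    open ≡.≡-Reasoning

  -- Each geometric sequence occurring in h′(E) b is an eigenvector of the shift, so applying `V`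
  -- only multiplies its coefficient by V(t_i). The formula is needed both in the ring `S` and in
  -- prime fields, hence for arbitrary `R`.
  trace-formula : ∀ R ts → Polynomial._≋_ R (map (Kit.ι R) h) (Degree.linProduct R ts) →
    ∃ λ cs → ∀ n → CommutativeRing._≈_ R (Kit.ι R (Δ ℤ.* b n)) (Dot.dot R cs (Vec.map (λ t → Kit._^_ R t n) (fromList ts)))
  trace-formula R ts splits = Vec.zipWith (λ c t → c * eval (map ι V) t) (proj₁ dp) (fromList ts) , λ n → begin
      ι (Δ ℤ.* b n)                                       ≈⟨ ι-cong (Δb n) ⟩
      ι (Pℤ.act V (Pℤ.act (Dℤ.D h) b) n)                  ≈⟨ act-map (ιʰ R) V _ n ⟩
      act (map ι V) (λ m → ι (Pℤ.act (Dℤ.D h) b m)) n     ≈⟨ act-congʳ (map ι V) (λ m → trans (act-map (ιʰ R) (Dℤ.D h) b m) (trans (act-congˡ Dh _ m) (proj₂ dp m))) n ⟩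
      act (map ι V) (λ m → dot (proj₁ dp) (Vec.map (_^ m) (fromList ts))) n  ≈⟨ act-powers (map ι V) (proj₁ dp) (fromList ts) n ⟩
      dot (Vec.zipWith (λ c t → c * eval (map ι V) t) (proj₁ dp) (fromList ts)) (Vec.map (_^ n) (fromList ts)) ∎
    where
    open Kit R
    open Polynomial R
    open Degree R
    open Dot R
    Dh : map ι (Dℤ.D h) ≋ D (linProduct ts)
    Dh = L.trans (map-D (ιʰ R) h) (D-cong splits)
    dp = derivative-powers ts (λ m → ι (b m)) (λ n → trans (act-congˡ (L.sym splits) _ n) (trans (sym (act-map (ιʰ R) h b n)) (ι-cong (killed n))))

  ℤ-spanned : Spanned ℤᴿ
  ℤ-spanned = record { gens = + 1 ∷ [] ; span = λ x → (x ∷ []) , Z.sym (Z.trans (Z.+-identityʳ _) (Z.trans (Z.*-identityʳ _) (ι-ℤ x))) }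

  -- The relation f(β) = 0 is fixed before `p`. A prime enters only through the homomorphism ψ into
  -- T = S/pS, which sends z_i to t_i^p and β to the class of Δ b_p. So f(Δ b_p) lies in pS, and the
  -- retraction of `S` onto ℤ turns this into divisibility in ℤ.
  annihilator : ∃ λ f → NonZeroPolyℤ f × (∀ p → Prime p → + p ℤ.∣ Pℤ.eval f (Δ ℤ.* b p))
  annihilator = proj₁ alg , proj₁ (proj₂ alg) , vanish
    where
    splitting = split deg ℤᴿ h monic
    open Splitting splitting
    open Kit S using (ι; _^_)
    hS : List ∣ S ∣
    hS = map ι h
    ts = fromList roots
    cs = proj₁ (trace-formula S roots (splits-ι splitting))
    module F = FreeRoots (freeRoots (List.length roots) S hS (monic-map (ιʰ S) h monic))
    β = Dot.dot F.B (Vec.map (Hom.fun F.embed) cs) F.roots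
    alg = algebraic F.B (spanned⇒dependent F.B (F.spanned (spanned ℤ-spanned))) β
    f = proj₁ alg
    vanish : ∀ p → Prime p → + p ℤ.∣ Pℤ.eval f (Δ ℤ.* b p)
    vanish p pr = ℤ-divides {Pℤ.eval f (Δ ℤ.* b p)} (∼0⇒mem f[Δb]∼0)
      where
      open Quotient S (principal S (ι (+ p))) renaming (ring/ to T; proj to toT)
      module T = Kit T
      char : T.ι (+ p) T.≈ T.0#
      char = T.trans (T.sym (Hom.ι-homo toT (+ p))) (mem⇒∼0 (Kit.1# S , Kit.sym S (Kit.*-identityˡ S _)))
      open Frobenius T pr char
      hT = map (Hom.fun toT) hS
      frob-fixes : Polynomial._≋_ T (map (Hom.fun frobenius) hT) hT
      frob-fixes = LT.trans (Hom.cong (mapʰ frobenius) (map-ι toT h)) (LT.trans (map-ι frobenius h) (LT.sym (map-ι toT h)))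
        where module LT = Kit (Polynomial.poly T)
      root-T : ∀ i → Polynomial.eval T hT (lookup ts i) T.≈ T.0#
      root-T i = T.trans (T.sym (eval-map toT hS (lookup ts i))) (Hom.cong toT (Kit.trans S (Hom.cong (Polynomial.evalʰ S (lookup ts i)) (splits-ι splitting)) (Dot.eval-linProduct S roots i)))
      root-T^p : ∀ i → Polynomial.eval T hT (lookup ts i T.^ p) T.≈ T.0#
      root-T^p i = T.trans (Hom.cong (Polynomial.evalʰ T (lookup ts i T.^ p)) (Kit.sym (Polynomial.poly T) frob-fixes))
        (T.trans (T.sym (eval-map frobenius hT (lookup ts i))) (T.trans (Hom.cong frobenius (root-T i)) (Hom.0-homo frobenius)))
      xs = Vec.map (T._^ p) ts
      ext = F.extend toT xs (λ i → T.trans (T.reflexive (≡.cong (Polynomial.eval T hT) (lookup-map i (T._^ p) ts))) (root-T^p i))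
      ψ = proj₁ ext
      cs₁ cs₂ ws : Vec T.Carrier _
      cs₁ = Vec.map (Hom.fun ψ) (Vec.map (Hom.fun F.embed) cs)
      cs₂ = Vec.map (Hom.fun toT) cs
      ws  = Vec.map (Hom.fun toT) (Vec.map (_^ p) ts)
      cs₁≈cs₂ : ∀ i → lookup cs₁ i T.≈ lookup cs₂ i
      cs₁≈cs₂ i = begin
        lookup cs₁ i                                               ≡⟨ lookup-map i (Hom.fun ψ) (Vec.map (Hom.fun F.embed) cs) ⟩
        Hom.fun ψ (lookup (Vec.map (Hom.fun F.embed) cs) i)        ≡⟨ ≡.cong (Hom.fun ψ) (lookup-map i (Hom.fun F.embed) cs) ⟩
        Hom.fun ψ (Hom.fun F.embed (lookup cs i))                  ≈⟨ proj₁ (proj₂ ext) (lookup cs i) ⟩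
        Hom.fun toT (lookup cs i)                                  ≡⟨ lookup-map i (Hom.fun toT) cs ⟨
        lookup cs₂ i                                               ∎
        where open T using (begin_; step-≈-⟩; step-≈-⟨; step-≡-⟩; step-≡-⟨; _∎)
      xs≈ws : ∀ i → lookup xs i T.≈ lookup ws i
      xs≈ws i = begin
        lookup xs i                                    ≡⟨ lookup-map i (T._^ p) ts ⟩
        Hom.fun toT (lookup ts i) T.^ p                ≈⟨ Hom.^-homo toT (lookup ts i) p ⟨
        Hom.fun toT (lookup ts i ^ p)        ≡⟨ ≡.cong (Hom.fun toT) (lookup-map i (_^ p) ts) ⟨
        Hom.fun toT (lookup (Vec.map (_^ p) ts) i)  ≡⟨ lookup-map i (Hom.fun toT) (Vec.map (_^ p) ts) ⟨
        lookup ws i                                    ∎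
        where open T using (begin_; step-≈-⟩; step-≈-⟨; step-≡-⟩; step-≡-⟨; _∎)
      ψβ : Hom.fun ψ β T.≈ T.ι (Δ ℤ.* b p)
      ψβ = begin
        Hom.fun ψ β                                        ≈⟨ dot-homo ψ (Vec.map (Hom.fun F.embed) cs) F.roots ⟩
        dot cs₁ (Vec.map (Hom.fun ψ) F.roots)              ≈⟨ dot-congʳ cs₁ (Vec.map (Hom.fun ψ) F.roots) xs (λ i → T.trans (T.reflexive (lookup-map i (Hom.fun ψ) F.roots)) (proj₂ (proj₂ ext) i)) ⟩
        dot cs₁ xs                                         ≈⟨ dot-congˡ cs₁ cs₂ xs cs₁≈cs₂ ⟩
        dot cs₂ xs                                         ≈⟨ dot-congʳ cs₂ xs ws xs≈ws ⟩
        dot cs₂ ws                                         ≈⟨ dot-homo toT cs (Vec.map (_^ p) ts) ⟨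
        Hom.fun toT (Dot.dot S cs (Vec.map (_^ p) ts))     ≈⟨ Hom.cong toT (proj₂ (trace-formula S roots (splits-ι splitting)) p) ⟨
        Hom.fun toT (ι (Δ ℤ.* b p))                        ≈⟨ Hom.ι-homo toT (Δ ℤ.* b p) ⟩
        T.ι (Δ ℤ.* b p)                                    ∎
        where
        open T using (begin_; step-≈-⟩; step-≈-⟨; _∎)
        open Dot T
      f[Δb]∼0 : Hom.fun toT (ι (Pℤ.eval f (Δ ℤ.* b p))) T.≈ T.0#
      f[Δb]∼0 = T.trans (Hom.ι-homo toT (Pℤ.eval f (Δ ℤ.* b p))) (T.trans (eval-map (ιʰ T) f (Δ ℤ.* b p)) (T.trans (Polynomial.eval-congʳ T (map T.ι f) (T.sym ψβ))
        (T.trans (Hom.cong (Polynomial.evalʰ T (Hom.fun ψ β)) (Kit.sym (Polynomial.poly T) (map-ι ψ f))) (T.trans (T.sym (eval-map ψ (map (Kit.ι F.B) f) β))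
        (T.trans (Hom.cong ψ (proj₂ (proj₂ alg))) (Hom.0-homo ψ))))))
      ℤ-divides : ∀ {m} → Ideal.Mem (principal S (ι (+ p))) (ι m) → + p ℤ.∣ m
      ℤ-divides {m} (q , e) = ≡.subst (+ p ℤ.∣_) (≡.sym eq) (≡.subst (p ℕ.∣_) (≡.sym (ℤ.abs-* (+ p) (π.fun q))) (ℕ.m∣m*n _))
        where
        module π = Retraction retract
        eq : m ≡ + p ℤ.* π.fun q
        eq = ≡.trans (≡.sym (ι-ℤ m)) (≡.trans (≡.sym (π.ι-homo m)) (≡.trans (π.cong (Kit.trans S e (Kit.*-comm S q _)))
          (≡.trans (π.ι-linear (+ p) q) (≡.cong (ℤ._* π.fun q) (ι-ℤ (+ p))))))

-- Domains of finite rank over ℤ, classically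

¬¬_ : ∀ {u} → Set u → Set u
¬¬ U = ¬ ¬ U

pure : ∀ {u} {U : Set u} → U → ¬¬ U
pure x k = k x

_>>=_ : ∀ {u v} {U : Set u} {V : Set v} → ¬¬ U → (U → ¬¬ V) → ¬¬ V
(m >>= f) k = m (λ x → f x k)

em : ∀ {u} (U : Set u) → ¬¬ (U ⊎ ¬ U)
em U k = k (inj₂ (λ x → k (inj₁ x)))

least : (P : ℕ → Set) → ∀ n → P n → ¬¬ (∃ λ m → P m × (∀ k → k < m → ¬ P k))
least P n p = go n n ℕ.≤-refl p
  where
  go : ∀ b n → n ≤ b → P n → ¬¬ (∃ λ m → P m × (∀ k → k < m → ¬ P k))
  go zero .0 z≤n p = pure (0 , p , λ k ())
  go (suc b) n n≤b p = do
    inj₁ (k , k<n , q) ← em (∃ λ k → k < n × P k)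
      where inj₂ none → pure (n , p , λ k k<n q → none (k , k<n , q))
    go b k (ℕ.≤-pred (ℕ.≤-trans k<n n≤b)) q

_*≢0_ : ∀ {m n} → m ≢ + 0 → n ≢ + 0 → m ℤ.* n ≢ + 0
_*≢0_ {m} a b e = [ a , b ]′ (ℤ.i*j≡0⇒i≡0∨j≡0 m e)

record TorsionFree (R : Ring) : Set where
  open Kit R
  field
    stable  : ∀ {x y} → ¬¬ (x ≈ y) → x ≈ y
    torsion : ∀ m {x} → m ≢ + 0 → ι m * x ≈ 0# → x ≈ 0#
    char0   : ∀ m → ι m ≈ 0# → m ≡ + 0

record Domain (R : Ring) : Set where
  open Kit R
  field
    stable : ∀ {x y} → ¬¬ (x ≈ y) → x ≈ y
    cancel : ∀ {x y} → x * y ≈ 0# → ¬ x ≈ 0# → y ≈ 0#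
    char0  : ∀ m → ι m ≈ 0# → m ≡ + 0

  product≉0 : ∀ {x y} → ¬ x ≈ 0# → ¬ y ≈ 0# → ¬ x * y ≈ 0#
  product≉0 x≉0 y≉0 e = y≉0 (cancel e x≉0)

  power≉0 : ∀ {x} n → ¬ x ≈ 0# → ¬ x ^ n ≈ 0#
  power≉0 zero x≉0 e with char0 (+ 1) e
  ... | ()
  power≉0 (suc n) x≉0 = product≉0 x≉0 (power≉0 n x≉0)

-- Equality modulo g up to torsion, made stable under double negation.
saturated : ∀ R → ∣ R ∣ → Ideal R
saturated R g = record
  { Mem = λ x → ¬¬ (∃ λ m → ∃ λ q → m ≢ + 0 × ι m * x ≈ q * g)
  ; respects = λ e mem → do
      (m , q , m≢0 , f) ← mem
      pure (m , q , m≢0 , trans (*-congˡ (sym e)) f)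
  ; zero-mem = pure (+ 1 , 0# , (λ ()) , trans (zeroʳ _) (sym (zeroˡ g)))
  ; add = λ {x} {y} mem mem′ → do
      (m , q , m≢0 , e) ← mem
      (n , r , n≢0 , f) ← mem′
      pure (m ℤ.* n , ι n * q + ι m * r , m≢0 *≢0 n≢0 , trans (*-congʳ (ι-*-homo m n))
        (trans (solve 4 (λ m n x y → (m :* n) :* (x :+ y) := n :* (m :* x) :+ m :* (n :* y)) refl (ι m) (ι n) x y)
        (trans (+-cong (*-congˡ e) (*-congˡ f)) (solve 5 (λ m n q r g → n :* (q :* g) :+ m :* (r :* g) := (n :* q :+ m :* r) :* g) refl (ι m) (ι n) q r g))))
  ; absorb = λ r {x} mem → do
      (m , q , m≢0 , e) ← mem
      pure (m , r * q , m≢0 , trans (solve 3 (λ m r x → m :* (r :* x) := r :* (m :* x)) refl (ι m) r x)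
        (trans (*-congˡ e) (sym (*-assoc r q g)))) }
  where open Kit R

module Saturate (R : Ring) (g : ∣ R ∣) where
  open Quotient R (saturated R g) public
  private
    module R = Kit R
    module Q = Kit ring/

  torsionFree : (∀ q m → m ≢ + 0 → ¬ q R.* g R.≈ R.ι m) → TorsionFree ring/
  torsionFree proper = record
    { stable = λ d → diff (λ k → d (λ e → member e k))
    ; torsion = λ m {x} m≢0 e → mem⇒∼0 do
        (n , q , n≢0 , f) ← ∼0⇒mem {R.ι m R.* x} (Q.trans (Q.*-congʳ {x} (Hom.ι-homo proj m)) e)
        pure (n ℤ.* m , q , n≢0 *≢0 m≢0 , R.trans (R.*-congʳ (R.ι-*-homo n m)) (R.trans (R.*-assoc _ _ x) f))
    ; char0 = λ m e → decidable-stable (m ℤ.≟ + 0) λ m≢0 → ∼0⇒mem {R.ι m} (Q.trans (Hom.ι-homo proj m) e) λ { (n , q , n≢0 , f) →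
        proper q (n ℤ.* m) (n≢0 *≢0 m≢0) (R.sym (R.trans (R.ι-*-homo n m) f)) } }

Dependent-surj : ∀ R (J : Ideal R) {n} → Dependent R n → Dependent (Quotient.ring/ R J) n
Dependent-surj R J dep vs = proj₁ (dep vs) , proj₁ (proj₂ (dep vs)) ,
    T.trans (T.reflexive (≡.cong (Combination.comb T′ (proj₁ (dep vs))) (≡.sym (map-id vs))))
      (T.trans (T.sym (comb-homo proj (proj₁ (dep vs)) vs)) (≈⇒∼ (proj₂ (proj₂ (dep vs)))))
  where
  open Quotient R J renaming (ring/ to T′)
  module T = Kit T′

record DomainOver (R : Ring) : Set₁ where
  field
    K      : Ring
    domain : Domain K
    embed  : Hom R K
    {dim}  : ℕ
    dependent : Dependent K dim

-- If every nonzero x divides a nonzero integer m = q x, then x y = 0 gives m y = 0 and y = 0, so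
-- `R` is a domain. Otherwise some nonzero x divides no nonzero integer; dividing by its saturated
-- ideal preserves characteristic zero and lowers the rank. The rank cannot fall forever, as an
-- empty family has no nontrivial relation.
maximalQuotient : ∀ n R → TorsionFree R → Dependent R n → ¬¬ DomainOver R
maximalQuotient zero R tf dep with dep []
... | [] , (() , _) , _
maximalQuotient (suc n) R tf dep = do
    inj₁ (x , x≉0 , nonunit) ← em (∃ λ x → ¬ x ≈ 0# × (∀ q m → m ≢ + 0 → ¬ q * x ≈ ι m))
      where inj₂ units → pure record { K = R ; domain = record
              { stable = stable
              ; cancel = λ {x} {y} e x≉0 → stable λ y≉0 → units (x , x≉0 , λ q m m≢0 qx →
                  y≉0 (torsion m m≢0 (trans (*-congʳ (sym qx)) (trans (*-assoc q x y) (trans (*-congˡ e) (zeroʳ q))))))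
              ; char0 = char0 } ; embed = idʰ ; dependent = dep }
    result ← maximalQuotient n (Saturate.ring/ R x) (Saturate.torsionFree R x nonunit) (dep/ x x≉0)
    pure record { K = DomainOver.K result ; domain = DomainOver.domain result
                ; embed = DomainOver.embed result ∘ʰ Saturate.proj R x ; dependent = DomainOver.dependent result }
  where
  open Kit R
  open TorsionFree tf
  open Combination R
  all-zero : ∀ {k} (cs : Vec ℤ k) ws → (∀ i → ¬ lookup cs i ≢ + 0) → comb cs ws ≈ 0#
  all-zero [] [] e = refl
  all-zero (c ∷ cs) (w ∷ ws) e = trans (+-cong (trans (*-congʳ (ι-cong (decidable-stable (c ℤ.≟ + 0) (e zero)))) (zeroˡ w)) (all-zero cs ws (λ i → e (suc i)))) (+-identityˡ 0#)
  dep/ : ∀ x → ¬ x ≈ 0# → Dependent (Saturate.ring/ R x) n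
  dep/ x x≉0 vs with dep (x ∷ vs)
  -- Since `x` becomes zero, its term may be dropped. The remaining coefficients are not all zero,
  -- for otherwise c x = 0 with c ≠ 0, against torsion-freeness.
  ... | c ∷ cs , nz , e = cs , nz′ , S.trans (S.reflexive (≡.cong (Combination.comb ring/ cs) (≡.sym (map-id vs)))) (S.trans (S.sym (comb-homo proj cs vs)) (mem⇒∼0 mem))
    where
    open Saturate R x
    module S = Kit ring/
    mem : Ideal.Mem (saturated R x) (comb cs vs)
    mem = pure (+ 1 , - ι c , (λ ()) , trans (solve 3 (λ c x s → con (+ 1) :* s := (c :* x :+ s) :- c :* x) refl (ι c) x (comb cs vs))
      (trans (+-congʳ e) (solve 2 (λ c x → con (+ 0) :- c :* x := (:- c) :* x) refl (ι c) x)))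
    nz′ : NonZeroVec cs
    nz′ = tail-nonzero nz
      where
      tail-nonzero : NonZeroVec (c ∷ cs) → NonZeroVec cs
      tail-nonzero (suc i , ci) = i , ci
      tail-nonzero (zero , c≢0) with any? (λ i → ¬? (lookup cs i ℤ.≟ + 0))
      ... | yes found = found
      ... | no none = ⊥-elim (x≉0 (torsion c c≢0 (trans (sym (+-identityʳ _)) (trans (+-congˡ (sym (all-zero cs vs (λ i ci → none (i , ci))))) e))))

module _ {A K : Ring} (f : Hom A K) (injective : ∀ {x} → CommutativeRing._≈_ K (Hom.fun f x) (CommutativeRing.0# K) → CommutativeRing._≈_ A x (CommutativeRing.0# A)) where
  private
    module A = Kit A
    module K = Kit K
    module F = Hom f

  Domain-sub : Domain K → Domain A
  Domain-sub dom = record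
    { stable = λ {x} {y} d → A.trans (A.solve 2 (λ x y → x := (x :- y) :+ y) A.refl x y) (A.trans (A.+-congʳ (injective (stable do
        e ← d
        pure (K.trans (F.cong (A.trans (A.+-congʳ e) (A.-‿inverseʳ y))) F.0-homo)))) (A.+-identityˡ y))
    ; cancel = λ e x≉0 → injective (cancel (K.trans (K.sym (F.*-homo _ _)) (K.trans (F.cong e) F.0-homo)) (λ z → x≉0 (injective z)))
    ; char0 = λ m e → char0 m (K.trans (K.sym (F.ι-homo m)) (K.trans (F.cong e) F.0-homo)) }
    where open Domain dom

  Dependent-sub : ∀ {n} → Dependent K n → Dependent A n
  Dependent-sub dep vs with dep (Vec.map F.fun vs)
  ... | cs , nz , e = cs , nz , injective (K.trans (comb-homo f cs vs) e)

module DomainTheory {K : Ring} (dom : Domain K) where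
  open Kit K
  open Polynomial K
  open Degree K
  open Domain dom

  -- Write an integer relation for `x` as c + x g(x) = 0. If c ≠ 0, then -g(x) times `x` is c; if c
  -- = 0, the factor `x` cancels and `g` is a shorter relation. Thus `K` becomes a field once
  -- nonzero integers are inverted.
  quasi-inverse : ∀ {n} → Dependent K n → ∀ x → ¬ x ≈ 0# → ∃ λ y → ∃ λ m → m ≢ + 0 × x * y ≈ ι m
  quasi-inverse dep x x≉0 = go (proj₁ alg) (proj₁ (proj₂ alg)) (proj₂ (proj₂ alg))
    where
    alg = algebraic K dep x
    go : ∀ f → NonZeroPolyℤ f → eval (map ι f) x ≈ 0# → ∃ λ y → ∃ λ m → m ≢ + 0 × x * y ≈ ι m
    go [] (i , nz) e = ⊥-elim (nz ≡.refl)
    go (c ∷ f) nz e with c ℤ.≟ + 0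
    ... | no c≢0 = - eval (map ι f) x , c , c≢0 ,
            trans (solve 3 (λ c x v → x :* (:- v) := c :- (c :+ x :* v)) refl (ι c) x _) (trans (+-congˡ (-‿cong e)) (solve 1 (λ c → c :- con (+ 0) := c) refl (ι c)))
    go (c ∷ f) (zero , nz) e | yes c≡0 = ⊥-elim (nz c≡0)
    go (c ∷ f) (suc i , nz) e | yes ≡.refl = go f (i , nz) (cancel (trans (sym (+-identityˡ _)) e) x≉0)

  leading : ∀ P k → DegLt P k → ¬ P ≋ [] → ¬¬ (∃ λ n → n < k × DegLt P (suc n) × ¬ coeff P n ≈ 0#)
  leading P zero d P≉0 = ⊥-elim (P≉0 (pw (λ i → d i z≤n)))
  leading P (suc k) d P≉0 = do
    inj₁ z ← em (coeff P k ≈ 0#)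
      where inj₂ nz → pure (k , ℕ.≤-refl , d , nz)
    (n , n<k , dn , nz) ← leading P k (λ i k≤i → [ (λ k<i → d i k<i) , (λ { ≡.refl → z }) ]′ (ℕ.m≤n⇒m<n∨m≡n k≤i)) P≉0
    pure (n , ℕ.m≤n⇒m≤1+n n<k , dn , nz)

  lin-monic : ∀ t → Monic K (lin t) 1
  lin-monic t = (λ { (suc (suc i)) _ → refl ; (suc zero) (s≤s ()) }) , refl

  lin-cancel : ∀ t P Q → lin t ⊠ P ≋ lin t ⊠ Q → P ≋ Q
  lin-cancel t P Q e = L.trans (L.solve 2 (λ P Q → P := (P :- Q) :+ Q) L.refl P Q)
    (L.+-congʳ {Q} (Adjoin.multiple-degree K (lin t) (lin-monic t) (P ⊞ neg Q) []
      (L.trans (L.solve 3 (λ P Q l → (P :- Q) :* l := l :* P :- l :* Q) L.refl P Q (lin t))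
        (L.trans (L.+-congʳ {neg (lin t ⊠ Q)} e) (L.-‿inverseʳ (lin t ⊠ Q)))) (λ i _ → refl)))

  -- A root on the progression γ + u δ is divided off, which lowers the degree bound. In
  -- characteristic zero the points of the progression are distinct, so the split-off factor
  -- vanishes at no other of them.
  few-roots : ∀ P k → DegLt P k → ¬ P ≋ [] → ∀ γ δ → ¬ δ ≈ 0# →
    ¬¬ (∃ λ N → ∀ u → N ≤ u → ¬ eval P (γ + ι (+ u) * δ) ≈ 0#)
  few-roots P zero d P≉0 γ δ δ≉0 = ⊥-elim (P≉0 (pw (λ i → d i z≤n)))
  few-roots P (suc k) d P≉0 γ δ δ≉0 = do
      inj₁ (v , e) ← em (∃ λ v → eval P (x v) ≈ 0#)
        where inj₂ none → pure (0 , λ u _ e → none (u , e))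
      (N , good) ← few-roots (quo P (x v)) k (quo-deg P (x v) d) (quo≉0 v e) γ δ δ≉0
      -- The bound `suc v` forces u > v, hence a nonzero value of the linear factor at `x u`.
      pure (N ℕ.⊔ suc v , λ u le e′ → good u (ℕ.≤-trans (ℕ.m≤m⊔n N (suc v)) le)
        (cancel (trans (sym (trans (Hom.*-homo (evalʰ (x u)) (lin (x v)) (quo P (x v))) (*-congʳ (eval-lin (x v) (x u)))))
            (trans (Hom.cong (evalʰ (x u)) (L.sym (factor P (x v) e))) e′))
          (distinct u v (ℕ.≤-trans (ℕ.m≤n⊔m N (suc v)) le))))
    where
    x : ℕ → Carrier
    x u = γ + ι (+ u) * δ
    quo≉0 : ∀ v → eval P (x v) ≈ 0# → ¬ quo P (x v) ≋ []
    quo≉0 v e z = P≉0 (L.trans (factor P (x v) e) (L.trans (L.*-congˡ {lin (x v)} z) (L.zeroʳ (lin (x v)))))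
    distinct : ∀ u v → v < u → ¬ x u - x v ≈ 0#
    distinct u v v<u e = ℕ.<⇒≢ v<u (≡.sym (ℤ.+-injective (ℤ.i-j≡0⇒i≡j (+ u) (+ v) (char0 (+ u ℤ.- + v) ([_]≈0)))))
      where
      [_]≈0 : ι (+ u ℤ.- + v) ≈ 0#
      [_]≈0 = stable λ nz → δ≉0 (cancel (trans (*-congʳ (trans (ι-+-homo (+ u) (ℤ.- + v)) (+-congˡ (ι-neg-homo (+ v)))))
        (trans (solve 4 (λ u v d g → (u :- v) :* d := (g :+ u :* d) :- (g :+ v :* d)) refl (ι (+ u)) (ι (+ v)) δ γ) e)) nz)

  -- At the first root `t` either `d` vanishes, or `q` does and X - t cancels from both sides. When
  -- all linear factors are used up, c = q d contradicts the positive degree of `d`.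
  common-root : ∀ ts c q d {k} → ¬ c ≈ 0# → C c ⊠ linProduct ts ≋ q ⊠ d → DegLt d (suc (suc k)) → ¬ coeff d (suc k) ≈ 0# →
    ¬¬ Any (λ t → eval d t ≈ 0#) ts
  common-root [] c q d {k} c≉0 e dd top = do
    (j , _ , dq , qj) ← leading q (List.length q) (degLt-length q) λ q≋0 →
      c≉0 (at (L.trans (L.sym (L.*-identityʳ (C c))) (L.trans e (L.trans (L.*-congʳ {d} q≋0) (L.zeroˡ d)))) 0)
    ⊥-elim (product≉0 qj top (trans (sym (proj₂ (degLt-⊠ q d {j} {suc k} dq dd)))
      (trans (at (L.sym (L.trans (L.sym (L.*-identityʳ (C c))) e)) (j ℕ.+ suc k)) (≡.subst (λ i → coeff (C c) i ≈ 0#) (≡.sym (ℕ.+-suc j k)) refl))))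
  common-root (t ∷ ts) c q d c≉0 e dd top = do
    inj₂ nz ← em (eval d t ≈ 0#)
      where inj₁ z → pure (here z)
    let qt≈0 = cancel {eval d t} {eval q t} (trans (*-comm _ _) (trans (sym (Hom.*-homo (evalʰ t) q d)) (trans (Hom.cong (evalʰ t) (L.sym e))
               (trans (Hom.*-homo (evalʰ t) (C c) (lin t ⊠ linProduct ts)) (trans (*-congˡ (eval-linProduct (t ∷ ts) zero)) (zeroʳ _)))))) nz
        e′ = lin-cancel t (C c ⊠ linProduct ts) (quo q t ⊠ d)
               (L.trans (L.solve 3 (λ l c M → l :* (c :* M) := c :* (l :* M)) L.refl (lin t) (C c) (linProduct ts))
               (L.trans e (L.trans (L.*-congʳ {d} (factor q t qt≈0)) (L.*-assoc (lin t) (quo q t) d))))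
    r ← common-root ts c (quo q t) d c≉0 e′ dd top
    pure (there r)
    where open Dot K

record MinimalPolynomial {A K : Ring} (f : Hom A K) (t : ∣ K ∣) : Set where
  private
    module A = Kit A
    module K = Kit K
  open Polynomial A
  open Degree A
  field
    poly′   : List A.Carrier
    {deg}   : ℕ
    degree  : DegLt poly′ (suc deg)
    lead≉0  : ¬ coeff poly′ deg A.≈ A.0#
    isRoot  : Polynomial.eval K (map (Hom.fun f) poly′) t K.≈ K.0#
    minimal : ∀ P → DegLt P deg → Polynomial.eval K (map (Hom.fun f) P) t K.≈ K.0# → P ≋ []

  lead : A.Carrier
  lead = coeff poly′ deg

  -- The pseudo-remainder vanishes at `t` and has smaller degree, so minimality makes it zero. The
  -- power of `lead` is the price for not dividing in `A`.
  divides : ∀ F → Polynomial.eval K (map (Hom.fun f) F) t K.≈ K.0# → ∃ λ e → ∃ λ q → C (lead A.^ e) ⊠ F ≋ q ⊠ poly′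
  divides F z = exponent , quotient , L.trans equation (L.trans (L.+-congˡ {quotient ⊠ poly′} (minimal remainder pdeg r≈0)) (L.+-identityʳ (quotient ⊠ poly′)))
    where
    open PseudoDivision (pseudoDivide F {poly′} {deg} degree) renaming (degree to pdeg)
    ev : Hom (Polynomial.poly A) K
    ev = Polynomial.evalʰ K t ∘ʰ mapʰ f
    module E = Hom ev
    r≈0 : E.fun remainder K.≈ K.0#
    r≈0 = begin
      E.fun remainder                                       ≈⟨ K.+-identityˡ _ ⟨
      K.0# K.+ E.fun remainder                              ≈⟨ K.+-congʳ (K.trans (E.*-homo quotient poly′) (K.trans (K.*-congˡ isRoot) (K.zeroʳ _))) ⟨
      E.fun (quotient ⊠ poly′) K.+ E.fun remainder          ≈⟨ E.+-homo (quotient ⊠ poly′) remainder ⟨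
      E.fun (quotient ⊠ poly′ ⊞ remainder)                  ≈⟨ E.cong equation ⟨
      E.fun (C (lead A.^ exponent) ⊠ F)                     ≈⟨ E.*-homo (C (lead A.^ exponent)) F ⟩
      E.fun (C (lead A.^ exponent)) K.* E.fun F             ≈⟨ K.trans (K.*-congˡ z) (K.zeroʳ _) ⟩
      K.0#                                                  ∎
      where open K using (begin_; step-≈-⟩; step-≈-⟨; _∎)

minimalPolynomial : ∀ {A K} (f : Hom A K) → Domain A → ∀ t P → (let open Polynomial A) → ¬ P ≋ [] →
  CommutativeRing._≈_ K (Polynomial.eval K (map (Hom.fun f) P) t) (CommutativeRing.0# K) → ¬¬ MinimalPolynomial f t
minimalPolynomial {A} {K} f domA t P P≉0 e = do
    (n , _ , dn , nz) ← leading P (List.length P) (degLt-length P) P≉0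
    (m , (Q , dQ , nzQ , eQ) , minimal) ← least Vanishing n (P , dn , nz , e)
    pure record { poly′ = Q ; degree = dQ ; lead≉0 = nzQ ; isRoot = eQ
      ; minimal = λ R dR eR → pw λ i → stable λ nzR → leading R m dR (λ R≋0 → nzR (at R≋0 i)) λ { (k , k<m , dk , nzk) →
          minimal k k<m (R , dk , nzk , eR) } }
  where
  open Kit A using (_≈_; 0#)
  open Polynomial A
  open Degree A
  open DomainTheory domA
  open Domain domA
  module K = Kit K
  Vanishing : ℕ → Set
  Vanishing n = ∃ λ Q → DegLt Q (suc n) × (¬ coeff Q n ≈ 0#) × Polynomial.eval K (map (Hom.fun f) Q) t K.≈ K.0#

-- A primitive element for the roots

ℤ-domain : Domain ℤᴿ
ℤ-domain = record
  { stable = λ {x} {y} → decidable-stable (x ℤ.≟ y)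
  ; cancel = λ {x} e x≢0 → [ (λ z → ⊥-elim (x≢0 z)) , (λ z → z) ]′ (ℤ.i*j≡0⇒i≡0∨j≡0 x e)
  ; char0 = λ m e → ≡.trans (≡.sym (ι-ℤ m)) e }

module IntegerAdjunction (K : Ring) (θ : ∣ K ∣) where
  open Kit K

  evalℤ : Hom (Polynomial.poly ℤᴿ) K
  evalℤ = Polynomial.evalʰ K θ ∘ʰ mapʰ (ιʰ K)

  open Quotient (Polynomial.poly ℤᴿ) (kernel evalℤ) public using () renaming (ring/ to ℤ[θ])
  open Quotient (Polynomial.poly ℤᴿ) (kernel evalℤ)

  value : Hom ℤ[θ] K
  value = lift evalℤ (λ x e → e)

  value-injective : ∀ {x} → Hom.fun value x ≈ 0# → CommutativeRing._≈_ ℤ[θ] x []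
  value-injective {x} = mem⇒∼0 {x}

  -- Membership in ℚ(θ), stated without division: some nonzero integer multiple lies in ℤ[θ].
  Rational : Carrier → Set
  Rational x = ∃ λ m → ∃ λ Q → m ≢ + 0 × ι m * x ≈ Hom.fun evalℤ Q

  private
    module E = Hom evalℤ
    module Pℤ = Polynomial ℤᴿ

    evalℤ-C : ∀ c → E.fun (Pℤ.C c) ≈ ι c
    evalℤ-C c = Polynomial.eval-C K (ι c) θ

  evalℤ-X : E.fun Pℤ.X ≈ θ
  evalℤ-X = Polynomial.eval-X K θ

  rational-θ : Rational θ
  rational-θ = + 1 , Pℤ.X , (λ ()) , trans (*-identityˡ θ) (sym evalℤ-X)

  rational-ι : ∀ m → Rational (ι m)
  rational-ι m = + 1 , Pℤ.C m , (λ ()) , trans (*-identityˡ _) (sym (evalℤ-C m))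

  rational-cong : ∀ {x y} → x ≈ y → Rational x → Rational y
  rational-cong e (m , Q , m≢0 , f) = m , Q , m≢0 , trans (*-congˡ (sym e)) f

  rational-+ : ∀ {x y} → Rational x → Rational y → Rational (x + y)
  rational-+ {x} {y} (m , P , m≢0 , e) (n , Q , n≢0 , f) = m ℤ.* n , Pℤ.C n Pℤ.⊠ P Pℤ.⊞ Pℤ.C m Pℤ.⊠ Q , m≢0 *≢0 n≢0 ,
    trans (*-congʳ (ι-*-homo m n)) (trans (solve 4 (λ m n x y → (m :* n) :* (x :+ y) := n :* (m :* x) :+ m :* (n :* y)) refl (ι m) (ι n) x y)
      (sym (trans (E.+-homo (Pℤ.C n Pℤ.⊠ P) _) (+-cong (trans (E.*-homo (Pℤ.C n) P) (*-cong (evalℤ-C n) (sym e))) (trans (E.*-homo (Pℤ.C m) Q) (*-cong (evalℤ-C m) (sym f)))))))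

  rational-* : ∀ {x y} → Rational x → Rational y → Rational (x * y)
  rational-* {x} {y} (m , P , m≢0 , e) (n , Q , n≢0 , f) = m ℤ.* n , P Pℤ.⊠ Q , m≢0 *≢0 n≢0 ,
    trans (*-congʳ (ι-*-homo m n)) (trans (solve 4 (λ m n x y → (m :* n) :* (x :* y) := (m :* x) :* (n :* y)) refl (ι m) (ι n) x y)
      (trans (*-cong e f) (sym (E.*-homo P Q))))

  rational-unscale : ∀ {m x} → m ≢ + 0 → Rational (ι m * x) → Rational x
  rational-unscale {m} {x} m≢0 (n , Q , n≢0 , e) = n ℤ.* m , Q , n≢0 *≢0 m≢0 , trans (trans (*-congʳ (ι-*-homo n m)) (*-assoc _ _ x)) e

module _ (K : Ring) where
  open Kit K
  open IntegerAdjunction K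

  rational-trans : ∀ {θ γ x} → Rational γ x → Rational θ γ → Rational θ x
  rational-trans {θ} {γ} (m , Q , m≢0 , e) r = rational-unscale θ m≢0 (rational-cong θ (sym e) (go Q))
    where
    go : ∀ Q → Rational θ (Hom.fun (evalℤ γ) Q)
    go [] = rational-ι θ (+ 0)
    go (c ∷ Q) = rational-+ θ (rational-ι θ c) (rational-* θ r (go Q))

module Primitive {K : Ring} (dom : Domain K) {n : ℕ} (dep : Dependent K n) {h : List ℤ} {m : ℕ} (monic : Monic ℤᴿ h m)
  {ts : List ∣ K ∣} (splits : Polynomial._≋_ K (map (Kit.ι K) h) (Degree.linProduct K ts)) where
  open Kit K
  open Polynomial K
  open Degree K
  open Domain dom
  open DomainTheory dom
  open IntegerAdjunction K

  ι-nonzero : ∀ f → NonZeroPolyℤ f → ¬ map ι f ≋ []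
  ι-nonzero f (i , nz) e = nz (char0 _ (trans (sym (coeff-map (ιʰ K) f i)) (at e i)))

  -- Excluding finitely many values of u makes t the only common root of h(X) and μ(γ + u t - u X).
  separating : ∀ μ → ¬ μ ≋ [] → ∀ γ t ss → ¬¬ (∃ λ N → ∀ u → N ≤ u → All (λ s → ¬ t ≈ s → ¬ eval μ (γ + ι (+ u) * (t - s)) ≈ 0#) ss)
  separating μ μ≉0 γ t [] = pure (0 , λ u _ → [])
  separating μ μ≉0 γ t (s ∷ ss) = do
    (N , good) ← separating μ μ≉0 γ t ss
    inj₂ t≉s ← em (t ≈ s)
      where inj₁ t≈s → pure (N , λ u le → (λ t≉s → ⊥-elim (t≉s t≈s)) ∷ good u le)
    (M , avoid) ← few-roots μ (List.length μ) (degLt-length μ) μ≉0 γ (t - s) (λ e → t≉s (trans (solve 2 (λ t s → t := (t :- s) :+ s) refl t s) (trans (+-congʳ e) (+-identityˡ s))))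
    pure (N ℕ.⊔ M , λ u le → (λ _ → avoid u (ℕ.≤-trans (ℕ.m≤n⊔m N M) le)) ∷ good u (ℕ.≤-trans (ℕ.m≤m⊔n N M) le))

  -- The classical argument for a primitive element γ + u t, with `A` standing for ℤ[θ]. The minimal
  -- polynomial `d` of `t` over `A` divides both h(X) and μ(θ - u X) up to powers of its leading
  -- coefficient. By the choice of `u` these share no root in `ts` other than `t`, so `d` is linear
  -- and exhibits `t` as a fraction over `A`.
  module Step (t γ : Carrier) (ht : eval (map ι h) t ≈ 0#) (μ : List ℤ) (μγ : eval (map ι μ) γ ≈ 0#) (u : ℕ)
    (good : All (λ s → ¬ t ≈ s → ¬ eval (map ι μ) (γ + ι (+ u) * (t - s)) ≈ 0#) ts)
    (A : Ring) (f : Hom A K) (f-injective : ∀ {x} → Hom.fun f x ≈ 0# → CommutativeRing._≈_ A x (CommutativeRing.0# A))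
    (θ : ∣ A ∣) (fθ : Hom.fun f θ ≈ γ + ι (+ u) * t) where
    module A = Kit A
    module PA = Polynomial A
    module DA = Degree A
    module F = Hom f
    domA : Domain A
    domA = Domain-sub f f-injective dom
    hA : List A.Carrier
    hA = map A.ι h
    hA≉0 : ¬ hA PA.≋ []
    hA≉0 e with Domain.char0 domA (+ 1) (A.trans (A.sym (proj₂ (monic-map (ιʰ A) h monic))) (PA.at e m))
    ... | ()
    over : ∀ P → map F.fun (map A.ι P) ≋ map ι P
    over = map-ι f
    hA-root : eval (map F.fun hA) t ≈ 0#
    hA-root = trans (Hom.cong (evalʰ t) (over h)) ht

    evalA : Carrier → Hom PA.poly K
    evalA s = evalʰ s ∘ʰ mapʰ f

    line : List A.Carrier
    line = θ ∷ A.- A.ι (+ u) ∷ []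
    μline : List A.Carrier
    μline = Polynomial.eval PA.poly (map (Kit.ι PA.poly) μ) line
    eval-line : ∀ s → Hom.fun (evalA s) line ≈ (γ + ι (+ u) * t) - ι (+ u) * s
    eval-line s = trans (+-cong fθ (*-congˡ (trans (+-cong (trans (F.neg-homo (A.ι (+ u))) (-‿cong (F.ι-homo (+ u)))) (zeroʳ s)) (+-identityʳ _))))
      (solve 3 (λ θ u s → θ :+ s :* (:- u) := θ :- u :* s) refl (γ + ι (+ u) * t) (ι (+ u)) s)
    eval-μline : ∀ s → Hom.fun (evalA s) μline ≈ eval (map ι μ) (γ + ι (+ u) * (t - s))
    eval-μline s = trans (eval-map (evalA s) (map (Kit.ι PA.poly) μ) line) (trans (Hom.cong (evalʰ (Hom.fun (evalA s) line)) (map-ι (evalA s) μ))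
      (eval-congʳ (map ι μ) (trans (eval-line s) (solve 4 (λ γ u t s → (γ :+ u :* t) :- u :* s := γ :+ u :* (t :- s)) refl γ (ι (+ u)) t s))))
    μline-root : Hom.fun (evalA t) μline ≈ 0#
    μline-root = trans (eval-μline t) (trans (eval-congʳ (map ι μ) (solve 3 (λ γ u t → γ :+ u :* (t :- t) := γ) refl γ (ι (+ u)) t)) μγ)

    module _ (mp : MinimalPolynomial f t) where
      open MinimalPolynomial mp renaming (poly′ to d)
      d̄ d₁ : List Carrier
      d̄ = map F.fun d
      d₁ = quo d̄ t
      d̄-factor : d̄ ≋ lin t ⊠ d₁
      d̄-factor = factor d̄ t isRoot

      d₁t≈Ddt : eval (map F.fun (DA.D d)) t ≈ eval d₁ t
      d₁t≈Ddt = begin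
        eval (map F.fun (DA.D d)) t                     ≈⟨ Hom.cong (evalʰ t) (L.trans (map-D f d) (L.trans (D-cong d̄-factor) (D-⊠ (lin t) d₁))) ⟩
        eval (D (lin t) ⊠ d₁ ⊞ lin t ⊠ D d₁) t          ≈⟨ Hom.+-homo (evalʰ t) (D (lin t) ⊠ d₁) (lin t ⊠ D d₁) ⟩
        eval (D (lin t) ⊠ d₁) t + eval (lin t ⊠ D d₁) t ≈⟨ +-cong (Hom.*-homo (evalʰ t) (D (lin t)) d₁) (Hom.*-homo (evalʰ t) (lin t) (D d₁)) ⟩
        eval (D (lin t)) t * eval d₁ t + eval (lin t) t * eval (D d₁) t ≈⟨ +-congˡ (*-congʳ (eval-lin t t)) ⟩
        eval (D (lin t)) t * eval d₁ t + (t - t) * eval (D d₁) t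
          ≈⟨ solve 3 (λ t x y → ((con (+ 1) :+ con (+ 0)) :+ t :* (con (+ 0) :+ t :* con (+ 0))) :* x :+ (t :- t) :* y := x) refl t (eval d₁ t) (eval (D d₁) t) ⟩
        eval d₁ t                                       ∎

      -- The cofactor d₁ = d / (X - t) would have positive degree and divide a nonzero multiple of
      -- the product of the X - t_i, hence vanish at some s in `ts`. This s differs from `t`, and
      -- d(s) = 0 forces μ(γ + u (t - s)) = 0, which `good` excludes.
      contradiction≥2 : ∀ k → deg ≡ suc (suc k) → ¬¬ ⊥
      contradiction≥2 k ≡.refl = do
          root ← common-root ts (F.fun (lead A.^ e₁)) (map F.fun q₁ ⊠ lin t) d₁ (λ z → Domain.power≉0 domA e₁ lead≉0 (f-injective z)) product
                   (quo-deg d̄ t (degLt-map f d degree)) (λ z → lead≉0 (f-injective (trans (sym (coeff-map f d (suc (suc k)))) (trans (sym (quo-top d̄ t (degLt-map f d degree))) z))))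
          let (good-s , d₁s≈0) = All.lookupAny good root
              s = Any.lookup root
              t≉s = λ t≈s → d₁t≉0 (trans (eval-congʳ d₁ t≈s) d₁s≈0)
              d̄s≈0 : eval d̄ s ≈ 0#
              d̄s≈0 = trans (Hom.cong (evalʰ s) d̄-factor) (trans (Hom.*-homo (evalʰ s) (lin t) d₁) (trans (*-congˡ d₁s≈0) (zeroʳ _)))
          pure (good-s t≉s (trans (sym (eval-μline s)) (cancel
            (trans (sym (trans (Hom.*-homo (evalA s) (PA.C (lead A.^ e₂)) μline) (*-congʳ (eval-C _ s))))
              (trans (Hom.cong (evalA s) eq₂) (trans (Hom.*-homo (evalA s) q₂ d) (trans (*-congˡ d̄s≈0) (zeroʳ _)))))
            (λ z → Domain.power≉0 domA e₂ lead≉0 (f-injective z)))))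
        where
        div₁ = divides hA hA-root
        e₁ = proj₁ div₁
        q₁ = proj₁ (proj₂ div₁)
        div₂ = divides μline μline-root
        e₂ = proj₁ div₂
        q₂ = proj₁ (proj₂ div₂)
        eq₂ = proj₂ (proj₂ div₂)
        product : C (F.fun (lead A.^ e₁)) ⊠ linProduct ts ≋ (map F.fun q₁ ⊠ lin t) ⊠ d₁
        product = L.trans (L.*-congˡ {C (F.fun (lead A.^ e₁))} (L.sym (L.trans (over h) splits)))
          (L.trans (L.sym (Hom.*-homo (mapʰ f) (PA.C (lead A.^ e₁)) hA))
          (L.trans (Hom.cong (mapʰ f) (proj₂ (proj₂ div₁))) (L.trans (Hom.*-homo (mapʰ f) q₁ d)
          (L.trans (L.*-congˡ {map F.fun q₁} d̄-factor) (L.sym (L.*-assoc (map F.fun q₁) (lin t) d₁))))))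
        -- The value is d′(t). If it were zero, minimality of `d` would give d′ = 0, although the
        -- top coefficient of d′ is deg d times `lead`, nonzero in characteristic zero.
        d₁t≉0 : ¬ eval d₁ t ≈ 0#
        d₁t≉0 z = lead≉0 (Domain.cancel domA (A.trans (A.sym (DA.coeff-D d (suc k))) (PA.at (minimal (DA.D d) degD (trans d₁t≈Ddt z)) (suc k)))
            (λ z → nonzero (Domain.char0 domA _ z)))
          where
          nonzero : ¬ + suc (suc k) ≡ + 0
          nonzero ()
          degD : DA.DegLt (DA.D d) (suc (suc k))
          degD i le = A.trans (DA.coeff-D d i) (A.trans (A.*-congˡ {A.ι (+ suc i)} (degree (suc i) (s≤s le))) (A.zeroʳ (A.ι (+ suc i))))

      t-rational : ∃ λ k → ∃ λ Q → k ≢ + 0 × ι k * t ≈ F.fun Q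
      t-rational = by-degree deg ≡.refl
        where
        d-small : ∀ i → F.fun (PA.coeff d i) ≈ coeff d̄ i
        d-small i = sym (coeff-map f d i)
        by-degree : ∀ n → deg ≡ n → ∃ λ k → ∃ λ Q → k ≢ + 0 × ι k * t ≈ F.fun Q
        by-degree zero ≡.refl = ⊥-elim (lead≉0 (f-injective (trans (d-small 0) (trans (sym (eval-deg0 {d̄} t (degLt-map f d degree))) isRoot))))
        -- Here d_0 + t lead = 0, and `y` satisfies lead y = k for a nonzero integer `k`;
        -- multiplying by `y` gives k t = -d_0 y.
        by-degree (suc zero) ≡.refl = k , A.- (PA.coeff d 0 A.* y) , k≢0 , (begin
            ι k * t                                ≈⟨ *-congʳ (F.ι-homo k) ⟨
            F.fun (A.ι k) * t                      ≈⟨ *-congʳ (trans (F.cong (A.sym ly≈k)) (F.*-homo lead y)) ⟩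
            (F.fun lead * F.fun y) * t             ≈⟨ solve 4 (λ c l y t → (l :* y) :* t := (c :+ t :* l) :* y :- c :* y) refl (F.fun (PA.coeff d 0)) (F.fun lead) (F.fun y) t ⟩
            (F.fun (PA.coeff d 0) + t * F.fun lead) * F.fun y - F.fun (PA.coeff d 0) * F.fun y
                                                   ≈⟨ +-congʳ (trans (*-congʳ linear) (zeroˡ _)) ⟩
            0# - F.fun (PA.coeff d 0) * F.fun y    ≈⟨ +-identityˡ _ ⟩
            - (F.fun (PA.coeff d 0) * F.fun y)     ≈⟨ trans (F.neg-homo (PA.coeff d 0 A.* y)) (-‿cong (F.*-homo (PA.coeff d 0) y)) ⟨
            F.fun (A.- (PA.coeff d 0 A.* y))       ∎)
          where
          inverse = DomainTheory.quasi-inverse domA (Dependent-sub f f-injective dep) lead lead≉0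
          y = proj₁ inverse
          k = proj₁ (proj₂ inverse)
          k≢0 = proj₁ (proj₂ (proj₂ inverse))
          ly≈k = proj₂ (proj₂ (proj₂ inverse))
          linear : F.fun (PA.coeff d 0) + t * F.fun lead ≈ 0#
          linear = trans (+-cong (d-small 0) (*-congˡ (d-small 1))) (trans (sym (trans (Hom.cong (evalʰ t) {d̄} {coeff d̄ 0 ∷ coeff d̄ 1 ∷ []}
                (pw λ { zero → refl ; (suc zero) → refl ; (suc (suc i)) → degLt-map f d degree (suc (suc i)) (s≤s (s≤s z≤n)) }))
                (+-congˡ (*-congˡ (trans (+-congˡ (zeroʳ t)) (+-identityʳ _)))))) isRoot)
        by-degree (suc (suc k)) e = ⊥-elim (contradiction≥2 k e (λ z → z))

  step : ∀ t γ → eval (map ι h) t ≈ 0# → ¬¬ (∃ λ θ → Rational θ t × Rational θ γ)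
  step t γ ht = do
    let (μ , nz , μγ) = algebraic K dep γ
    (u , good) ← separating (map ι μ) (ι-nonzero μ nz) γ t ts
    let θ = γ + ι (+ u) * t
        module S = Step t γ ht μ μγ u (good u ℕ.≤-refl) (ℤ[θ] θ) (value θ) (λ {x} → value-injective θ {x}) (Polynomial.X ℤᴿ) (evalℤ-X θ)
    mp ← minimalPolynomial (value θ) S.domA t S.hA S.hA≉0 S.hA-root
    let t-rational : Rational θ t
        t-rational = S.t-rational mp
    pure (θ , t-rational , rational-cong θ (solve 3 (λ γ u t → (γ :+ u :* t) :+ (:- u) :* t := γ) refl γ (ι (+ u)) t)
      (rational-+ θ (rational-θ θ) (rational-* θ (rational-cong θ (ι-neg-homo (+ u)) (rational-ι θ (ℤ.- + u))) t-rational)))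

  primitiveElement : ∀ ss → All (λ s → eval (map ι h) s ≈ 0#) ss → ¬¬ (∃ λ θ → All (Rational θ) ss)
  primitiveElement [] [] = pure (0# , [])
  primitiveElement (s ∷ ss) (e ∷ es) = do
    (γ , rs) ← primitiveElement ss es
    (θ , rs′ , rγ) ← step s γ e
    pure (θ , rs′ ∷ All.map (λ r → rational-trans K r rγ) rs)

-- Primes modulo which the characteristic polynomial splits

-- Throughout, `i` and `j` are inverses of the denominators `m` and `n`, so i P plays the part of P
-- / m.
module Fractions (R : Ring) where
  open Kit R

  inverse-* : ∀ {m i n j} → m * i ≈ 1# → n * j ≈ 1# → (m * n) * (i * j) ≈ 1#
  inverse-* {m} {i} {n} {j} e f = trans (solve 4 (λ m i n j → (m :* n) :* (i :* j) := (m :* i) :* (n :* j)) refl m i n j)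
    (trans (*-cong e f) (*-identityˡ 1#))

  fraction-cong : ∀ {m i n j P Q} → m * i ≈ 1# → n * j ≈ 1# → n * P - m * Q ≈ 0# → i * P ≈ j * Q
  fraction-cong {m} {i} {n} {j} {P} {Q} mi nj e = begin
    i * P                                       ≈⟨ trans (*-congʳ nj) (*-identityˡ _) ⟨
    (n * j) * (i * P)                           ≈⟨ solve 6 (λ n j i P m Q → (n :* j) :* (i :* P) := (i :* j) :* (n :* P :- m :* Q) :+ (m :* i) :* (j :* Q)) refl n j i P m Q ⟩
    (i * j) * (n * P - m * Q) + (m * i) * (j * Q)  ≈⟨ +-cong (trans (*-congˡ e) (zeroʳ _)) (trans (*-congʳ mi) (*-identityˡ _)) ⟩
    0# + j * Q                                  ≈⟨ +-identityˡ _ ⟩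
    j * Q                                       ∎

  fraction-+ : ∀ {m i n j P Q} → m * i ≈ 1# → n * j ≈ 1# → (i * j) * (n * P + m * Q) ≈ i * P + j * Q
  fraction-+ {m} {i} {n} {j} {P} {Q} mi nj = begin
    (i * j) * (n * P + m * Q)                 ≈⟨ solve 6 (λ i j n P m Q → (i :* j) :* (n :* P :+ m :* Q) := (n :* j) :* (i :* P) :+ (m :* i) :* (j :* Q)) refl i j n P m Q ⟩
    (n * j) * (i * P) + (m * i) * (j * Q)     ≈⟨ +-cong (trans (*-congʳ nj) (*-identityˡ _)) (trans (*-congʳ mi) (*-identityˡ _)) ⟩
    i * P + j * Q                             ∎

  fraction-* : ∀ i j P Q → (i * j) * (P * Q) ≈ (i * P) * (j * Q)
  fraction-* = solve 4 (λ i j P Q → (i :* j) :* (P :* Q) := (i :* P) :* (j :* Q)) refl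

  distrib-1 : ∀ x y → x * y ≈ x → x * (y - 1#) ≈ 0#
  distrib-1 x y e = trans (solve 2 (λ x y → x :* (y :- con (+ 1)) := x :* y :- x) refl x y) (trans (+-congʳ e) (-‿inverseʳ x))

  minus-1 : ∀ y → y - 1# ≈ 0# → y ≈ 1#
  minus-1 y e = trans (solve 1 (λ y → y := (y :- con (+ 1)) :+ con (+ 1)) refl y) (trans (+-congʳ e) (+-identityˡ 1#))

  one-plus-minus : ∀ x → x ≈ (1# + x) - 1#
  one-plus-minus = solve 1 (λ x → x := (con (+ 1) :+ x) :- con (+ 1)) refl

  distrib-minus : ∀ d x y → d * (x - y) ≈ d * x - d * y
  distrib-minus = solve 3 (λ d x y → d :* (x :- y) := d :* x :- d :* y) refl

prime-factor : ∀ n → 2 ≤ n → ∃ λ p → Prime p × p ℕ.∣ n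
prime-factor n@(suc _) 2≤n = go factors factorsPrime isFactorisation
  where
  open PrimeFactorisation (factorise n)
  go : ∀ ps → All Prime ps → n ≡ ℕ.product ps → ∃ λ p → Prime p × p ℕ.∣ n
  go [] _ e = ⊥-elim (ℕ.<⇒≢ 2≤n (≡.sym e))
  go (p ∷ ps) (pr ∷ _) e = p , pr , ≡.subst (p ℕ.∣_) (≡.sym e) (ℕ.m∣m*n _)

∣n! : ∀ {p n} → p ≢ 0 → p ≤ n → p ℕ.∣ n !
∣n! {zero} p≢0 _ = ⊥-elim (p≢0 ≡.refl)
∣n! {suc p} {n} _ le = ℕ.∣-trans (ℕ.m∣m*n (p !)) (ℕ.m≤n⇒m!∣n! le)

-- Euclid's argument: a prime below `N` divides the factorial and would therefore divide 1.
large-prime-factor : ∀ N k → k ≢ + 0 → ∃ λ p → Prime p × N ≤ p × + p ℤ.∣ (+ 1 ℤ.+ + ((3 ℕ.+ N) !) ℤ.* k)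
large-prime-factor N k k≢0 = p , pr , ℕ.≮⇒≥ large , p∣w
  where
  -- The summand 3 ensures M ≥ 3, so that |1 + M k| ≥ M |k| - 1 ≥ 2 even for negative `k` and a
  -- prime factor exists.
  M = (3 ℕ.+ N) !
  w = + 1 ℤ.+ + M ℤ.* k
  3≤M : 3 ≤ M
  3≤M = ℕ.≤-trans (ℕ.m≤m+n 3 N) (ℕ.≤-trans (ℕ.≤-reflexive (≡.sym (ℕ.*-identityʳ _))) (ℕ.*-monoʳ-≤ (3 ℕ.+ N) (ℕ.1≤n! (2 ℕ.+ N))))
  1≤k : 1 ≤ ℤ.∣ k ∣
  1≤k = ℕ.n≢0⇒n>0 (λ z → k≢0 (ℤ.∣i∣≡0⇒i≡0 z))
  3≤Mk : 3 ≤ ℤ.∣ w ∣ ℕ.+ 1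
  3≤Mk = begin
    3                              ≤⟨ 3≤M ⟩
    M                              ≡⟨ ℕ.*-identityʳ M ⟨
    M ℕ.* 1                        ≤⟨ ℕ.*-monoʳ-≤ M 1≤k ⟩
    M ℕ.* ℤ.∣ k ∣                  ≡⟨ ℤ.abs-* (+ M) k ⟨
    ℤ.∣ + M ℤ.* k ∣                ≡⟨ ≡.cong ℤ.∣_∣ (Fractions.one-plus-minus ℤᴿ (+ M ℤ.* k)) ⟩
    ℤ.∣ w ℤ.- + 1 ∣                ≤⟨ ℤ.∣i-j∣≤∣i∣+∣j∣ w (+ 1) ⟩
    ℤ.∣ w ∣ ℕ.+ 1                  ∎
    where
    open ℕ.≤-Reasoning
  factor′ = prime-factor ℤ.∣ w ∣ (ℕ.+-cancelʳ-≤ 1 2 ℤ.∣ w ∣ 3≤Mk)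
  p = proj₁ factor′
  pr = proj₁ (proj₂ factor′)
  p∣w : + p ℤ.∣ w
  p∣w = proj₂ (proj₂ factor′)
  large : ¬ p < N
  large p<N = ¬prime[1] (≡.subst Prime (ℕ.∣1⇒≡1 p∣1) pr)
    where
    p∣M : p ℕ.∣ M
    p∣M = ∣n! (λ z → ¬prime[0] (≡.subst Prime z pr)) (ℕ.≤-trans (ℕ.<⇒≤ p<N) (ℕ.m≤n+m N 3))
    p∣1 : + p ℤ.∣ + 1
    p∣1 = ℤˢ.∣⇒∣ᵤ (ℤˢ.∣m+n∣n⇒∣m {+ p} {+ 1} {+ M ℤ.* k} (ℤˢ.∣ᵤ⇒∣ {+ p} {w} p∣w) (ℤˢ.∣m⇒∣m*n k (ℤˢ.∣ᵤ⇒∣ {+ p} {+ M} p∣M)))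

abstract
  large-prime-factors : ∀ N → ∃ λ F → F ≢ + 0 × (∀ k → k ≢ + 0 → ∃ λ p → Prime p × N ≤ p × + p ℤ.∣ (+ 1 ℤ.+ F ℤ.* k))
  large-prime-factors N = + ((3 ℕ.+ N) !) , (λ z → ℕ.≢-nonZero⁻¹ _ {{(3 ℕ.+ N) ℕ.!≢0}} (ℤ.+-injective z)) , large-prime-factor N

module _ {R : Ring} (dom : Domain R) where
  open Kit R
  open Polynomial R
  open Degree R
  open Domain dom
  open DomainTheory dom

  -- Evaluate c + X g at v = u c F: the result is c (1 + F u g(v)), and `few-roots` provides a
  -- positive u with g(v) ≠ 0. With `F` divisible by all small primes, the second factor has only
  -- large prime divisors.
  value-multiple : ∀ c g → ¬ g ≋ [] → ¬ c ≈ 0# → ∀ {F} → ¬ F ≈ 0# →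
    ¬¬ (∃ λ k → ∃ λ v → ¬ k ≈ 0# × eval (c ∷ g) v ≈ c * (1# + F * k))
  value-multiple c g g≉0 c≉0 {F} F≉0 = do
    (M , good) ← few-roots g (List.length g) (degLt-length g) g≉0 0# (c * F) (product≉0 c≉0 F≉0)
    let v = 0# + ι (+ suc M) * (c * F)
    pure (ι (+ suc M) * eval g v , v , product≉0 (suc≉0 M) (good (suc M) (ℕ.n≤1+n M)) ,
      solve 4 (λ c F u x → c :+ (con (+ 0) :+ u :* (c :* F)) :* x := c :* (con (+ 1) :+ F :* (u :* x))) refl c F (ι (+ suc M)) (eval g v))
    where
    suc≉0 : ∀ M → ¬ ι (+ suc M) ≈ 0#
    suc≉0 M e with char0 (+ suc M) e
    ... | ()

prime-dividing-value : ∀ g {n} → Degree.DegLt ℤᴿ g (suc (suc n)) → Polynomial.coeff ℤᴿ g (suc n) ≢ + 0 → ∀ N →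
  ¬¬ (∃ λ p → Prime p × N ≤ p × (∃ λ v → + p ℤ.∣ Polynomial.eval ℤᴿ g v))
prime-dividing-value [] _ top N = ⊥-elim (top ≡.refl)
prime-dividing-value (c ∷ g) {n} d top N with c ℤ.≟ + 0
-- With constant term zero every prime divides the value at 0, so any prime above `N` will do.
... | yes ≡.refl with large-prime-factors N
...   | F , F≢0 , factor-of with factor-of (+ 1) (λ ())
...     | p , pr , le , _ = pure (p , pr , le , + 0 , (p ℕ.∣0))
prime-dividing-value (c ∷ g) {n} d top N | no c≢0 with large-prime-factors N
... | F , F≢0 , factor-of = do
    (k , v , k≢0 , e) ← value-multiple ℤ-domain c g (λ z → top (Polynomial.at z n)) c≢0 F≢0
    let (p , pr , le , d) = factor-of k k≢0
    pure (p , pr , le , v , ∣-multiple {p} {c} e d)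
  where
  ∣-multiple : ∀ {p c x y} → y ≡ c ℤ.* x → + p ℤ.∣ x → + p ℤ.∣ y
  ∣-multiple {p} {c} {x} ≡.refl d = ℤˢ.∣⇒∣ᵤ {+ p} {c ℤ.* x} (ℤˢ.∣n⇒∣m*n c (ℤˢ.∣ᵤ⇒∣ {+ p} {x} d))

record PrimeField (p : ℕ) : Set₁ where
  field
    𝔽 : Ring
  open Kit 𝔽
  field
    cancel     : ∀ x y → x * y ≈ 0# → ¬ x ≈ 0# → y ≈ 0#
    surjective : ∀ x → ∃ λ m → x ≈ ι m
    ι≈0⇒∣      : ∀ m → ι m ≈ 0# → + p ℤ.∣ m
    ∣⇒ι≈0      : ∀ m → + p ℤ.∣ m → ι m ≈ 0#

  open Fractions 𝔽

  module _ (pr : Prime p) where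

    fermat : ∀ x → x ^ p ≈ x
    fermat x with surjective x
    ... | m , e = trans (^-congˡ p e) (trans (Frobenius.ι^p 𝔽 pr (∣⇒ι≈0 (+ p) ℕ.∣-refl) m) (sym e))

    inverse : ∀ x → ¬ x ≈ 0# → ∃ λ y → x * y ≈ 1#
    inverse x x≉0 = go p ≡.refl
      where
      go : ∀ n → n ≡ p → ∃ λ y → x * y ≈ 1#
      go 0 ≡.refl = ⊥-elim (¬prime[0] pr)
      go 1 ≡.refl = ⊥-elim (¬prime[1] pr)
      -- Here n = p - 2: Fermat's theorem gives x (x^(p-1) - 1) = 0, and `x` cancels.
      go (suc (suc n)) ≡.refl = x ^ n , minus-1 (x * x ^ n) (cancel x (x * x ^ n - 1#) (distrib-1 x (x * x ^ n) (fermat x)) x≉0)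

    1≉0 : ¬ 1# ≈ 0#
    1≉0 e = ¬prime[1] (≡.subst Prime (ℕ.∣1⇒≡1 (ι≈0⇒∣ (+ 1) e)) pr)

  large-nonzero : ∀ m → m ≢ + 0 → ℤ.∣ m ∣ < p → ¬ ι m ≈ 0#
  large-nonzero m m≢0 m<p e = ℕ.<⇒≱ m<p (ℕ.∣⇒≤ {{ℕ.≢-nonZero (λ z → m≢0 (ℤ.∣i∣≡0⇒i≡0 z))}} (ι≈0⇒∣ m e))

primeField : ∀ {p} → Prime p → PrimeField p
primeField {p} pr = record
  { 𝔽 = ring/
  ; cancel = λ x y e x≁0 → [ (λ d → ⊥-elim (x≁0 (divides⇒∼ {x} d))) , (λ d → divides⇒∼ {y} d) ]′
      (euclidsLemma ℤ.∣ x ∣ ℤ.∣ y ∣ pr (≡.subst (p ℕ.∣_) (ℤ.abs-* x y) (∼⇒divides e)))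
  ; surjective = λ x → x , ℤ-initial proj x
  ; ι≈0⇒∣ = λ m e → ∼⇒divides (Kit.trans ring/ (ℤ-initial proj m) e)
  ; ∣⇒ι≈0 = λ m d → Kit.trans ring/ (Kit.sym ring/ (ℤ-initial proj m)) (divides⇒∼ {m} d) }
  where
  open Quotient ℤᴿ (principal ℤᴿ (+ p))
  divides⇒∼ : ∀ {x} → + p ℤ.∣ x → x ∼ + 0
  divides⇒∼ {x} d with ℤˢ.∣ᵤ⇒∣ {+ p} {x} d
  ... | ℤˢ.divides q e = mem⇒∼0 (q , e)
  ∼⇒divides : ∀ {x} → x ∼ + 0 → + p ℤ.∣ x
  ∼⇒divides {x} e = let (q , f) = ∼0⇒mem e in ℤˢ.∣⇒∣ᵤ {+ p} {x} (ℤˢ.divides q f)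

-- No map from `K` to `F` exists in general. But the factorisation involves only elements of `A`, so
-- it descends along the injection ε and can then be pushed forward along φ.
transfer-splitting : ∀ {A K F} (ε : Hom A K) (φ : Hom A F) →
  (∀ {x y} → CommutativeRing._≈_ K (Hom.fun ε x) (Hom.fun ε y) → CommutativeRing._≈_ A x y) →
  ∀ h ss {ts} → map (Hom.fun ε) ss ≡ ts → Polynomial._≋_ K (map (Kit.ι K) h) (Degree.linProduct K ts) →
  Polynomial._≋_ F (map (Kit.ι F) h) (Degree.linProduct F (map (Hom.fun φ) ss))
transfer-splitting {A} {K} {F} ε φ injective h ss ≡.refl e =
    LF.trans (LF.sym (map-ι φ h)) (LF.trans (Hom.cong (mapʰ φ) {map (Kit.ι A) h} {Degree.linProduct A ss} in-A) (map-linProduct φ ss))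
  where
  module K = Kit K
  module LF = Kit (Polynomial.poly F)
  module LK = Kit (Polynomial.poly K)
  in-K : Polynomial._≋_ K (map (Hom.fun ε) (map (Kit.ι A) h)) (map (Hom.fun ε) (Degree.linProduct A ss))
  in-K = LK.trans (map-ι ε h) (LK.trans e (LK.sym (map-linProduct ε ss)))
  in-A : Polynomial._≋_ A (map (Kit.ι A) h) (Degree.linProduct A ss)
  in-A = Polynomial.pw λ i → injective (K.trans (K.sym (coeff-map ε (map (Kit.ι A) h) i)) (K.trans (Polynomial.at in-K i) (coeff-map ε (Degree.linProduct A ss) i)))

-- The homomorphism from a localisation of ℤ[θ] to a prime field

module Reduction {K : Ring} {θ : ∣ K ∣} (mp : MinimalPolynomial (ιʰ K) θ) {p : ℕ} (pr : Prime p) (Fp : PrimeField p) where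
  open IntegerAdjunction K θ
  open PrimeField Fp using (𝔽; cancel; 1≉0)
  open Fractions 𝔽 using (inverse-*; fraction-cong; fraction-+; fraction-*)
  open MinimalPolynomial mp renaming (poly′ to g)
  private
    module K = Kit K
    module 𝔽 = Kit 𝔽
    module Pℤ = Polynomial ℤᴿ
    module Z = Kit ℤᴿ

  at : 𝔽.Carrier → Hom (Polynomial.poly ℤᴿ) 𝔽
  at v = Polynomial.evalʰ 𝔽 v ∘ʰ mapʰ (ιʰ 𝔽)

  module _ (lead≉0 : ¬ 𝔽.ι lead 𝔽.≈ 𝔽.0#) (v : 𝔽.Carrier) (g-root : Hom.fun (at v) g 𝔽.≈ 𝔽.0#) where
    open 𝔽
    private module V = Hom (at v)

    at-C : ∀ c → V.fun (Pℤ.C c) ≈ ι c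
    at-C c = Polynomial.eval-C 𝔽 (ι c) v

    -- Some power of `lead` times `E` is a multiple of `g`, and g(v) = 0 while `lead` is nonzero in
    -- 𝔽. So sending θ to `v` is well defined on ℤ[θ].
    vanishing : ∀ E → Hom.fun evalℤ E K.≈ K.0# → V.fun E ≈ 0#
    vanishing E z = cancel (ι (lead Z.^ e)) (V.fun E) (begin
        ι (lead Z.^ e) * V.fun E              ≈⟨ *-congʳ (at-C (lead Z.^ e)) ⟨
        V.fun (Pℤ.C (lead Z.^ e)) * V.fun E   ≈⟨ V.*-homo (Pℤ.C (lead Z.^ e)) E ⟨
        V.fun (Pℤ.C (lead Z.^ e) Pℤ.⊠ E)      ≈⟨ V.cong (proj₂ (proj₂ div)) ⟩
        V.fun (q Pℤ.⊠ g)                      ≈⟨ V.*-homo q g ⟩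
        V.fun q * V.fun g                     ≈⟨ trans (*-congˡ g-root) (zeroʳ _) ⟩
        0#                                    ∎) (λ z → power e (trans (sym (Hom.^-homo (ιʰ 𝔽) lead e)) z))
      where
      div = divides E z
      e = proj₁ div
      q = proj₁ (proj₂ div)
      power : ∀ e → ¬ ι lead ^ e ≈ 0#
      power zero = 1≉0 pr
      power (suc e) z = power e (cancel (ι lead) (ι lead ^ e) z lead≉0)

    -- A chosen expression Q(θ) / m together with an inverse of m in 𝔽. The choice is kept as data
    -- so that `reduce` can compute with it.
    Local : K.Carrier → Set
    Local x = Σ (Rational x) λ r → ∃ λ i → ι (proj₁ r) * i ≈ 1#

    reduce : Σ K.Carrier Local → Carrier
    reduce (x , (m , Q , _) , i , _) = i * V.fun Q

    closed : Closed K Local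
    closed = record
      { +-closed = λ { (r , i , e) (s , j , f) → rational-+ r s , i * j , trans (*-congʳ (ι-*-homo (proj₁ r) (proj₁ s))) (inverse-* e f) }
      ; *-closed = λ { (r , i , e) (s , j , f) → rational-* r s , i * j , trans (*-congʳ (ι-*-homo (proj₁ r) (proj₁ s))) (inverse-* e f) }
      ; neg-closed = λ { {x} (r , i , e) → rational-cong (K.solve 1 (λ x → con -[1+ 0 ] :* x := :- x) K.refl x) (rational-* (rational-ι -[1+ 0 ]) r)
                       , 1# * i , trans (*-congʳ (ι-*-homo (+ 1) (proj₁ r))) (inverse-* (*-identityˡ 1#) e) }
      ; 1-closed = rational-ι (+ 1) , 1# , *-identityˡ 1#
      ; 0-closed = rational-ι (+ 0) , 1# , *-identityˡ 1# }

    open Subring K closed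

    -- Two expressions P / m and Q / n of the same element make n P - m Q vanish at θ, hence also at
    -- `v`, and the inverses of m and n in 𝔽 turn this into equality of the reductions.
    reduce-unique : ∀ x y → proj₁ x K.≈ proj₁ y → reduce x ≈ reduce y
    reduce-unique (x , (m , P , _ , e) , i , mi) (y , (n , Q , _ , f) , j , nj) x≈y = fraction-cong mi nj zero′
      where
      E = Pℤ.C n Pℤ.⊠ P Pℤ.⊞ Pℤ.neg (Pℤ.C m Pℤ.⊠ Q)
      evalE : ∀ {B} (φ : Hom (Polynomial.poly ℤᴿ) B) → (let module B = Kit B) → Hom.fun φ E B.≈ Hom.fun φ (Pℤ.C n) B.* Hom.fun φ P B.- Hom.fun φ (Pℤ.C m) B.* Hom.fun φ Q
      evalE {B} φ = B.trans (Φ.+-homo (Pℤ.C n Pℤ.⊠ P) (Pℤ.neg (Pℤ.C m Pℤ.⊠ Q))) (B.+-cong (Φ.*-homo (Pℤ.C n) P) (B.trans (Φ.neg-homo (Pℤ.C m Pℤ.⊠ Q)) (B.-‿cong (Φ.*-homo (Pℤ.C m) Q))))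
        where
        module B = Kit B
        module Φ = Hom φ
      E≈0 : Hom.fun evalℤ E K.≈ K.0#
      E≈0 = K.trans (evalE evalℤ) (K.trans (K.+-cong (K.*-cong (Polynomial.eval-C K (K.ι n) θ) (K.sym e)) (K.-‿cong (K.*-cong (Polynomial.eval-C K (K.ι m) θ) (K.trans (K.sym f) (K.*-congˡ (K.sym x≈y))))))
        (K.solve 3 (λ n m x → n :* (m :* x) :- m :* (n :* x) := con (+ 0)) K.refl (K.ι n) (K.ι m) x))
      zero′ : ι n * V.fun P - ι m * V.fun Q ≈ 0#
      zero′ = trans (sym (trans (evalE (at v)) (+-cong (*-congʳ (at-C n)) (-‿cong (*-congʳ (at-C m)))))) (vanishing E E≈0)

    reduceʰ : Hom sub 𝔽
    reduceʰ = record
      { fun = reduce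
      ; cong = λ {x} {y} e → reduce-unique x y (equal e)
      ; +-homo = λ { (x , (m , P , _ , _) , i , mi) (y , (n , Q , _ , _) , j , nj) →
          trans (*-congˡ (trans (V.+-homo (Pℤ.C n Pℤ.⊠ P) (Pℤ.C m Pℤ.⊠ Q)) (+-cong (trans (V.*-homo (Pℤ.C n) P) (*-congʳ (at-C n))) (trans (V.*-homo (Pℤ.C m) Q) (*-congʳ (at-C m))))))
            (fraction-+ mi nj) }
      ; *-homo = λ { (x , (m , P , _ , _) , i , mi) (y , (n , Q , _ , _) , j , nj) → trans (*-congˡ (V.*-homo P Q)) (fraction-* i j (V.fun P) (V.fun Q)) }
      ; 1-homo = trans (*-identityˡ _) V.1-homo }

    localise : ∀ ts → All Local ts → List (Σ K.Carrier Local)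
    localise [] [] = []
    localise (t ∷ ts) (l ∷ ls) = (t , l) ∷ localise ts ls

    include-localise : ∀ ts ls → map (Hom.fun include) (localise ts ls) ≡ ts
    include-localise [] [] = ≡.refl
    include-localise (t ∷ ts) (l ∷ ls) = ≡.cong (t ∷_) (include-localise ts ls)

    splits-modulo : ∀ h ts → All Local ts → Polynomial._≋_ K (map K.ι h) (Degree.linProduct K ts) →
      ∃ λ ss → Polynomial._≋_ 𝔽 (map ι h) (Degree.linProduct 𝔽 ss)
    splits-modulo h ts ls e = map (Hom.fun reduceʰ) (localise ts ls) ,
      transfer-splitting include reduceʰ (λ e → same e) h (localise ts ls) (include-localise ts ls) e

module _ {K : Ring} {θ : ∣ K ∣} where
  open IntegerAdjunction K θ

  denominators : ∀ {ts} → All Rational ts → ℕ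
  denominators [] = 0
  denominators ((m , _) ∷ rs) = suc ℤ.∣ m ∣ ℕ.⊔ denominators rs

-- Congruences at infinitely many primes

module _ (rec : SeparableRecurrence) where
  open SeparableRecurrence rec

  congruent-modulo : ∀ {p} (pr : Prime p) (Fp : PrimeField p) → (let open PrimeField Fp) → ∀ ss →
    Polynomial._≋_ 𝔽 (map (Kit.ι 𝔽) h) (Degree.linProduct 𝔽 ss) → ¬ CommutativeRing._≈_ 𝔽 (Kit.ι 𝔽 Δ) (CommutativeRing.0# 𝔽) →
    + p ℤ.∣ b p ℤ.- b 1
  congruent-modulo {p} pr Fp ss e Δ≉0 = ι≈0⇒∣ (b p ℤ.- b 1) (trans (trans (ι-+-homo (b p) (ℤ.- b 1)) (+-congˡ (ι-neg-homo (b 1)))) (cancel (ι Δ) (ι (b p) - ι (b 1)) (begin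
      ι Δ * (ι (b p) - ι (b 1))                    ≈⟨ Fractions.distrib-minus 𝔽 (ι Δ) (ι (b p)) (ι (b 1)) ⟩
      ι Δ * ι (b p) - ι Δ * ι (b 1)                ≈⟨ +-cong (ι-*-homo Δ (b p)) (-‿cong (ι-*-homo Δ (b 1))) ⟨
      ι (Δ ℤ.* b p) - ι (Δ ℤ.* b 1)                ≈⟨ +-cong (proj₂ tf p) (-‿cong (proj₂ tf 1)) ⟩
      dot cs (Vec.map (_^ p) ts) - dot cs (Vec.map (_^ 1) ts) ≈⟨ +-congʳ (dot-congʳ cs (Vec.map (_^ p) ts) (Vec.map (_^ 1) ts) same-power) ⟩
      dot cs (Vec.map (_^ 1) ts) - dot cs (Vec.map (_^ 1) ts) ≈⟨ -‿inverseʳ _ ⟩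
      0#                                           ∎) Δ≉0))
    where
    open PrimeField Fp
    open Kit 𝔽
    open Dot 𝔽
    tf = trace-formula rec 𝔽 ss e
    cs = proj₁ tf
    ts = fromList ss
    same-power : ∀ i → lookup (Vec.map (_^ p) ts) i ≈ lookup (Vec.map (_^ 1) ts) i
    same-power i = begin
      lookup (Vec.map (_^ p) ts) i   ≡⟨ lookup-map i (_^ p) ts ⟩
      lookup ts i ^ p                ≈⟨ fermat pr (lookup ts i) ⟩
      lookup ts i                    ≈⟨ *-identityʳ _ ⟨
      lookup ts i ^ 1                ≡⟨ lookup-map i (_^ 1) ts ⟨
      lookup (Vec.map (_^ 1) ts) i   ∎

  module _ {K : Ring} (dom : Domain K) {n : ℕ} (dep : Dependent K n) (ts : List ∣ K ∣)
    (splits : Polynomial._≋_ K (map (Kit.ι K) h) (Degree.linProduct K ts)) where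
    private
      module K = Kit K
      module PK = Polynomial K

    roots-vanish : All (λ s → PK.eval (map K.ι h) s K.≈ K.0#) ts
    roots-vanish = All.map (λ {s} e → K.trans (Hom.cong (PK.evalʰ s) splits) e) (go ts)
      where
      go : ∀ ss → All (λ s → PK.eval (Degree.linProduct K ss) s K.≈ K.0#) ss
      go [] = []
      go (t ∷ ss) = Dot.eval-linProduct K (t ∷ ss) zero ∷
        All.map (λ {s} e → K.trans (Hom.*-homo (PK.evalʰ s) (Degree.lin K t) (Degree.linProduct K ss)) (K.trans (K.*-congˡ e) (K.zeroʳ _))) (go ss)

    infinitely-many : ∀ N → ¬¬ (∃ λ p → Prime p × N ≤ p × + p ℤ.∣ b p ℤ.- b 1)
    infinitely-many N = do
        (θ , rationals) ← primitiveElement ts roots-vanish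
        let (f , nz , f-root) = algebraic K dep θ
        mp ← minimalPolynomial (ιʰ K) ℤ-domain θ f (λ z → let (i , nzi) = nz in nzi (Polynomial.at z i)) f-root
        at-prime θ rationals mp
      where
      open Primitive dom dep monic {ts} splits
      at-prime : ∀ θ → All (IntegerAdjunction.Rational K θ) ts → MinimalPolynomial (ιʰ K) θ → ¬¬ (∃ λ p → Prime p × N ≤ p × + p ℤ.∣ b p ℤ.- b 1)
      at-prime θ rationals mp = by-degree (MinimalPolynomial.deg mp) ≡.refl
        where
        open MinimalPolynomial mp renaming (poly′ to g; deg to deg-g)
        bound : ℕ
        -- A prime exceeding the absolute values of `lead`, `Δ` and all denominators of the roots
        -- divides none of these nonzero integers, so all of them are invertible modulo that prime.
        bound = (N ℕ.⊔ suc ℤ.∣ lead ∣) ℕ.⊔ (suc ℤ.∣ Δ ∣ ℕ.⊔ denominators {K} {θ} rationals)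
        by-degree : ∀ n → deg-g ≡ n → ¬¬ (∃ λ p → Prime p × N ≤ p × + p ℤ.∣ b p ℤ.- b 1)
        by-degree zero ≡.refl = ⊥-elim (lead≉0 (Domain.char0 dom lead (K.trans (K.sym (coeff-map (ιʰ K) g 0))
          (K.trans (K.sym (Degree.eval-deg0 K {map K.ι g} θ (degLt-map (ιʰ K) g degree))) isRoot))))
        by-degree (suc n) ≡.refl = do
            (p , pr , le , v , p∣gv) ← prime-dividing-value g degree lead≉0 bound
            pure (p , pr , ℕ.≤-trans (ℕ.≤-trans (ℕ.m≤m⊔n N _) (ℕ.m≤m⊔n (N ℕ.⊔ suc ℤ.∣ lead ∣) _)) le , divides-at p pr le v p∣gv)
          where
          divides-at : ∀ p → Prime p → bound ≤ p → ∀ v → + p ℤ.∣ Polynomial.eval ℤᴿ g v → + p ℤ.∣ b p ℤ.- b 1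
          divides-at p pr le v p∣gv = congruent-modulo pr Fp (proj₁ split-𝔽) (proj₂ split-𝔽)
              (large-nonzero Δ Δ≢0 (ℕ.≤-trans (ℕ.≤-trans (ℕ.m≤m⊔n (suc ℤ.∣ Δ ∣) (denominators {K} {θ} rationals)) (ℕ.m≤n⊔m (N ℕ.⊔ suc ℤ.∣ lead ∣) _)) le))
            where
            Fp : PrimeField p
            Fp = primeField pr
            open PrimeField Fp
            open Kit 𝔽 using (ι; trans; sym)
            lead≉0′ = large-nonzero lead lead≉0 (ℕ.≤-trans (ℕ.≤-trans (ℕ.m≤n⊔m N _) (ℕ.m≤m⊔n (N ℕ.⊔ suc ℤ.∣ lead ∣) _)) le)
            g-root = trans (sym (eval-map (ιʰ 𝔽) g v)) (∣⇒ι≈0 (Polynomial.eval ℤᴿ g v) p∣gv)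
            open Reduction mp pr Fp
            locals : ∀ {ss} (rs : All (IntegerAdjunction.Rational K θ) ss) → denominators {K} {θ} rs ≤ p → All (Local lead≉0′ (ι v) g-root) ss
            locals [] _ = []
            locals (r@(m , _ , m≢0 , _) ∷ rs) le =
              (r , inverse pr (ι m) (large-nonzero m m≢0 (ℕ.≤-trans (ℕ.m≤m⊔n (suc ℤ.∣ m ∣) (denominators {K} {θ} rs)) le))) ∷ locals rs (ℕ.≤-trans (ℕ.m≤n⊔m (suc ℤ.∣ m ∣) (denominators {K} {θ} rs)) le)
            split-𝔽 = splits-modulo lead≉0′ (ι v) g-root h ts (locals rationals (ℕ.≤-trans (ℕ.≤-trans (ℕ.m≤n⊔m (suc ℤ.∣ Δ ∣) (denominators {K} {θ} rationals)) (ℕ.m≤n⊔m (N ℕ.⊔ suc ℤ.∣ lead ∣) _)) le)) splits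

  private
    splitting = split deg ℤᴿ h monic
    open Splitting splitting
    module S = Kit S

    ι-injective : ∀ m → S.ι m S.≈ S.0# → m ≡ + 0
    ι-injective m e = ≡.trans (≡.sym (ι-ℤ m)) (≡.trans (≡.sym (Retraction.ι-homo retract m)) (≡.trans (Retraction.cong retract e) (Retraction.0-homo retract)))

    -- Dividing by the saturation of the zero ideal yields the torsion-freeness and the stable
    -- equality that `maximalQuotient` demands. No nonzero integer is lost, because `S` retracts
    -- onto ℤ.
    module S₀ = Saturate S S.0#

    S₀-torsionFree : TorsionFree S₀.ring/
    S₀-torsionFree = S₀.torsionFree (λ q m m≢0 e → m≢0 (ι-injective m (S.trans (S.sym e) (S.zeroʳ q))))

    S₀-dependent : Dependent S₀.ring/ _
    S₀-dependent = Dependent-surj S (saturated S S.0#) (spanned⇒dependent S (spanned (ℤ-spanned rec)))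

  infinitely-many-congruences : ∀ N → ¬¬ (∃ λ p → Prime p × N ≤ p × + p ℤ.∣ b p ℤ.- b 1)
  infinitely-many-congruences N = do
    over ← maximalQuotient _ S₀.ring/ S₀-torsionFree S₀-dependent
    let open DomainOver over renaming (embed to toK)
        φ = toK ∘ʰ S₀.proj
    infinitely-many domain dependent (map (Hom.fun φ) roots)
      (Kit.trans (Polynomial.poly K) (Kit.sym (Polynomial.poly K) (map-ι φ h)) (Kit.trans (Polynomial.poly K) (Hom.cong (mapʰ φ) (splits-ι splitting)) (map-linProduct φ roots))) N

-- Reduction to a separable recurrence

record Field (F : Ring) : Set where
  open Kit F
  field
    zero?   : ∀ x → Dec (x ≈ 0#)
    inverse : ∀ x → ¬ x ≈ 0# → ∃ λ y → x * y ≈ 1#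
    char0   : ∀ m → ι m ≈ 0# → m ≡ + 0

  domain : Domain F
  domain = record
    { stable = λ {x} {y} d → trans (solve 2 (λ x y → x := (x :- y) :+ y) refl x y) (trans (+-congʳ (decidable-stable (zero? (x - y)) λ nz →
        d λ e → nz (trans (+-congʳ e) (-‿inverseʳ y)))) (+-identityˡ y))
    ; cancel = λ {x} {y} e x≉0 → let (i , xi) = inverse x x≉0 in
        trans (sym (trans (*-congʳ xi) (*-identityˡ y))) (trans (solve 3 (λ x i y → (x :* i) :* y := i :* (x :* y)) refl x i y) (trans (*-congˡ e) (zeroʳ i)))
    ; char0 = char0 }

module FieldPolynomials {F : Ring} (fieldF : Field F) where
  open Kit F hiding (_^_; begin_; step-≈-⟩; _∎)
  open Polynomial F
  open Degree F
  open Field fieldF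
  open Domain domain using (product≉0; power≉0)
  open L using (_^_)

  HasDeg : List Carrier → ℕ → Set
  HasDeg P n = DegLt P (suc n) × ¬ coeff P n ≈ 0#

  degree? : ∀ P k → DegLt P k → P ≋ [] ⊎ (∃ λ n → n < k × HasDeg P n)
  degree? P zero d = inj₁ (pw (λ i → d i z≤n))
  degree? P (suc k) d with zero? (coeff P k)
  ... | no nz = inj₂ (k , ℕ.≤-refl , d , nz)
  ... | yes z with degree? P k (λ i k≤i → [ (λ k<i → d i k<i) , (λ { ≡.refl → z }) ]′ (ℕ.m≤n⇒m<n∨m≡n k≤i))
  ...   | inj₁ P≋0 = inj₁ P≋0
  ...   | inj₂ (n , n<k , h) = inj₂ (n , ℕ.m≤n⇒m≤1+n n<k , h)

  degree : ∀ P → ¬ P ≋ [] → ∃ (HasDeg P)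
  degree P P≉0 with degree? P (List.length P) (degLt-length P)
  ... | inj₁ z = ⊥-elim (P≉0 z)
  ... | inj₂ (n , _ , h) = n , h

  hasDeg≉0 : ∀ {P n} → HasDeg P n → ¬ P ≋ []
  hasDeg≉0 {P} {n} (_ , nz) e = nz (at e n)

  hasDeg-cong : ∀ {P Q n} → P ≋ Q → HasDeg P n → HasDeg Q n
  hasDeg-cong {P} {Q} {n} e (d , nz) = degLt-cong {P} {Q} e d , λ z → nz (trans (at e n) z)

  hasDeg-⊠ : ∀ {P Q n m} → HasDeg P n → HasDeg Q m → HasDeg (P ⊠ Q) (n ℕ.+ m)
  hasDeg-⊠ {P} {Q} {n} {m} (d , p) (e , q) = proj₁ (degLt-⊠ P Q {n} {m} d e) , λ z → product≉0 p q (trans (sym (proj₂ (degLt-⊠ P Q {n} {m} d e))) z)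

  hasDeg-unique : ∀ {P n m} → HasDeg P n → HasDeg P m → n ≡ m
  hasDeg-unique (d , p) (e , q) = ℕ.≤-antisym (ℕ.≮⇒≥ (λ m<n → p (e _ m<n))) (ℕ.≮⇒≥ (λ n<m → q (d _ n<m)))

  product-degrees : ∀ {P Q S n} → HasDeg P n → P ≋ Q ⊠ S → ∃ λ a → ∃ λ b → HasDeg Q a × HasDeg S b × a ℕ.+ b ≡ n
  product-degrees {P} {Q} {S} hP e = proj₁ hQ , proj₁ hS , proj₂ hQ , proj₂ hS , hasDeg-unique {Q ⊠ S} (hasDeg-⊠ {Q} {S} (proj₂ hQ) (proj₂ hS)) (hasDeg-cong {P} {Q ⊠ S} e hP)
    where
    hQ = degree Q (λ z → hasDeg≉0 {P} hP (L.trans e (L.trans (L.*-congʳ {S} z) (L.zeroˡ S))))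
    hS = degree S (λ z → hasDeg≉0 {P} hP (L.trans e (L.trans (L.*-congˡ {Q} z) (L.zeroʳ Q))))

  hasDeg-0 : ∀ {P} → HasDeg P 0 → ∃ λ i → C i ⊠ P ≋ C 1#
  hasDeg-0 {P} (d , nz) = let (i , e) = inverse (coeff P 0) nz in i ,
    pw λ { zero → trans (coeff-C⊠ i P 0) (trans (*-comm _ _) e) ; (suc j) → trans (coeff-C⊠ i P (suc j)) (trans (*-congˡ (d (suc j) (s≤s z≤n))) (zeroʳ i)) }

  hasDeg-^ : ∀ {P m} k → HasDeg P m → HasDeg (P ^ k) (k ℕ.* m)
  hasDeg-^ zero h = (λ { (suc i) _ → refl }) , λ z → contra (char0 (+ 1) z)
    where
    contra : ¬ + 1 ≡ + 0
    contra ()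
  hasDeg-^ {P} (suc k) h = hasDeg-⊠ {P} {P ^ k} h (hasDeg-^ {P} k h)

  product-cancel : ∀ {P Q} → ¬ P ≋ [] → P ⊠ Q ≋ [] → Q ≋ []
  product-cancel {P} {Q} P≉0 e with degree? Q (List.length Q) (degLt-length Q)
  ... | inj₁ z = z
  ... | inj₂ (n , _ , h) = ⊥-elim (hasDeg≉0 {P ⊠ Q} (hasDeg-⊠ {P} {Q} (proj₂ (degree P P≉0)) h) e)

  euclid : ∀ f {d n} → HasDeg d n → ∃ λ q → ∃ λ r → f ≋ q ⊠ d ⊞ r × DegLt r n
  euclid f {d} {n} (dd , nz) = C i ⊠ quotient , C i ⊠ remainder , eq , λ j n≤j → trans (coeff-C⊠ i remainder j) (trans (*-congˡ (deg j n≤j)) (zeroʳ i))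
    where
    open PseudoDivision (pseudoDivide f {d} {n} dd) renaming (degree to deg)
    u = Kit._^_ F (coeff d n) exponent
    inv = inverse u (power≉0 exponent nz)
    i = proj₁ inv
    eq : f ≋ (C i ⊠ quotient) ⊠ d ⊞ C i ⊠ remainder
    eq = L.trans (L.sym (L.*-identityˡ f)) (L.trans (L.*-congʳ {f} (Hom.cong Cʰ (sym (trans (*-comm i u) (proj₂ inv)))))
      (L.trans (L.*-congʳ {f} (Hom.*-homo Cʰ i u)) (L.trans (L.*-assoc (C i) (C u) f) (L.trans (L.*-congˡ {C i} equation)
      (L.solve 4 (λ i q d r → i :* (q :* d :+ r) := (i :* q) :* d :+ i :* r) L.refl (C i) quotient d remainder)))))

  record GCD (f g : List Carrier) : Set where
    field
      d U V f′ g′ : List Carrier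
      bezout : d ≋ U ⊠ f ⊞ V ⊠ g
      f≋     : f ≋ f′ ⊠ d
      g≋     : g ≋ g′ ⊠ d

  gcd : ∀ k f g → DegLt g k → GCD f g
  gcd k f g dg with degree? g k dg
  ... | inj₁ g≋0 = record { d = f ; U = C 1# ; V = [] ; f′ = C 1# ; g′ = []
        ; bezout = L.sym (L.trans (L.+-identityʳ (C 1# ⊠ f)) (L.*-identityˡ f)) ; f≋ = L.sym (L.*-identityˡ f) ; g≋ = g≋0 }
  gcd zero f g dg | inj₂ (m , () , hg)
  gcd (suc k) f g dg | inj₂ (m , m<k , hg) = record { d = d ; U = V ; V = U ⊞ neg (V ⊠ q) ; f′ = q ⊠ f′ ⊞ g′ ; g′ = f′
        ; bezout = L.trans bezout (L.trans (L.+-congˡ {U ⊠ g} (L.*-congˡ {V} r≋))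
            (L.solve 5 (λ U V f g q → U :* g :+ V :* (f :- q :* g) := V :* f :+ (U :- V :* q) :* g) L.refl U V f g q))
        ; f≋ = L.trans e (L.trans (L.+-cong (L.*-congˡ {q} f≋) g≋) (L.solve 4 (λ q f d g → q :* (f :* d) :+ g :* d := (q :* f :+ g) :* d) L.refl q f′ d g′))
        ; g≋ = f≋ }
    where
    div = euclid f {g} {m} hg
    q = proj₁ div
    r = proj₁ (proj₂ div)
    e = proj₁ (proj₂ (proj₂ div))
    open GCD (gcd k g r (λ i k≤i → proj₂ (proj₂ (proj₂ div)) i (ℕ.≤-trans (ℕ.≤-pred m<k) k≤i)))
    r≋ : r ≋ f ⊞ neg (q ⊠ g)
    r≋ = L.trans (L.solve 2 (λ a r → r := (a :+ r) :- a) L.refl (q ⊠ g) r) (L.+-congʳ {neg (q ⊠ g)} (L.sym e))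

  D-^ : ∀ P k → ∃ λ z → D (P ^ suc k) ≋ (P ^ k) ⊠ z
  D-^ P zero = D (P ⊠ C 1#) , L.sym (L.*-identityˡ (D (P ⊠ C 1#)))
  D-^ P (suc k) = D P ⊞ z , L.trans (D-⊠ P (P ^ suc k)) (L.trans (L.+-congˡ {D P ⊠ (P ^ suc k)} (L.*-congˡ {P} (proj₂ (D-^ P k))))
      (L.solve 4 (λ P Q z D → D :* (P :* Q) :+ P :* (Q :* z) := (P :* Q) :* (D :+ z)) L.refl P (P ^ k) z (D P)))
    where z = proj₁ (D-^ P k)

  module _ {χ n} (hχ : HasDeg χ n) (G : GCD χ (D χ)) where
    open GCD G renaming (d to g; f′ to q; g′ to y)

    -- A square dividing χ / gcd(χ, χ′) divides χ to every power.
    squarefree : ∀ {d m s} → q ≋ s ⊠ (d ⊠ d) → HasDeg d m → m ≡ 0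
    squarefree {d} {m} {s} q≋ hd = small m bound
      where
      powers-divide : ∀ j → ∃ λ z → χ ≋ z ⊠ ((d ^ j) ⊠ (d ⊠ d))
      powers-divide zero = g ⊠ s , L.trans f≋ (L.trans (L.*-congʳ {g} q≋) (L.solve 3 (λ g s d → (s :* (d :* d)) :* g := (g :* s) :* (con (+ 1) :* (d :* d))) L.refl g s d))
      -- If d^(j+2) divides χ, then d^(j+1) divides χ′ and hence `g`; the square in `q` raises this
      -- to d^(j+3) in χ = q g.
      powers-divide (suc j) = s ⊠ (U ⊠ z ⊠ d ⊞ V ⊠ (D z ⊠ d ⊞ z ⊠ w)) , L.trans f≋ (L.trans (L.*-cong q≋ g≋′)
            (L.solve 4 (λ s d P W → (s :* (d :* d)) :* ((d :* P) :* W) := (s :* W) :* ((d :* P) :* (d :* d))) L.refl s d (d ^ j) _))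
        where
        z = proj₁ (powers-divide j)
        w = proj₁ (D-^ d (suc j))
        χ≋ : χ ≋ z ⊠ (d ^ suc (suc j))
        χ≋ = L.trans (proj₂ (powers-divide j)) (L.solve 3 (λ z P d → z :* (P :* (d :* d)) := z :* (d :* (d :* P))) L.refl z (d ^ j) d)
        Dχ≋ : D χ ≋ (d ^ suc j) ⊠ (D z ⊠ d ⊞ z ⊠ w)
        Dχ≋ = L.trans (D-cong χ≋) (L.trans (D-⊠ z (d ^ suc (suc j))) (L.trans (L.+-congˡ {D z ⊠ (d ^ suc (suc j))} (L.*-congˡ {z} (proj₂ (D-^ d (suc j)))))
          (L.solve 5 (λ D d P z w → D :* (d :* P) :+ z :* (P :* w) := P :* (D :* d :+ z :* w)) L.refl (D z) d (d ^ suc j) z w)))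
        g≋′ : g ≋ (d ^ suc j) ⊠ (U ⊠ z ⊠ d ⊞ V ⊠ (D z ⊠ d ⊞ z ⊠ w))
        g≋′ = L.trans bezout (L.trans (L.+-cong (L.*-congˡ {U} χ≋) (L.*-congˡ {V} Dχ≋))
          (L.solve 6 (λ U z d P V W → U :* (z :* (d :* P)) :+ V :* (P :* W) := P :* (U :* z :* d :+ V :* W)) L.refl U z d (d ^ suc j) V (D z ⊠ d ⊞ z ⊠ w)))
      -- The exponent n + 1 suffices: (n + 1) deg d ≤ deg χ = n leaves only deg d = 0.
      top = powers-divide (suc n)
      degs = product-degrees {χ} {proj₁ top} {(d ^ suc n) ⊠ (d ⊠ d)} hχ (proj₂ top)
      bound : suc n ℕ.* m ≤ n
      bound = ℕ.≤-trans (ℕ.m≤m+n (suc n ℕ.* m) (m ℕ.+ m)) (ℕ.≤-trans (ℕ.≤-reflexive (hasDeg-unique {(d ^ suc n) ⊠ (d ⊠ d)} (hasDeg-⊠ {d ^ suc n} {d ⊠ d} (hasDeg-^ {d} (suc n) hd) (hasDeg-⊠ {d} {d} hd hd)) (proj₁ (proj₂ (proj₂ (proj₂ degs))))))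
        (ℕ.≤-trans (ℕ.m≤n+m _ (proj₁ degs)) (ℕ.≤-reflexive (proj₂ (proj₂ (proj₂ (proj₂ degs)))))))
      small : ∀ m → suc n ℕ.* m ≤ n → m ≡ 0
      small zero _ = ≡.refl
      small (suc m) le = ⊥-elim (ℕ.<-irrefl ≡.refl (ℕ.≤-trans (ℕ.m≤m*n (suc n) (suc m)) le))

    -- The square of gcd(e, q₁) divides `q`, so `squarefree` makes this gcd a nonzero constant, and
    -- the Bezout identity can be divided by it.
    coprime-factors : ∀ {e q₁} → q ≋ q₁ ⊠ e → ∃ λ α → ∃ λ β → α ⊠ e ⊞ β ⊠ q₁ ≋ C 1#
    coprime-factors {e} {q₁} q≋ = C i ⊠ H.U , C i ⊠ H.V ,
        L.trans (L.solve 5 (λ i U e V q → (i :* U) :* e :+ (i :* V) :* q := i :* (U :* e :+ V :* q)) L.refl (C i) H.U e H.V q₁)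
          (L.trans (L.*-congˡ {C i} (L.sym H.bezout)) (proj₂ invertible))
      where
      module H = GCD (gcd (List.length q₁) e q₁ (degLt-length q₁))
      q-square : q ≋ (H.g′ ⊠ H.f′) ⊠ (H.d ⊠ H.d)
      q-square = L.trans q≋ (L.trans (L.*-cong H.g≋ H.f≋) (L.solve 3 (λ a b d → (a :* d) :* (b :* d) := (a :* b) :* (d :* d)) L.refl H.g′ H.f′ H.d))
      hq = proj₁ (proj₂ (proj₂ (product-degrees {χ} {q} {g} hχ f≋)))
      hd² = proj₁ (proj₂ (proj₂ (proj₂ (product-degrees {q} {H.g′ ⊠ H.f′} {H.d ⊠ H.d} hq q-square))))
      hd = proj₁ (proj₂ (proj₂ (product-degrees {H.d ⊠ H.d} {H.d} {H.d} hd² L.refl)))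
      invertible = hasDeg-0 {H.d} (≡.subst (HasDeg H.d) (squarefree {H.d} {_} {H.g′ ⊠ H.f′} q-square hd) hd)
      i = proj₁ invertible

    -- With v = α A and k = y - q′ one has e - v k e = q (β + α e B), which makes the sequence
    -- act (q v) a the correction that lowers the degree.
    module _ (A B k₁ q₁ e α β : List Carrier) (e≋ : e ≋ A ⊠ (y ⊞ neg (D q)) ⊞ B ⊠ q) (αβ : α ⊠ e ⊞ β ⊠ q₁ ≋ C 1#) (q≋ : q ≋ q₁ ⊠ e) where
      private
        v = α ⊠ A
        W = β ⊞ α ⊠ e ⊠ B ⊞ neg (D e ⊠ v)
        k = y ⊞ neg (D q)

      -- Differentiate χ = q g and compare with χ′ = y g.
      qDg : q ⊠ D g ≋ k ⊠ g
      qDg = L.trans (L.solve 4 (λ q D′ g′ g → q :* g′ := (D′ :* g :+ q :* g′) :- D′ :* g) L.refl q (D q) (D g) g)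
        (L.trans (L.+-congʳ {neg (D q ⊠ g)} (L.trans (L.sym (D-⊠ q g)) (L.trans (D-cong (L.sym f≋)) g≋)))
        (L.solve 3 (λ y g d → y :* g :- d :* g := (y :- d) :* g) L.refl y g (D q)))

      -- Applied to a sequence killed by χ, this says that g e acts on it as (g e)′ acts on the
      -- image under q v. That is exactly the term which `act-M` produces from the multiples of that
      -- image.
      correction : g ⊠ e ≋ W ⊠ χ ⊞ D (g ⊠ e) ⊠ (q ⊠ v)
      correction = L.sym (begin
        W ⊠ χ ⊞ D (g ⊠ e) ⊠ (q ⊠ v)                     ≈⟨ L.+-cong (L.*-congˡ {W} f≋) (L.*-congʳ {q ⊠ v} (D-⊠ g e)) ⟩
        W ⊠ (q ⊠ g) ⊞ (D g ⊠ e ⊞ g ⊠ D e) ⊠ (q ⊠ v)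
          ≈⟨ L.solve 9 (λ α β e B E v q g G → (β :+ α :* e :* B :- E :* v) :* (q :* g) :+ (G :* e :+ g :* E) :* (q :* v)
               := (β :+ α :* e :* B) :* (q :* g) :+ (q :* G) :* (e :* v)) L.refl α β e B (D e) v q g (D g) ⟩
        (β ⊞ α ⊠ e ⊠ B) ⊠ (q ⊠ g) ⊞ (q ⊠ D g) ⊠ (e ⊠ v)   ≈⟨ L.+-cong (L.solve 6 (λ α β e B q g → (β :+ α :* e :* B) :* (q :* g) := β :* q :* g :+ α :* e :* (B :* q) :* g) L.refl α β e B q g) (L.*-congʳ {e ⊠ v} qDg) ⟩
        (β ⊠ q ⊠ g ⊞ α ⊠ e ⊠ (B ⊠ q) ⊠ g) ⊞ (k ⊠ g) ⊠ (e ⊠ (α ⊠ A))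
          ≈⟨ L.+-congʳ {(k ⊠ g) ⊠ (e ⊠ (α ⊠ A))} (L.+-congʳ {α ⊠ e ⊠ (B ⊠ q) ⊠ g} (L.*-congʳ {g} (L.*-congˡ {β} q≋))) ⟩
        (β ⊠ (q₁ ⊠ e) ⊠ g ⊞ α ⊠ e ⊠ (B ⊠ q) ⊠ g) ⊞ (k ⊠ g) ⊠ (e ⊠ (α ⊠ A))
          ≈⟨ L.solve 8 (λ α β e b q₁ g k A → (β :* (q₁ :* e) :* g :+ α :* e :* b :* g) :+ (k :* g) :* (e :* (α :* A))
               := (g :* e) :* (α :* (A :* k :+ b) :+ β :* q₁)) L.refl α β e (B ⊠ q) q₁ g k A ⟩
        (g ⊠ e) ⊠ (α ⊠ (A ⊠ k ⊞ B ⊠ q) ⊞ β ⊠ q₁)       ≈⟨ L.*-congˡ {g ⊠ e} (L.+-congʳ {β ⊠ q₁} (L.*-congˡ {α} (L.sym e≋))) ⟩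
        (g ⊠ e) ⊠ (α ⊠ e ⊞ β ⊠ q₁)                     ≈⟨ L.trans (L.*-congˡ {g ⊠ e} αβ) (L.*-identityʳ (g ⊠ e)) ⟩
        g ⊠ e                                          ∎)
        where open L using (begin_; step-≈-⟩; _∎)

      -- If q₁ were constant, `e` would be `q` up to a unit and `k` a multiple of `q`; then q g′ = k
      -- g would show that `g` divides g′, impossible for nonconstant `g` in characteristic zero. So
      -- deg e < deg q, which makes the recurrence shorter.
      q₁-nonconstant : ∀ {m b} → k ≋ k₁ ⊠ e → HasDeg g (suc m) → HasDeg q₁ b → b ≢ 0
      q₁-nonconstant {m} k≋ hg h₁ ≡.refl = ℕ.<⇒≢ (ℕ.m≤n+m (suc m) a) (hasDeg-unique {D g} hDg (hasDeg-cong {(k₁ ⊠ C i) ⊠ g} {D g} (L.sym Dg≋) (hasDeg-⊠ {k₁ ⊠ C i} {g} (proj₂ hk) hg)))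
        where
        constant = hasDeg-0 {q₁} h₁
        i = proj₁ constant
        Dg≋ : D g ≋ (k₁ ⊠ C i) ⊠ g
        Dg≋ = L.trans (L.solve 2 (λ a b → a := (a :- b) :+ b) L.refl (D g) ((k₁ ⊠ C i) ⊠ g))
          (L.trans (L.+-congʳ {(k₁ ⊠ C i) ⊠ g} (product-cancel {q} {D g ⊞ neg ((k₁ ⊠ C i) ⊠ g)} (hasDeg≉0 {q} (proj₁ (proj₂ (proj₂ (product-degrees {χ} {q} {g} hχ f≋)))))
            (L.trans (L.solve 5 (λ q G k i g → q :* (G :- (k :* i) :* g) := q :* G :- (k :* (i :* q)) :* g) L.refl q (D g) k₁ (C i) g)
            (L.trans (L.+-cong (L.trans qDg (L.*-congʳ {g} k≋)) (neg-cong (L.*-congʳ {g} (L.*-congˡ {k₁} (L.trans (L.*-congˡ {C i} q≋)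
               (L.trans (L.sym (L.*-assoc (C i) q₁ e)) (L.trans (L.*-congʳ {e} (proj₂ constant)) (L.*-identityˡ e))))))))
             (L.-‿inverseʳ ((k₁ ⊠ e) ⊠ g)))))) (L.+-identityˡ ((k₁ ⊠ C i) ⊠ g)))
        hDg : HasDeg (D g) m
        hDg = (λ j le → trans (coeff-D g j) (trans (*-congˡ (proj₁ hg (suc j) (s≤s le))) (zeroʳ _))) ,
              λ z → product≉0 (λ w → contra (char0 (+ suc m) w)) (proj₂ hg) (trans (sym (coeff-D g m)) z)
          where
          contra : ¬ + suc m ≡ + 0
          contra ()
        hk = degree (k₁ ⊠ C i) (λ z → hasDeg≉0 {D g} hDg (L.trans Dg≋ (L.trans (L.*-congʳ {g} z) (L.zeroˡ g))))
        a = proj₁ hk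

module Multiples (F : Ring) where
  open Kit F
  open Polynomial F
  open Degree F

  -- If ℓ is the functional X^n ↦ c n on polynomials, then M c n = ℓ((X^n)′).
  M : (ℕ → Carrier) → ℕ → Carrier
  M c zero    = 0#
  M c (suc n) = ι (+ suc n) * c n

  -- Dual to the Leibniz rule (X^n P)′ = n X^(n-1) P + X^n P′, to whose terms the functional X^n ↦ c
  -- n is applied.
  act-M : ∀ P c n → act P (M c) n ≈ M (act P c) n + act (D P) c n
  act-M [] c zero = sym (+-identityˡ 0#)
  act-M [] c (suc n) = sym (trans (+-identityʳ _) (zeroʳ _))
  act-M (x ∷ P) c n = trans (+-congˡ (act-M P c (suc n))) (trans (expand n)
      (+-congˡ (sym (trans (act-⊞ P (0# ∷ D P) c n) (+-congˡ (trans (+-congʳ (zeroˡ _)) (+-identityˡ _)))))))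
    where
    expand : ∀ n → x * M c n + (ι (+ suc n) * act P c n + act (D P) c (suc n)) ≈ M (act (x ∷ P) c) n + (act P c n + act (D P) c (suc n))
    expand zero = solve 3 (λ x u v → x :* con (+ 0) :+ (con (+ 1) :* u :+ v) := con (+ 0) :+ (u :+ v)) refl x (act P c 0) (act (D P) c 1)
    expand (suc n) = trans (+-congˡ (+-congʳ (*-congʳ (ι-+-homo (+ 1) (+ suc n)))))
      (solve 5 (λ x k c u v → x :* (k :* c) :+ ((con (+ 1) :+ k) :* u :+ v) := k :* (x :* c :+ u) :+ (u :+ v)) refl x (ι (+ suc n)) (c n) (act P c (suc n)) (act (D P) c (suc (suc n))))

  M-+ : ∀ c d n → M (λ k → c k + d k) n ≈ M c n + M d n
  M-+ c d zero = sym (+-identityˡ 0#)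
  M-+ c d (suc n) = distribˡ _ _ _

-- I will consist of the sequences that are integral at almost all primes p, and then M c p ≡ 0 mod p.
module SeparablePart {F : Ring} (fieldF : Field F) (I : (ℕ → ∣ F ∣) → Set)
  (I-act : ∀ P {a} → I a → I (Polynomial.act F P a))
  (I-+ : ∀ {a b} → I a → I b → I (λ n → CommutativeRing._+_ F (a n) (b n)))
  (I-neg : ∀ {a} → I a → I (λ n → CommutativeRing.-_ F (a n)))
  (I-M : ∀ {a} → I a → I (Multiples.M F a)) where
  open Kit F hiding (_^_)
  open Polynomial F
  open Degree F
  open FieldPolynomials fieldF
  open Multiples F

  record Separable (a : ℕ → Carrier) : Set where
    field
      h U V  : List Carrier
      bezout : U ⊠ h ⊞ V ⊠ D h ≋ C 1#
      {deg}  : ℕ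
      hasDeg : HasDeg h deg
      b c    : ℕ → Carrier
      b-in   : I b
      c-in   : I c
      killed : ∀ n → act h b n ≈ 0#
      a≈     : ∀ n → a n ≈ b n + M c n

  -- Put c = (q v)(E) a. Since χ = q g kills `a`, the polynomial g e kills `c`, and by `correction`
  -- and `act-M` it kills a - M c as well. Its degree is below that of χ. The recursion, bounded by
  -- `k`, ends when `g` is constant, that is, when χ is separable.
  separable : ∀ k χ {n} → HasDeg χ n → n < k → ∀ a → I a → (∀ n → act χ a n ≈ 0#) → Separable a
  separable (suc k) χ {n} hχ n<k a Ia killed = by-degree (proj₁ hg) ≡.refl
    where
    G = gcd (List.length (D χ)) χ (D χ) (degLt-length (D χ))
    open GCD G renaming (d to g; f′ to q; g′ to y; bezout to g-bezout)
    degs = product-degrees {χ} {q} {g} hχ f≋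
    hg : ∃ (HasDeg g)
    hg = proj₁ (proj₂ degs) , proj₁ (proj₂ (proj₂ (proj₂ degs)))
    by-degree : ∀ m → m ≡ proj₁ hg → Separable a
    by-degree zero m≡ = record { h = χ ; U = C i ⊠ U ; V = C i ⊠ V
        ; bezout = L.trans (L.solve 5 (λ i U e V q → (i :* U) :* e :+ (i :* V) :* q := i :* (U :* e :+ V :* q)) L.refl (C i) U χ V (D χ))
            (L.trans (L.*-congˡ {C i} (L.sym g-bezout)) (proj₂ constant))
        -- No correction is made: `act [] a` is the zero sequence, in the form for which `I-act`
        -- gives membership in `I`.
        ; hasDeg = hχ ; b = a ; c = act [] a ; b-in = Ia ; c-in = I-act [] Ia ; killed = killed
        ; a≈ = λ n → sym (trans (+-congˡ (M-0 n)) (+-identityʳ (a n))) }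
      where
      constant = hasDeg-0 {g} (≡.subst (HasDeg g) (≡.sym m≡) (proj₂ hg))
      i = proj₁ constant
      M-0 : ∀ n → M (act [] a) n ≈ 0#
      M-0 zero = refl
      M-0 (suc n) = zeroʳ _
    by-degree (suc m) m≡ = record { Separable S ; c = λ n → Separable.c S n + c n ; c-in = I-+ (Separable.c-in S) Ic
        ; a≈ = λ n → trans (solve 2 (λ a m → a := (a :- m) :+ m) refl (a n) (M c n)) (trans (+-congʳ (Separable.a≈ S n)) (trans (+-assoc _ _ _) (+-congˡ (sym (M-+ (Separable.c S) c n))))) }
      where
      H = gcd (List.length q) (y ⊞ neg (D q)) q (degLt-length q)
      module H = GCD H
      -- Since q g′ = k g, the quotient k / q is g′ / g, so at a root of χ of multiplicity r the
      -- value of `k` is (r - 1) times that of q′. Over a splitting field `e` thus collects the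
      -- simple roots, and g e arises from χ by lowering every multiplicity above one by one.
      e = H.d
      coprime = coprime-factors hχ G {e} {H.g′} H.g≋
      α = proj₁ coprime
      β = proj₁ (proj₂ coprime)
      αβ = proj₂ (proj₂ coprime)
      v = α ⊠ H.U
      W = β ⊞ α ⊠ e ⊠ H.V ⊞ neg (D e ⊠ v)
      c : ℕ → Carrier
      c = act (q ⊠ v) a
      Ic : I c
      Ic = I-act (q ⊠ v) Ia
      identity : g ⊠ e ≋ W ⊠ χ ⊞ D (g ⊠ e) ⊠ (q ⊠ v)
      identity = correction hχ G H.U H.V H.f′ H.g′ e α β H.bezout αβ H.g≋
      b : ℕ → Carrier
      b n = a n - M c n
      ge-c : ∀ n → act (g ⊠ e) c n ≈ 0#
      ge-c n = begin
        act (g ⊠ e) (act (q ⊠ v) a) n      ≈⟨ act-⊠ (g ⊠ e) (q ⊠ v) a n ⟨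
        act ((g ⊠ e) ⊠ (q ⊠ v)) a n        ≈⟨ act-congˡ (L.trans (L.solve 4 (λ g e q v → (g :* e) :* (q :* v) := (e :* v) :* (q :* g)) L.refl g e q v) (L.*-congˡ {e ⊠ v} (L.sym f≋))) a n ⟩
        act ((e ⊠ v) ⊠ χ) a n              ≈⟨ trans (act-⊠ (e ⊠ v) χ a n) (act-0ʳ (e ⊠ v) killed n) ⟩
        0#                                 ∎
      M-vanish : ∀ n → M (act (g ⊠ e) c) n ≈ 0#
      M-vanish zero = refl
      M-vanish (suc n) = trans (*-congˡ (ge-c n)) (zeroʳ _)
      b-killed : ∀ n → act (g ⊠ e) b n ≈ 0#
      b-killed n = begin
        act (g ⊠ e) b n                                        ≈⟨ act-+ʳ (g ⊠ e) a (λ m → - M c m) n ⟩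
        act (g ⊠ e) a n + act (g ⊠ e) (λ m → - M c m) n        ≈⟨ +-cong ge-a (act-negʳ n) ⟩
        act (D (g ⊠ e)) c n - act (g ⊠ e) (M c) n              ≈⟨ +-congˡ (-‿cong (trans (act-M (g ⊠ e) c n) (trans (+-congʳ (M-vanish n)) (+-identityˡ _)))) ⟩
        act (D (g ⊠ e)) c n - act (D (g ⊠ e)) c n              ≈⟨ -‿inverseʳ _ ⟩
        0#                                                     ∎
        where
        ge-a : act (g ⊠ e) a n ≈ act (D (g ⊠ e)) c n
        ge-a = trans (act-congˡ identity a n) (trans (act-⊞ (W ⊠ χ) (D (g ⊠ e) ⊠ (q ⊠ v)) a n)
          (trans (+-cong (trans (act-⊠ W χ a n) (act-0ʳ W killed n)) (act-⊠ (D (g ⊠ e)) (q ⊠ v) a n)) (+-identityˡ _)))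
        act-negʳ : ∀ n → act (g ⊠ e) (λ m → - M c m) n ≈ - act (g ⊠ e) (M c) n
        act-negʳ n = trans (act-congʳ (g ⊠ e) (λ m → solve 1 (λ x → :- x := con -[1+ 0 ] :* x) refl (M c m)) n)
          (trans (act-*ʳ (g ⊠ e) (ι -[1+ 0 ]) (M c) n) (solve 1 (λ x → con -[1+ 0 ] :* x := :- x) refl _))
      hq = proj₁ (proj₂ (proj₂ degs))
      q-degs = product-degrees {q} {H.g′} {e} hq H.g≋
      he = proj₁ (proj₂ (proj₂ (proj₂ q-degs)))
      smaller : proj₁ hg ℕ.+ proj₁ (proj₂ q-degs) < k
      smaller = ℕ.≤-trans (≡.subst₂ _<_ (ℕ.+-comm (proj₁ (proj₂ q-degs)) _) (proj₂ (proj₂ (proj₂ (proj₂ degs))))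
          (ℕ.+-monoˡ-< (proj₁ hg) (≡.subst (proj₁ (proj₂ q-degs) <_) (proj₂ (proj₂ (proj₂ (proj₂ q-degs))))
            (ℕ.m<n+m (proj₁ (proj₂ q-degs)) (ℕ.n≢0⇒n>0 (q₁-nonconstant hχ G H.U H.V H.f′ H.g′ e α β H.bezout αβ H.g≋ H.f≋
              (≡.subst (HasDeg g) (≡.sym m≡) (proj₂ hg)) (proj₁ (proj₂ (proj₂ q-degs))))))))) (ℕ.≤-pred n<k)
      S : Separable b
      S = separable k (g ⊠ e) (hasDeg-⊠ {g} {e} (proj₂ hg) he) smaller b (I-+ Ia (I-neg (I-M Ic))) b-killed

-- Integrality at p and clearing of denominators

Fractions-of : Ring → Set
Fractions-of F = ∀ x → ∃ λ d → ∃ λ m → d ≢ + 0 × x * ι d ≈ ι m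
  where open Kit F

module MonicRecurrence (R : Ring) {Z : ∣ R ∣ → Set} (closed : Closed R Z) (resp : ∀ {x y} → CommutativeRing._≈_ R x y → Z x → Z y) where
  open Kit R
  open Polynomial R
  open Degree R
  open Closed closed

  isolate-top : ∀ P s a n → Monic R P s → (∀ i → Z (coeff P i)) → (∀ i → i < s → Z (a (n ℕ.+ i))) →
    ∃ λ z → Z z × act P a n ≈ z + a (n ℕ.+ s)
  isolate-top [] s a n (_ , e) Zc Za = 0# , 0-closed , sym (trans (+-identityˡ _) (trans (sym (*-identityˡ _)) (trans (*-congʳ (sym e)) (zeroˡ _))))
  isolate-top (c ∷ P) zero a n (d , e) Zc Za = 0# , 0-closed , trans (+-cong (trans (*-congʳ e) (*-identityˡ _)) (act-0ˡ {P} (λ i → d (suc i) (s≤s z≤n)) a (suc n)))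
    (trans (+-comm _ _) (+-congˡ (reflexive (≡.cong a (≡.sym (ℕ.+-identityʳ n))))))
  isolate-top (c ∷ P) (suc s) a n (d , e) Zc Za with isolate-top P s a (suc n) ((λ i le → d (suc i) (s≤s le)) , e) (λ i → Zc (suc i))
    (λ i i<s → ≡.subst (λ k → Z (a k)) (ℕ.+-suc n i) (Za (suc i) (s≤s i<s)))
  ... | z , Zz , f = c * a n + z , +-closed (*-closed (Zc 0) (≡.subst (λ k → Z (a k)) (ℕ.+-identityʳ n) (Za 0 (s≤s z≤n)))) Zz ,
        trans (+-congˡ f) (trans (sym (+-assoc _ _ _)) (+-congˡ (reflexive (≡.cong a (≡.sym (ℕ.+-suc n s))))))

  -- As `P` is monic, each new term is a combination of the `s` preceding ones with coefficients in
  -- `Z`. It serves both for elements integral at a prime and for integers.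
  all-in : ∀ P s a → Monic R P s → (∀ i → Z (coeff P i)) → (∀ n → act P a n ≈ 0#) → (∀ i → i < s → Z (a i)) → ∀ n → Z (a n)
  all-in P s a monic Zc killed init n = go n n (ℕ.m≤m+n (suc n) s)
    where
    last : ∀ n → (∀ i → i < s → Z (a (n ℕ.+ i))) → Z (a (n ℕ.+ s))
    last n prev with isolate-top P s a n monic Zc prev
    ... | z , Zz , f = resp (trans (solve 2 (λ z x → :- z := x :- (z :+ x)) refl z (a (n ℕ.+ s)))
      (trans (+-congˡ (-‿cong (trans (sym f) (killed n)))) (solve 1 (λ x → x :- con (+ 0) := x) refl _))) (neg-closed Zz)
    go : ∀ n i → i < suc n ℕ.+ s → Z (a i)
    go zero i (s≤s i≤s) = [ init i , (λ { ≡.refl → last 0 init }) ]′ (ℕ.m≤n⇒m<n∨m≡n i≤s)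
    go (suc n) i (s≤s i≤) = [ go n i , (λ { ≡.refl → last (suc n) (λ j j<s → go n (suc n ℕ.+ j) (ℕ.+-monoʳ-< (suc n) j<s)) }) ]′ (ℕ.m≤n⇒m<n∨m≡n i≤)

module Dilation (R : Ring) (w : ∣ R ∣) where
  open Kit R
  open Polynomial R
  open Degree R

  -- The substitution X ↦ w X.
  dilate : Hom poly poly
  dilate = Polynomial.evalʰ poly (0# ∷ w ∷ []) ∘ʰ mapʰ Cʰ

  private
    σ = Hom.fun dilate

    wX≋CX : 0# ∷ w ∷ [] ≋ C w ⊠ X
    wX≋CX = pw λ { zero → sym (trans (coeff-C⊠ w X 0) (zeroʳ w)) ; (suc zero) → sym (trans (coeff-C⊠ w X 1) (*-identityʳ w))
      ; (suc (suc i)) → sym (trans (coeff-C⊠ w X (suc (suc i))) (zeroʳ w)) }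

    wX≋ : ∀ P → (0# ∷ w ∷ []) ⊠ P ≋ C w ⊠ (X ⊠ P)
    wX≋ P = L.trans (L.*-congʳ {P} {0# ∷ w ∷ []} {C w ⊠ X} wX≋CX) (L.*-assoc (C w) X P)

    σ-∷ : ∀ c P → σ (c ∷ P) ≋ c ∷ scale w (σ P)
    σ-∷ c P = L.trans (L.+-congˡ {C c} (L.trans (wX≋ (σ P)) (L.trans (L.solve 3 (λ w X P → w :* (X :* P) := X :* (w :* P)) L.refl (C w) X (σ P))
      (L.*-congˡ {X} (scale-⊠ w (σ P)))))) (L.sym (∷-split c (scale w (σ P))))

  coeff-dilate : ∀ P i → coeff (σ P) i ≈ w ^ i * coeff P i
  coeff-dilate [] i = sym (zeroʳ _)
  coeff-dilate (c ∷ P) zero = trans (at (σ-∷ c P) 0) (sym (*-identityˡ c))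
  coeff-dilate (c ∷ P) (suc i) = trans (at (σ-∷ c P) (suc i)) (trans (coeff-scale w (σ P) i) (trans (*-congˡ (coeff-dilate P i)) (sym (*-assoc _ _ _))))

  D-dilate : ∀ P → D (σ P) ≋ C w ⊠ σ (D P)
  D-dilate P = pw λ i → trans (coeff-D (σ P) i) (trans (*-congˡ (coeff-dilate P (suc i)))
    (trans (solve 4 (λ k w u c → k :* ((w :* u) :* c) := w :* (u :* (k :* c))) refl (ι (+ suc i)) w (w ^ i) (coeff P (suc i)))
      (sym (trans (coeff-C⊠ w (σ (D P)) i) (*-congˡ (trans (coeff-dilate (D P) i) (*-congˡ (coeff-D P i))))))))

  eval-dilate : ∀ P x → eval (σ P) x ≈ eval P (w * x)
  eval-dilate [] x = refl
  eval-dilate (c ∷ P) x = trans (Hom.cong (evalʰ x) (σ-∷ c P)) (+-congˡ (trans (*-congˡ (trans (Hom.cong (evalʰ x) (L.sym (scale-⊠ w (σ P)))) (trans (Hom.*-homo (evalʰ x) (C w) (σ P)) (*-cong (eval-C w x) (eval-dilate P x)))))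
    (solve 3 (λ x w v → x :* (w :* v) := (w :* x) :* v) refl x w _)))

  -- Every shift of u^m a_m brings out one more factor `u`, which cancels the `w` attached to X.
  act-dilate : ∀ u → u * w ≈ 1# → ∀ P a n → act (σ P) (λ m → u ^ m * a m) n ≈ u ^ n * act P a n
  act-dilate u uw [] a n = sym (zeroʳ _)
  act-dilate u uw (c ∷ P) a n = trans (act-congˡ (σ-∷ c P) _ n) (trans (+-congˡ (trans (act-scale w (σ P) _ (suc n)) (*-congˡ (act-dilate u uw P a (suc n)))))
    (trans (solve 6 (λ c v x w u s → c :* (v :* x) :+ w :* ((u :* v) :* s) := v :* (c :* x) :+ (u :* w) :* (v :* s)) refl c (u ^ n) (a n) w u (act P a (suc n)))
      (trans (+-congˡ (trans (*-congʳ uw) (*-identityˡ _))) (sym (distribˡ _ _ _)))))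

module Local {F : Ring} (fieldF : Field F) (fraction : Fractions-of F) where
  open Kit F
  open Polynomial F
  open Degree F
  open Field fieldF

  ι-injective : ∀ {m n} → ι m ≈ ι n → m ≡ n
  ι-injective {m} {n} e = ℤ.i-j≡0⇒i≡j m n (char0 (m ℤ.- n) (trans (ι-+-homo m (ℤ.- n)) (trans (+-cong e (ι-neg-homo n)) (-‿inverseʳ (ι n)))))

  ι≉0 : ∀ {m} → m ≢ + 0 → ¬ ι m ≈ 0#
  ι≉0 m≢0 e = m≢0 (char0 _ e)

  -- For prime `p` these are ℤ_(p) and its maximal ideal p ℤ_(p). Any denominator prime to `p` is
  -- allowed, so sums and products need no reduction to lowest terms.
  Integral Zero : ℕ → Carrier → Set
  Integral p x = ∃ λ d → ∃ λ m → ¬ + p ℤ.∣ d × x * ι d ≈ ι m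
  Zero     p x = ∃ λ d → ∃ λ m → ¬ + p ℤ.∣ d × x * ι d ≈ ι (+ p) * ι m

  ∤-large : ∀ {p} m → m ≢ + 0 → ℤ.∣ m ∣ < p → ¬ + p ℤ.∣ m
  ∤-large m m≢0 m<p d = ℕ.<⇒≱ m<p (ℕ.∣⇒≤ {{ℕ.≢-nonZero (λ z → m≢0 (ℤ.∣i∣≡0⇒i≡0 z))}} d)

  module AtPrime {p : ℕ} (pr : Prime p) where

    euclid′ : ∀ m n → + p ℤ.∣ m ℤ.* n → + p ℤ.∣ m ⊎ + p ℤ.∣ n
    euclid′ m n d = euclidsLemma ℤ.∣ m ∣ ℤ.∣ n ∣ pr (≡.subst (p ℕ.∣_) (ℤ.abs-* m n) d)

    ∤-* : ∀ {m n} → ¬ + p ℤ.∣ m → ¬ + p ℤ.∣ n → ¬ + p ℤ.∣ m ℤ.* n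
    ∤-* {m} {n} a b d = [ a , b ]′ (euclid′ m n d)

    ∤1 : ¬ + p ℤ.∣ + 1
    ∤1 d = ¬prime[1] (≡.subst Prime (ℕ.∣1⇒≡1 d) pr)

    integral-cong : ∀ {x y} → x ≈ y → Integral p x → Integral p y
    integral-cong e (d , m , nd , f) = d , m , nd , trans (*-congʳ (sym e)) f

    integral-ι : ∀ m → Integral p (ι m)
    integral-ι m = + 1 , m , ∤1 , *-identityʳ _

    integral-+ : ∀ {x y} → Integral p x → Integral p y → Integral p (x + y)
    integral-+ {x} {y} (d , m , nd , e) (d′ , n , nd′ , f) = d ℤ.* d′ , m ℤ.* d′ ℤ.+ n ℤ.* d , ∤-* {d} {d′} nd nd′ ,
      trans (*-congˡ (ι-*-homo d d′)) (trans (solve 4 (λ x y d e → (x :+ y) :* (d :* e) := (x :* d) :* e :+ (y :* e) :* d) refl x y (ι d) (ι d′))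
        (trans (+-cong (*-congʳ e) (*-congʳ f)) (sym (trans (ι-+-homo (m ℤ.* d′) _) (+-cong (ι-*-homo m d′) (ι-*-homo n d))))))

    integral-* : ∀ {x y} → Integral p x → Integral p y → Integral p (x * y)
    integral-* {x} {y} (d , m , nd , e) (d′ , n , nd′ , f) = d ℤ.* d′ , m ℤ.* n , ∤-* {d} {d′} nd nd′ ,
      trans (*-congˡ (ι-*-homo d d′)) (trans (solve 4 (λ x y d e → (x :* y) :* (d :* e) := (x :* d) :* (y :* e)) refl x y (ι d) (ι d′))
        (trans (*-cong e f) (sym (ι-*-homo m n))))

    integral-neg : ∀ {x} → Integral p x → Integral p (- x)
    integral-neg {x} i = integral-cong (solve 1 (λ x → con -[1+ 0 ] :* x := :- x) refl x) (integral-* (integral-ι -[1+ 0 ]) i)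

    integral-closed : Closed F (Integral p)
    integral-closed = record { +-closed = integral-+ ; *-closed = integral-* ; neg-closed = integral-neg ; 1-closed = integral-ι (+ 1) ; 0-closed = integral-ι (+ 0) }

    zero-cong : ∀ {x y} → x ≈ y → Zero p x → Zero p y
    zero-cong e (d , m , nd , f) = d , m , nd , trans (*-congʳ (sym e)) f

    zero-+ : ∀ {x y} → Zero p x → Zero p y → Zero p (x + y)
    zero-+ {x} {y} (d , m , nd , e) (d′ , n , nd′ , f) = d ℤ.* d′ , m ℤ.* d′ ℤ.+ n ℤ.* d , ∤-* {d} {d′} nd nd′ ,
      trans (*-congˡ (ι-*-homo d d′)) (trans (solve 4 (λ x y d e → (x :+ y) :* (d :* e) := (x :* d) :* e :+ (y :* e) :* d) refl x y (ι d) (ι d′))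
        (trans (+-cong (*-congʳ e) (*-congʳ f)) (trans (solve 5 (λ p m e n d → (p :* m) :* e :+ (p :* n) :* d := p :* (m :* e :+ n :* d)) refl (ι (+ p)) (ι m) (ι d′) (ι n) (ι d))
          (*-congˡ (sym (trans (ι-+-homo (m ℤ.* d′) _) (+-cong (ι-*-homo m d′) (ι-*-homo n d))))))))

    zero-* : ∀ {x y} → Integral p x → Zero p y → Zero p (x * y)
    zero-* {x} {y} (d , m , nd , e) (d′ , n , nd′ , f) = d ℤ.* d′ , m ℤ.* n , ∤-* {d} {d′} nd nd′ ,
      trans (*-congˡ (ι-*-homo d d′)) (trans (solve 4 (λ x y d e → (x :* y) :* (d :* e) := (x :* d) :* (y :* e)) refl x y (ι d) (ι d′))
        (trans (*-cong e f) (trans (solve 3 (λ m p n → m :* (p :* n) := p :* (m :* n)) refl (ι m) (ι (+ p)) (ι n)) (*-congˡ (sym (ι-*-homo m n))))))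

    zero-neg : ∀ {x} → Zero p x → Zero p (- x)
    zero-neg {x} z = zero-cong (solve 1 (λ x → con -[1+ 0 ] :* x := :- x) refl x) (zero-* (integral-ι -[1+ 0 ]) z)

    zero⇒integral : ∀ {x} → Zero p x → Integral p x
    zero⇒integral (d , m , nd , e) = d , + p ℤ.* m , nd , trans e (sym (ι-*-homo (+ p) m))

    ∣⇒zero : ∀ {m} → + p ℤ.∣ m → Zero p (ι m)
    ∣⇒zero {m} d with ℤˢ.∣ᵤ⇒∣ {+ p} {m} d
    ... | ℤˢ.divides q e = + 1 , q , ∤1 , trans (*-identityʳ _) (trans (ι-cong e) (trans (ι-*-homo q (+ p)) (*-comm _ _)))

    zero⇒∣ : ∀ {m} → Zero p (ι m) → + p ℤ.∣ m
    zero⇒∣ {m} (d , n , nd , e) = [ (λ z → z) , (λ z → ⊥-elim (nd z)) ]′ (euclid′ m d (≡.subst (+ p ℤ.∣_) {+ p ℤ.* n} {m ℤ.* d}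
      (≡.sym (ι-injective (trans (ι-*-homo m d) (trans e (sym (ι-*-homo (+ p) n)))))) (≡.subst (p ℕ.∣_) (≡.sym (ℤ.abs-* (+ p) n)) (ℕ.m∣m*n _))))

    zero-unscale : ∀ {k x} → ¬ + p ℤ.∣ k → Zero p (ι k * x) → Zero p x
    zero-unscale {k} {x} nk (d , m , nd , e) = k ℤ.* d , m , ∤-* {k} {d} nk nd ,
      trans (*-congˡ (ι-*-homo k d)) (trans (solve 3 (λ x k d → x :* (k :* d) := (k :* x) :* d) refl x (ι k) (ι d)) e)

    integral-unscale : ∀ {k x} → ¬ + p ℤ.∣ k → Integral p (ι k * x) → Integral p x
    integral-unscale {k} {x} nk (d , m , nd , e) = k ℤ.* d , m , ∤-* {k} {d} nk nd ,
      trans (*-congˡ (ι-*-homo k d)) (trans (solve 3 (λ x k d → x :* (k :* d) := (k :* x) :* d) refl x (ι k) (ι d)) e)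

    eval-integral : ∀ P {x} → (∀ i → Integral p (coeff P i)) → Integral p x → Integral p (eval P x)
    eval-integral [] ic ix = integral-ι (+ 0)
    eval-integral (c ∷ P) ic ix = integral-+ (ic 0) (integral-* ix (eval-integral P (λ i → ic (suc i)) ix))

    eval-congruent : ∀ P {x y} → (∀ i → Integral p (coeff P i)) → Integral p x → Integral p y → Zero p (x - y) → Zero p (eval P x - eval P y)
    eval-congruent [] ic ix iy z = zero-cong (sym (-‿inverseʳ 0#)) (∣⇒zero {+ 0} (p ℕ.∣0))
    eval-congruent (c ∷ P) {x} {y} ic ix iy z = zero-cong
      (solve 5 (λ c x y u v → x :* (u :- v) :+ v :* (x :- y) := (c :+ x :* u) :- (c :+ y :* v)) refl c x y (eval P x) (eval P y))
      (zero-+ (zero-* ix (eval-congruent P (λ i → ic (suc i)) ix iy z)) (zero-* (eval-integral P (λ i → ic (suc i)) iy) z))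

    act-integral : ∀ P {a} → (∀ i → Integral p (coeff P i)) → (∀ n → Integral p (a n)) → ∀ n → Integral p (act P a n)
    act-integral [] ic ia n = integral-ι (+ 0)
    act-integral (c ∷ P) ic ia n = integral-+ (integral-* (ic 0) (ia n)) (act-integral P (λ i → ic (suc i)) ia (suc n))

  Eventually : (ℕ → Set) → Set
  Eventually P = ∃ λ N → ∀ p → Prime p → N ≤ p → P p

  both : ∀ {P Q} → Eventually P → Eventually Q → Eventually (λ p → P p × Q p)
  both (M , f) (N , g) = M ℕ.⊔ N , λ p pr le → f p pr (ℕ.≤-trans (ℕ.m≤m⊔n M N) le) , g p pr (ℕ.≤-trans (ℕ.m≤n⊔m M N) le)

  with-prime : ∀ {P Q : ℕ → Set} → (∀ {p} → Prime p → P p → Q p) → Eventually P → Eventually Q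
  with-prime f (N , g) = N , λ p pr le → f pr (g p pr le)

  eventually-∤ : ∀ m → m ≢ + 0 → Eventually (λ p → ¬ + p ℤ.∣ m)
  eventually-∤ m m≢0 = suc ℤ.∣ m ∣ , λ p pr le → ∤-large m m≢0 le

  eventually-integral : ∀ x → Eventually (λ p → Integral p x)
  eventually-integral x = let (d , m , d≢0 , e) = fraction x in suc ℤ.∣ d ∣ , λ p pr le → d , m , ∤-large d d≢0 le , e

  coefficients-integral : ∀ P → Eventually (λ p → ∀ i → Integral p (coeff P i))
  coefficients-integral [] = 0 , λ p pr _ i → AtPrime.integral-ι pr (+ 0)
  coefficients-integral (c ∷ P) = with-prime (λ { pr (x , y) zero → x ; pr (x , y) (suc i) → y i }) (both (eventually-integral c) (coefficients-integral P))

  initial-integral : ∀ (a : ℕ → Carrier) s → Eventually (λ p → ∀ i → i < s → Integral p (a i))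
  initial-integral a zero = 0 , λ p pr _ i ()
  initial-integral a (suc s) = with-prime (λ { pr (x , y) i (s≤s i≤s) → [ y i , (λ { ≡.refl → x }) ]′ (ℕ.m≤n⇒m<n∨m≡n i≤s) }) (both (eventually-integral (a s)) (initial-integral a s))

  AlmostIntegral : (ℕ → Carrier) → Set
  AlmostIntegral a = Eventually (λ p → ∀ n → Integral p (a n))

  -- The coefficients and the `s` initial values involve finitely many denominators, and a monic
  -- recurrence introduces no further primes into them.
  recurrent-integral : ∀ P s a → Monic F P s → (∀ n → act P a n ≈ 0#) → AlmostIntegral a
  recurrent-integral P s a monic killed = with-prime (λ pr (ic , ii) → MonicRecurrence.all-in F (AtPrime.integral-closed pr) (AtPrime.integral-cong pr) P s a monic ic killed ii)
    (both (coefficients-integral P) (initial-integral a s))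

  open Multiples F using (M)

  M-integral : ∀ {p} (pr : Prime p) {a} → (∀ n → Integral p (a n)) → ∀ n → Integral p (M a n)
  M-integral pr ia zero = AtPrime.integral-ι pr (+ 0)
  M-integral pr ia (suc n) = AtPrime.integral-* pr (AtPrime.integral-ι pr (+ suc n)) (ia n)

  M-zero : ∀ {p} (pr : Prime p) {a} → (∀ n → Integral p (a n)) → Zero p (M a p)
  M-zero {zero} pr ia = AtPrime.∣⇒zero pr {+ 0} (0 ℕ.∣0)
  M-zero {suc n} pr {a} ia = AtPrime.zero-cong pr (*-comm _ _) (AtPrime.zero-* pr (ia n) (AtPrime.∣⇒zero pr {+ suc n} ℕ.∣-refl))

  separable-part : ∀ P s a → Monic F P s → (∀ n → act P a n ≈ 0#) → SeparablePart.Separable fieldF AlmostIntegral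
      (λ Q ia → with-prime (λ pr (x , y) → AtPrime.act-integral pr Q x y) (both (coefficients-integral Q) ia))
      (λ ia ib → with-prime (λ pr (x , y) n → AtPrime.integral-+ pr (x n) (y n)) (both ia ib))
      (λ ia → with-prime (λ pr x n → AtPrime.integral-neg pr (x n)) ia)
      (λ ia → with-prime (λ pr x → M-integral pr x) ia) a
  separable-part P s a monic killed = SeparablePart.separable fieldF AlmostIntegral _ _ _ _ (suc s) P
    (proj₁ monic , λ z → ι≉0 {+ 1} (λ ()) (trans (sym (proj₂ monic)) z)) ℕ.≤-refl a (recurrent-integral P s a monic killed) killed

fermat-little : ∀ {p} → Prime p → PrimeField p → ∀ m → + p ℤ.∣ m ℤ.- Kit._^_ ℤᴿ m p
fermat-little {p} pr Fp m = ι≈0⇒∣ (m ℤ.- Kit._^_ ℤᴿ m p) (trans (ι-+-homo m (ℤ.- Kit._^_ ℤᴿ m p))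
    (trans (+-congˡ (trans (ι-neg-homo (Kit._^_ ℤᴿ m p)) (-‿cong (trans (Hom.^-homo (ιʰ 𝔽) m p) (fermat pr (ι m)))))) (-‿inverseʳ (ι m))))
  where
  open PrimeField Fp
  open Kit 𝔽

-- Normal form: an integral separable recurrence

module Normalisation {F : Ring} (fieldF : Field F) (fraction : Fractions-of F) where
  open Kit F
  open Polynomial F
  open Degree F
  open Field fieldF
  open Local fieldF fraction
  private
    module Pℤ = Polynomial ℤᴿ
    module Dℤ = Degree ℤᴿ
    module Zᴾ = Kit (Polynomial.poly ℤᴿ)
    ιᴾ = mapʰ (ιʰ F)
    module ιᴾ = Hom ιᴾ

  Integer : Carrier → Set
  Integer x = ∃ λ m → x ≈ ι m

  integer-cong : ∀ {x y} → x ≈ y → Integer x → Integer y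
  integer-cong e (m , f) = m , trans (sym e) f

  integer-* : ∀ {x y} → Integer x → Integer y → Integer (x * y)
  integer-* (m , e) (n , f) = m ℤ.* n , trans (*-cong e f) (sym (ι-*-homo m n))

  integer-closed : Closed F Integer
  integer-closed = record
    { +-closed = λ { (m , e) (n , f) → m ℤ.+ n , trans (+-cong e f) (sym (ι-+-homo m n)) }
    ; *-closed = integer-*
    ; neg-closed = λ { (m , e) → ℤ.- m , trans (-‿cong e) (sym (ι-neg-homo m)) }
    ; 1-closed = + 1 , refl ; 0-closed = + 0 , refl }

  integer-lift : ∀ P → (∀ i → Integer (coeff P i)) → ∃ λ Pz → map ι Pz ≋ P
  integer-lift [] _ = [] , L.refl
  integer-lift (c ∷ P) ic with integer-lift P (λ i → ic (suc i))
  ... | Pz , e = proj₁ (ic 0) ∷ Pz , ∷-cong (sym (proj₂ (ic 0))) e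

  clear-sequence : ∀ (a : ℕ → Carrier) s → ∃ λ m → m ≢ + 0 × (∀ i → i < s → Integer (ι m * a i))
  clear-sequence a zero = + 1 , (λ ()) , λ i ()
  clear-sequence a (suc s) with clear-sequence a s | fraction (a s)
  ... | m , m≢0 , ints | d , n , d≢0 , e = m ℤ.* d , m≢0 *≢0 d≢0 , λ i → λ { (s≤s i≤s) →
      [ (λ i<s → integer-cong (sym (trans (*-congʳ (ι-*-homo m d)) (solve 3 (λ m d x → (m :* d) :* x := d :* (m :* x)) refl (ι m) (ι d) (a i)))) (integer-* (d , refl) (ints i i<s)))
      , (λ { ≡.refl → integer-cong (sym (trans (*-congʳ (ι-*-homo m d)) (solve 3 (λ m d x → (m :* d) :* x := m :* (x :* d)) refl (ι m) (ι d) (a s)))) (integer-* (m , refl) (n , e)) })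
      ]′ (ℕ.m≤n⇒m<n∨m≡n i≤s) }

  clear : ∀ P → ∃ λ m → m ≢ + 0 × ∃ λ Pz → map ι Pz ≋ C (ι m) ⊠ P
  clear P with clear-sequence (coeff P) (List.length P)
  ... | m , m≢0 , ints = m , m≢0 , integer-lift (C (ι m) ⊠ P) λ i → integer-cong (sym (coeff-C⊠ (ι m) P i)) (at-index i)
    where
    at-index : ∀ i → Integer (ι m * coeff P i)
    at-index i with ℕ.<-≤-connex i (List.length P)
    ... | inj₁ i<l = ints i i<l
    ... | inj₂ l≤i = + 0 , trans (*-congˡ (degLt-length P i l≤i)) (zeroʳ _)

  map-ι-injective : ∀ {P Q} → map ι P ≋ map ι Q → P Pℤ.≋ Q
  map-ι-injective {P} {Q} e = Pℤ.pw λ i → ι-injective (trans (sym (coeff-map (ιʰ F) P i)) (trans (at e i) (coeff-map (ιʰ F) Q i)))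

  -- The factor κ gathers all scalings that do not depend on `p`; being nonzero, it can be divided
  -- out modulo every large prime.
  record NormalForm (a : ℕ → Carrier) : Set where
    field
      recurrence : SeparableRecurrence
      κ          : ℤ
      κ≢0        : κ ≢ + 0
      congruent  : Eventually (λ p → Zero p (ι κ * a p - ι (SeparableRecurrence.b recurrence p)))

  -- Passing from h to D^s h(X/D), and from b n to D^n b n, makes the recurrence monic over ℤ.
  module Scale {h U V : List Carrier} (bezout : U ⊠ h ⊞ V ⊠ D h ≋ C 1#) {s : ℕ} (monic : Monic F h s)
    {b : ℕ → Carrier} (killed : ∀ n → act h b n ≈ 0#) where
    E : ℤ
    E = proj₁ (clear h)
    E≢0 : E ≢ + 0
    E≢0 = proj₁ (proj₂ (clear h))
    w : Carrier
    w = proj₁ (inverse (ι E) (ι≉0 E≢0))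
    Ew : ι E * w ≈ 1#
    Ew = proj₂ (inverse (ι E) (ι≉0 E≢0))
    open Dilation F w
    module σ = Hom dilate

    P : List Carrier
    P = C (ι E ^ s) ⊠ σ.fun h

    shift-powers : ∀ j i → ι E ^ (j ℕ.+ i) * w ^ i ≈ ι E ^ j
    shift-powers j zero = trans (*-identityʳ _) (reflexive (≡.cong (ι E ^_) (ℕ.+-identityʳ j)))
    shift-powers j (suc i) = trans (*-congʳ (reflexive (≡.cong (ι E ^_) (ℕ.+-suc j i))))
      (trans (solve 4 (λ e u w v → (e :* u) :* (w :* v) := (e :* w) :* (u :* v)) refl (ι E) (ι E ^ (j ℕ.+ i)) w (w ^ i))
      (trans (*-cong Ew (shift-powers j i)) (*-identityˡ _)))

    coeff-P : ∀ i → coeff P i ≈ ι E ^ s * (w ^ i * coeff h i)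
    coeff-P i = trans (coeff-C⊠ (ι E ^ s) (σ.fun h) i) (*-congˡ (coeff-dilate h i))

    -- For i < s at least one factor E remains and clears the denominator of the coefficient of `h`;
    -- for i = s none remains and the coefficient is 1. So `P` is monic and integral.
    coeff-P-split : ∀ j i → j ℕ.+ i ≡ s → coeff P i ≈ ι E ^ j * coeff h i
    coeff-P-split j i ≡.refl = trans (coeff-P i) (trans (sym (*-assoc _ _ _)) (*-congʳ (shift-powers j i)))

    monic-P : Monic F P s
    monic-P = (λ i le → trans (coeff-P i) (trans (*-congˡ (trans (*-congˡ (proj₁ monic i le)) (zeroʳ _))) (zeroʳ _))) ,
              trans (coeff-P-split 0 s ≡.refl) (trans (*-identityˡ _) (proj₂ monic))

    integer-P : ∀ i → Integer (coeff P i)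
    integer-P i with ℕ.<-cmp i s
    ... | tri≈ _ ≡.refl _ = + 1 , proj₂ monic-P
    ... | tri> _ _ s<i = + 0 , proj₁ monic-P i s<i
    ... | tri< i<s _ _ with ℕ.m≤n⇒∃[o]m+o≡n i<s
    ...   | j , e = integer-cong (sym (trans (coeff-P-split (suc j) i (≡.trans (≡.cong suc (ℕ.+-comm j i)) e))
                (solve 3 (λ e u c → (e :* u) :* c := u :* (e :* c)) refl (ι E) (ι E ^ j) (coeff h i))))
              (integer-* (Kit._^_ ℤᴿ E j , sym (Hom.^-homo (ιʰ F) E j)) (Pℤ.coeff hz′ i , trans (sym (coeff-C⊠ (ι E) h i)) (trans (sym (at (proj₂ (proj₂ (proj₂ (clear h)))) i)) (coeff-map (ιʰ F) hz′ i))))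
      where hz′ = proj₁ (proj₂ (proj₂ (clear h)))

    hz : List ℤ
    hz = proj₁ (integer-lift P integer-P)
    hz≋ : map ι hz ≋ P
    hz≋ = proj₂ (integer-lift P integer-P)

    monic-hz : Monic ℤᴿ hz s
    monic-hz = (λ i le → ι-injective {Pℤ.coeff hz i} {+ 0} (trans (sym (coeff-map (ιʰ F) hz i)) (trans (at hz≋ i) (proj₁ monic-P i le)))) ,
               ι-injective {Pℤ.coeff hz s} {+ 1} (trans (sym (coeff-map (ιʰ F) hz s)) (trans (at hz≋ s) (proj₂ monic-P)))

    -- Obtained by dilating U h + V h′ = 1: w^s cancels the factor E^s of `P`, and the extra E in V₂
    -- cancels the `w` that the chain rule puts into the derivative.
    U₂ V₂ : List Carrier
    U₂ = σ.fun U ⊠ C (w ^ s)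
    V₂ = (σ.fun V ⊠ C (ι E)) ⊠ C (w ^ s)

    bezout-P : U₂ ⊠ P ⊞ V₂ ⊠ D P ≋ C 1#
    bezout-P = L.trans (L.+-cong
        (L.trans (L.*-assoc (σ.fun U) (C (w ^ s)) P) (L.*-congˡ {σ.fun U} unscale))
        (L.trans (L.*-assoc (σ.fun V ⊠ C (ι E)) (C (w ^ s)) (D P)) (L.trans (L.*-congˡ {σ.fun V ⊠ C (ι E)} unscale-D)
          (L.trans (L.*-assoc (σ.fun V) (C (ι E)) (D (σ.fun h))) (L.*-congˡ {σ.fun V} σD)))))
      (L.trans (L.sym (L.trans (σ.+-homo (U ⊠ h) (V ⊠ D h)) (L.+-cong (σ.*-homo U h) (σ.*-homo V (D h))))) (L.trans (σ.cong bezout) σ.1-homo))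
      where
      C-cancel : C (w ^ s) ⊠ C (ι E ^ s) ≋ C 1#
      C-cancel = L.trans (L.sym (Hom.*-homo Cʰ (w ^ s) (ι E ^ s))) (Hom.cong Cʰ (trans (*-comm _ _) (shift-powers 0 s)))
      unscale : C (w ^ s) ⊠ P ≋ σ.fun h
      unscale = L.trans (L.sym (L.*-assoc (C (w ^ s)) (C (ι E ^ s)) (σ.fun h))) (L.trans (L.*-congʳ {σ.fun h} C-cancel) (L.*-identityˡ (σ.fun h)))
      unscale-D : C (w ^ s) ⊠ D P ≋ D (σ.fun h)
      unscale-D = L.trans (L.sym (D-C⊠ (w ^ s) P)) (D-cong unscale)
      σD : C (ι E) ⊠ D (σ.fun h) ≋ σ.fun (D h)
      σD = L.trans (L.*-congˡ {C (ι E)} (D-dilate h)) (L.trans (L.sym (L.*-assoc (C (ι E)) (C w) (σ.fun (D h))))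
        (L.trans (L.*-congʳ {σ.fun (D h)} (L.trans (L.sym (Hom.*-homo Cʰ (ι E) w)) (Hom.cong Cʰ Ew))) (L.*-identityˡ (σ.fun (D h)))))

    β : ℕ → Carrier
    β n = ι E ^ n * b n

    β-killed : ∀ n → act P β n ≈ 0#
    β-killed n = trans (act-⊠ (C (ι E ^ s)) (σ.fun h) β n) (trans (+-identityʳ _) (trans (*-congˡ (trans (act-dilate (ι E) Ew h b n) (trans (*-congˡ (killed n)) (zeroʳ _)))) (zeroʳ _)))

    k : ℤ
    k = proj₁ (clear-sequence β s)
    k≢0 : k ≢ + 0
    k≢0 = proj₁ (proj₂ (clear-sequence β s))

    kβ-killed : ∀ n → act P (λ m → ι k * β m) n ≈ 0#
    kβ-killed n = trans (act-*ʳ P (ι k) β n) (trans (*-congˡ (β-killed n)) (zeroʳ _))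

    kβ-integer : ∀ n → Integer (ι k * β n)
    kβ-integer = MonicRecurrence.all-in F integer-closed integer-cong P s (λ n → ι k * β n) monic-P integer-P kβ-killed (proj₂ (proj₂ (clear-sequence β s)))

    bz : ℕ → ℤ
    bz n = proj₁ (kβ-integer n)

    bz-killed : ∀ n → Pℤ.act hz bz n ≡ + 0
    bz-killed n = ι-injective {Pℤ.act hz bz n} {+ 0} (trans (act-map (ιʰ F) hz bz n) (trans (act-congˡ hz≋ _ n)
      (trans (act-congʳ P (λ m → sym (proj₂ (kβ-integer m))) n) (kβ-killed n))))

    mU mV : ℤ
    mU = proj₁ (clear U₂)
    mV = proj₁ (clear V₂)
    Uz Vz : List ℤ
    Uz = proj₁ (proj₂ (proj₂ (clear U₂)))
    Vz = proj₁ (proj₂ (proj₂ (clear V₂)))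

    bezout-z : (Pℤ.C mV Pℤ.⊠ Uz) Pℤ.⊠ hz Pℤ.⊞ (Pℤ.C mU Pℤ.⊠ Vz) Pℤ.⊠ Dℤ.D hz Pℤ.≋ Pℤ.C (mU ℤ.* mV)
    bezout-z = map-ι-injective (L.trans (ιᴾ.+-homo ((Pℤ.C mV Pℤ.⊠ Uz) Pℤ.⊠ hz) ((Pℤ.C mU Pℤ.⊠ Vz) Pℤ.⊠ Dℤ.D hz)) (L.trans
        (L.+-cong (L.trans (ιᴾ.*-homo (Pℤ.C mV Pℤ.⊠ Uz) hz) (L.*-cong (L.trans (ιᴾ.*-homo (Pℤ.C mV) Uz) (L.*-congˡ {C (ι mV)} (proj₂ (proj₂ (proj₂ (clear U₂)))))) hz≋))
                  (L.trans (ιᴾ.*-homo (Pℤ.C mU Pℤ.⊠ Vz) (Dℤ.D hz)) (L.*-cong (L.trans (ιᴾ.*-homo (Pℤ.C mU) Vz) (L.*-congˡ {C (ι mU)} (proj₂ (proj₂ (proj₂ (clear V₂)))))) (L.trans (map-D (ιʰ F) hz) (D-cong hz≋)))))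
        (L.trans (L.solve 6 (λ u v U V P Q → (v :* (u :* U)) :* P :+ (u :* (v :* V)) :* Q := (u :* v) :* (U :* P :+ V :* Q)) L.refl (C (ι mU)) (C (ι mV)) U₂ V₂ P (D P))
        (L.trans (L.*-congˡ {C (ι mU) ⊠ C (ι mV)} bezout-P) (L.trans (L.*-identityʳ (C (ι mU) ⊠ C (ι mV))) (L.trans (L.sym (Hom.*-homo Cʰ (ι mU) (ι mV))) (Hom.cong Cʰ (sym (ι-*-homo mU mV)))))))))

    scaled : SeparableRecurrence
    scaled = record { h = hz ; monic = monic-hz ; U = Pℤ.C mV Pℤ.⊠ Uz ; V = Pℤ.C mU Pℤ.⊠ Vz ; Δ = mU ℤ.* mV
      ; Δ≢0 = proj₁ (proj₂ (clear U₂)) *≢0 proj₁ (proj₂ (clear V₂)) ; bezout = bezout-z ; b = bz ; killed = bz-killed }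

    -- Scaling multiplied b_p by k E^p, a factor that varies with `p`. By Fermat's theorem E^p ≡ E,
    -- so the fixed factor k E has the same effect modulo `p`.
    scaled-congruent : ∀ {p} (pr : Prime p) {x y} → Integral p (b p) → Zero p y → x ≈ b p + y → Zero p (ι (k ℤ.* E) * x - ι (bz p))
    scaled-congruent {p} pr {x} {y} ib zy e = zero-cong (sym (begin
        ι (k ℤ.* E) * x - ι (bz p)                       ≈⟨ +-cong (*-cong (ι-*-homo k E) e) (-‿cong (sym (proj₂ (kβ-integer p)))) ⟩
        (ι k * ι E) * (b p + y) - ι k * (ι E ^ p * b p)  ≈⟨ solve 5 (λ k e b y u → (k :* e) :* (b :+ y) :- k :* (u :* b) := (k :* e) :* y :+ (k :* b) :* (e :- u)) refl (ι k) (ι E) (b p) y (ι E ^ p) ⟩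
        (ι k * ι E) * y + (ι k * b p) * (ι E - ι E ^ p)  ∎))
      (zero-+ (zero-* (integral-* (integral-ι k) (integral-ι E)) zy)
              (zero-* (integral-* (integral-ι k) ib) (zero-cong (trans (ι-+-homo E _) (+-congˡ (trans (ι-neg-homo (Kit._^_ ℤᴿ E p)) (-‿cong (Hom.^-homo (ιʰ F) E p))))) (∣⇒zero {E ℤ.- Kit._^_ ℤᴿ E p} (fermat-little pr (primeField pr) E)))))
      where open AtPrime pr

  normalForm : ∀ P s a → Monic F P s → (∀ n → act P a n ≈ 0#) → NormalForm a
  normalForm P s a monic killed = record { recurrence = N.scaled ; κ = N.k ℤ.* N.E ; κ≢0 = N.k≢0 *≢0 N.E≢0
      ; congruent = with-prime (λ {p} pr (ib , ic) → N.scaled-congruent pr (ib p) (M-zero pr ic) (S.a≈ p)) (both S.b-in S.c-in) }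
    where
    module S = SeparablePart.Separable (separable-part P s a monic killed)
    lead = coeff S.h S.deg
    i = proj₁ (inverse lead (proj₂ S.hasDeg))
    li : lead * i ≈ 1#
    li = proj₂ (inverse lead (proj₂ S.hasDeg))
    restore : C lead ⊠ (C i ⊠ S.h) ≋ S.h
    restore = L.trans (L.sym (L.*-assoc (C lead) (C i) S.h)) (L.trans (L.*-congʳ {S.h} (L.trans (L.sym (Hom.*-homo Cʰ lead i)) (Hom.cong Cʰ li))) (L.*-identityˡ S.h))
    bezout′ : (S.U ⊠ C lead) ⊠ (C i ⊠ S.h) ⊞ (S.V ⊠ C lead) ⊠ D (C i ⊠ S.h) ≋ C 1#
    bezout′ = L.trans (L.+-cong (L.trans (L.*-assoc S.U (C lead) (C i ⊠ S.h)) (L.*-congˡ {S.U} restore))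
        (L.trans (L.*-assoc S.V (C lead) (D (C i ⊠ S.h))) (L.*-congˡ {S.V} (L.trans (L.sym (D-C⊠ lead (C i ⊠ S.h))) (D-cong restore))))) S.bezout
    monic′ : Monic F (C i ⊠ S.h) S.deg
    monic′ = (λ j le → trans (coeff-C⊠ i S.h j) (trans (*-congˡ (proj₁ S.hasDeg j le)) (zeroʳ i))) , trans (coeff-C⊠ i S.h S.deg) (trans (*-comm _ _) li)
    killed′ : ∀ n → act (C i ⊠ S.h) S.b n ≈ 0#
    killed′ n = trans (act-⊠ (C i) S.h S.b n) (trans (+-identityʳ _) (trans (*-congˡ (S.killed n)) (zeroʳ i)))
    module N = Scale {C i ⊠ S.h} {S.U ⊠ C lead} {S.V ⊠ C lead} bezout′ {S.deg} monic′ {S.b} killed′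

-- The theorem over ℚ

module Identities (F : Ring) where
  open Kit F

  monic-constant : ∀ x → 1# * x + 0# ≈ x - 0#
  monic-constant = solve 1 (λ x → con (+ 1) :* x :+ con (+ 0) := x :- con (+ 0)) refl

  move-term : ∀ c x y s → (- c) * x + (y - s) ≈ y - (c * x + s)
  move-term = solve 4 (λ c x y s → (:- c) :* x :+ (y :- s) := y :- (c :* x :+ s)) refl

-- The annihilating polynomial and the common root

module Consequences {F : Ring} (fieldF : Field F) (fraction : Fractions-of F) where
  open Kit F
  open Polynomial F
  open Degree F
  open Field fieldF
  open Domain domain using (product≉0; power≉0; stable)
  open Local fieldF fraction
  open Normalisation fieldF fraction

  module _ {a : ℕ → Carrier} (nf : NormalForm a) where
    open NormalForm nf
    open SeparableRecurrence recurrence using (Δ; Δ≢0; b)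

    -- Take f₀(Δ κ X), where f₀ annihilates all Δ b_p, and use Δ κ a_p ≡ Δ b_p modulo p. The
    -- coefficient of X^j is multiplied by (Δ κ)^j, so nonzero coefficients survive.
    annihilating : ∃ λ f → (∃ λ i → ¬ coeff f i ≈ 0#) × Eventually (λ p → Zero p (eval f (a p)))
    annihilating = f , (j , λ z → product≉0 (power≉0 j w≉0) (ι≉0 {Polynomial.coeff ℤᴿ f₀ j} nz) (trans (*-congˡ (sym (coeff-map (ιʰ F) f₀ j))) (trans (sym (coeff-dilate (map ι f₀) j)) z))) ,
        with-prime vanishes congruent
      where
      f₀ = proj₁ (annihilator recurrence)
      j = proj₁ (proj₁ (proj₂ (annihilator recurrence)))
      nz = proj₂ (proj₁ (proj₂ (annihilator recurrence)))
      w = ι (Δ ℤ.* κ)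
      w≉0 : ¬ w ≈ 0#
      w≉0 = ι≉0 (Δ≢0 *≢0 κ≢0)
      open Dilation F w
      f = Hom.fun dilate (map ι f₀)
      vanishes : ∀ {p} → Prime p → Zero p (ι κ * a p - ι (b p)) → Zero p (eval f (a p))
      vanishes {p} pr z = zero-cong (trans (solve 2 (λ u v → (u :- v) :+ v := u) refl _ _) (sym (eval-dilate (map ι f₀) (a p))))
          (zero-+ (eval-congruent (map ι f₀) (λ i → integral-cong (sym (coeff-map (ιʰ F) f₀ i)) (integral-ι (Polynomial.coeff ℤᴿ f₀ i))) ix (integral-ι (Δ ℤ.* b p)) close)
                  (zero-cong (eval-map (ιʰ F) f₀ (Δ ℤ.* b p)) (∣⇒zero {Polynomial.eval ℤᴿ f₀ (Δ ℤ.* b p)} (proj₂ (proj₂ (annihilator recurrence)) p pr))))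
        where
        open AtPrime pr
        close : Zero p (w * a p - ι (Δ ℤ.* b p))
        close = zero-cong (trans (solve 4 (λ d k x y → d :* (k :* x :- y) := (d :* k) :* x :- d :* y) refl (ι Δ) (ι κ) (a p) (ι (b p)))
            (+-cong (*-congʳ (sym (ι-*-homo Δ κ))) (-‿cong (sym (ι-*-homo Δ (b p)))))) (zero-* (integral-ι Δ) z)
        ix : Integral p (w * a p)
        ix = integral-cong (solve 2 (λ u v → (u :- v) :+ v := u) refl _ _) (integral-+ (zero⇒integral close) (integral-ι (Δ ℤ.* b p)))

    -- This is b_1 / κ, to which a_p is congruent for the infinitely many primes with κ a_p ≡ b_p ≡
    -- b_1. It is the same for every polynomial.
    root : Carrier
    root = ι (b 1) * proj₁ (inverse (ι κ) (ι≉0 κ≢0))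

    κ-root : ι κ * root ≈ ι (b 1)
    κ-root = trans (solve 3 (λ k b i → k :* (b :* i) := b :* (k :* i)) refl (ι κ) (ι (b 1)) _) (trans (*-congˡ (proj₂ (inverse (ι κ) (ι≉0 κ≢0)))) (*-identityʳ _))

    root-spec : ∀ f → Eventually (λ p → Zero p (eval f (a p))) → eval f root ≈ 0#
    root-spec f vanishing = stable λ f[r]≉0 → nonzero-value f[r]≉0 (fraction (eval f root))
      where
      -- A nonzero numerator m has only finitely many prime divisors.
      nonzero-value : ¬ eval f root ≈ 0# → (∃ λ d → ∃ λ m → d ≢ + 0 × eval f root * ι d ≈ ι m) → ⊥
      nonzero-value f[r]≉0 (d , m , d≢0 , e) = infinitely-many-congruences recurrence (proj₁ good) λ { (p , pr , le , div) →
            conclude pr (proj₂ good p pr le) div }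
        where
        m≢0 : m ≢ + 0
        m≢0 ≡.refl = product≉0 f[r]≉0 (ι≉0 d≢0) e
        good = both (both congruent vanishing) (both (both (eventually-∤ κ κ≢0) (eventually-∤ m m≢0)) (coefficients-integral f))
        conclude : ∀ {p} → Prime p → (Zero p (ι κ * a p - ι (b p)) × Zero p (eval f (a p))) ×
          ((¬ + p ℤ.∣ κ × ¬ + p ℤ.∣ m) × (∀ i → Integral p (coeff f i))) → + p ℤ.∣ b p ℤ.- b 1 → ⊥
        conclude {p} pr ((z , v) , (p∤κ , p∤m) , ic) div = p∤m (zero⇒∣ {m} (zero-cong (trans (*-comm _ _) e) (zero-* (integral-ι d)
            (zero-cong (solve 2 (λ u v → u :- (u :- v) := v) refl (eval f (a p)) (eval f root)) (zero-+ v (zero-neg (eval-congruent f ic ia ir close)))))))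
          where
          open AtPrime pr
          close : Zero p (a p - root)
          close = zero-unscale {κ} p∤κ (zero-cong (trans (solve 3 (λ x y z → (x :- y) :+ (y :- z) := x :- z) refl (ι κ * a p) (ι (b p)) (ι (b 1)))
              (trans (+-congˡ (-‿cong (sym κ-root))) (solve 3 (λ k x r → k :* x :- k :* r := k :* (x :- r)) refl (ι κ) (a p) root)))
            (zero-+ z (zero-cong (trans (ι-+-homo (b p) (ℤ.- b 1)) (+-congˡ (ι-neg-homo (b 1)))) (∣⇒zero {b p ℤ.- b 1} div))))
          ir : Integral p root
          ir = integral-unscale {κ} p∤κ (integral-cong (sym κ-root) (integral-ι (b 1)))
          ia : Integral p (a p)
          ia = integral-cong (solve 2 (λ x r → (x :- r) :+ r := x) refl (a p) root) (integral-+ (zero⇒integral close) ir)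

open import Defs

ℚᴿ : Ring
ℚᴿ = ℚ.+-*-commutativeRing

-- An integer as a fraction in lowest terms, whose numerator is visible by computation, whereas `ι`
-- builds the same number as a sum of ones.
fromℤ : ℤ → ℚ
fromℤ m = mkℚ m 0 (Coprime.sym (Coprime.1-coprimeTo ℤ.∣ m ∣))

fromℤʰ : Hom ℤᴿ ℚᴿ
fromℤʰ = record
  { fun = fromℤ
  ; cong = ≡.cong fromℤ
  ; +-homo = λ m n → ℚ.toℚᵘ-injective (ℚᵘ.≃-trans (ℚᵘ.*≡* (≡.cong (ℤ._* + 1) (≡.sym (≡.cong₂ ℤ._+_ (ℤ.*-identityʳ m) (ℤ.*-identityʳ n)))))
      (ℚᵘ.≃-sym (ℚ.toℚᵘ-homo-+ (fromℤ m) (fromℤ n))))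
  ; *-homo = λ m n → ℚ.toℚᵘ-injective (ℚᵘ.≃-sym (ℚ.toℚᵘ-homo-* (fromℤ m) (fromℤ n)))
  ; 1-homo = ≡.refl }

ι≡fromℤ : ∀ m → Kit.ι ℚᴿ m ≡ fromℤ m
ι≡fromℤ m = ≡.sym (ℤ-initial fromℤʰ m)

*-denominator : ∀ q → q ℚ.* Kit.ι ℚᴿ (↧ q) ≡ Kit.ι ℚᴿ (↥ q)
*-denominator q@(mkℚ n d-1 _) = ≡.trans (≡.cong (q ℚ.*_) (ι≡fromℤ (↧ q))) (≡.trans
  (ℚ.toℚᵘ-injective (ℚᵘ.≃-trans (ℚ.toℚᵘ-homo-* q (fromℤ (↧ q))) (ℚᵘ.*≡* (≡.trans (ℤ.*-identityʳ (n ℤ.* + suc d-1)) (≡.cong (n ℤ.*_) (≡.cong +_ (≡.sym (ℕ.*-identityʳ (suc d-1)))))))))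
  (≡.sym (ι≡fromℤ n)))

ℚ-fraction : Fractions-of ℚᴿ
ℚ-fraction q = ↧ q , ↥ q , (λ ()) , *-denominator q

ℚ-field : Field ℚᴿ
ℚ-field = record
  { zero? = λ x → x ℚ.≟ 0ℚ
  ; inverse = λ x x≢0 → (1/ x) {{ℚ.≢-nonZero x≢0}} , ℚ.*-inverseʳ x {{ℚ.≢-nonZero x≢0}}
  ; char0 = λ m e → ≡.cong ↥_ (≡.trans (≡.sym (ι≡fromℤ m)) e) }

open Local ℚ-field ℚ-fraction
open Consequences ℚ-field ℚ-fraction

module _ {p : ℕ} (pr : Prime p) where
  open AtPrime pr

  zero⇒ZeroModP : ∀ q → Zero p q → ZeroModP p q
  zero⇒ZeroModP q z = zero⇒∣ {↥ q} (≡.subst (Zero p) (≡.trans (ℚ.*-comm (Kit.ι ℚᴿ (↧ q)) q) (*-denominator q)) (zero-* {Kit.ι ℚᴿ (↧ q)} {q} (integral-ι (↧ q)) z))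

  -- In lowest terms a prime dividing the numerator cannot divide the denominator, so integrality at
  -- `p` comes for free.
  ZeroModP⇒zero : ∀ q → ZeroModP p q → Zero p q
  ZeroModP⇒zero q@(mkℚ n d-1 coprime) p∣n with ℤˢ.∣ᵤ⇒∣ {+ p} {n} p∣n
  ... | ℤˢ.divides x e = ↧ q , x , (λ p∣d → ¬prime[1] (≡.subst Prime (Coprime.recompute coprime (p∣n , p∣d)) pr)) ,
        ≡.trans (*-denominator q) (≡.trans (≡.cong (Kit.ι ℚᴿ) (≡.trans e (ℤ.*-comm x (+ p)))) (Kit.ι-*-homo ℚᴿ (+ p) x))

open Polynomial ℚᴿ using (coeff; act)
open Degree ℚᴿ using (DegLt)

-- The polynomial X^k - c_(k-1) X^(k-1) - ... - c_0, listed from the constant term.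
characteristic : (k : ℕ) → (Fin k → ℚ) → List ℚ
characteristic zero    c = 1ℚ ∷ []
characteristic (suc k) c = ℚ.- c zero ∷ characteristic k (λ i → c (suc i))

characteristic-monic : ∀ k c → Monic ℚᴿ (characteristic k c) k
characteristic-monic zero c = (λ { (suc i) _ → ≡.refl }) , ≡.refl
characteristic-monic (suc k) c with characteristic-monic k (λ i → c (suc i))
... | d , e = (λ { (suc i) (s≤s le) → d i le }) , e

finSum-cong : ∀ k {f g : Fin k → ℚ} → (∀ i → f i ≡ g i) → finSum k f ≡ finSum k g
finSum-cong zero e = ≡.refl
finSum-cong (suc k) e = ≡.cong₂ ℚ._+_ (e zero) (finSum-cong k (λ i → e (suc i)))

act-characteristic : ∀ k c (a : ℕ → ℚ) n → act (characteristic k c) a n ≡ a (n ℕ.+ k) ℚ.- finSum k (λ i → c i ℚ.* a (n ℕ.+ toℕ i))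
act-characteristic zero c a n = ≡.trans (Identities.monic-constant ℚᴿ (a n)) (≡.cong (λ m → a m ℚ.- 0ℚ) (≡.sym (ℕ.+-identityʳ n)))
act-characteristic (suc k) c a n = ≡.trans (≡.cong (λ z → (ℚ.- c zero) ℚ.* a n ℚ.+ z) (act-characteristic k (λ i → c (suc i)) a (suc n)))
  (≡.trans (Identities.move-term ℚᴿ (c zero) (a n) (a (suc n ℕ.+ k)) s)
  (≡.cong₂ ℚ._-_ (≡.cong a (≡.sym (ℕ.+-suc n k))) (≡.cong₂ ℚ._+_ (≡.cong (λ m → c zero ℚ.* a m) (≡.sym (ℕ.+-identityʳ n)))
     (finSum-cong k (λ i → ≡.cong (λ m → c (suc i) ℚ.* a m) (≡.sym (ℕ.+-suc n (toℕ i))))))))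
  where s = finSum k (λ i → c (suc i) ℚ.* a (suc n ℕ.+ toℕ i))

recurrent-normalForm : ∀ {a} → IsRecurrent a → Normalisation.NormalForm ℚ-field ℚ-fraction a
recurrent-normalForm {a} (k , c , rec) = Normalisation.normalForm ℚ-field ℚ-fraction (characteristic k c) k a (characteristic-monic k c)
  (λ n → ≡.trans (act-characteristic k c a n) (≡.trans (≡.cong (ℚ._- finSum k (λ i → c i ℚ.* a (n ℕ.+ toℕ i))) (rec n)) (ℚ.+-inverseʳ (finSum k (λ i → c i ℚ.* a (n ℕ.+ toℕ i))))))

nonzero-coefficient : ∀ f i → coeff f i ≢ 0ℚ → NonZeroPoly f
nonzero-coefficient [] i nz = ⊥-elim (nz ≡.refl)
nonzero-coefficient (c ∷ f) zero nz = here nz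
nonzero-coefficient (c ∷ f) (suc i) nz = there (nonzero-coefficient f i nz)

eval-Defs : ∀ f x → eval f x ≡ Polynomial.eval ℚᴿ f x
eval-Defs [] x = ≡.refl
eval-Defs (c ∷ f) x = ≡.cong (λ z → c ℚ.+ x ℚ.* z) (eval-Defs f x)

VanishesEventually : Poly → (ℕ → ℚ) → Set
VanishesEventually f a = Eventually (λ p → Zero p (Polynomial.eval ℚᴿ f (a p)))

vanishes⇒ : ∀ {f a} → VanishesEventually f a → PolyVanishesAt f a
vanishes⇒ {f} {a} (N , z) = N , λ p pr le → zero⇒ZeroModP pr (eval f (a p) ℚ.- 0ℚ)
  (≡.subst (Zero p) (≡.trans (≡.sym (eval-Defs f (a p))) (≡.sym (ℚ.+-identityʳ (eval f (a p))))) (z p pr le))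

⇒vanishes : ∀ {f a} → PolyVanishesAt f a → VanishesEventually f a
⇒vanishes {f} {a} (N , z) = N , λ p pr le →
  ≡.subst (Zero p) (≡.trans (ℚ.+-identityʳ (eval f (a p))) (eval-Defs f (a p))) (ZeroModP⇒zero pr (eval f (a p) ℚ.- 0ℚ) (z p pr le))

nonzero-annihilator : ∀ {a} → (∃ λ f → (∃ λ i → ¬ coeff f i ≡ 0ℚ) × VanishesEventually f a) → ∃ λ (f : Poly) → NonZeroPoly f × PolyVanishesAt f a
nonzero-annihilator {a} (f , (i , nz) , z) = f , nonzero-coefficient f i nz , vanishes⇒ {f} {a} z

rational-root : ∀ {a} r → (∀ f → VanishesEventually f a → Polynomial.eval ℚᴿ f r ≡ 0ℚ) →
  ∀ (f : Poly) → NonZeroPoly f → PolyVanishesAt f a → ∃ λ (r : ℚ) → eval f r ≡ 0ℚ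
rational-root {a} r spec f _ z = r , ≡.trans (eval-Defs f r) (spec f (⇒vanishes {f} {a} z))

theorem1p4 : (a : ℕ → ℚ) → IsRecurrent a →
    (∃ λ (f : Poly) → NonZeroPoly f × PolyVanishesAt f a)
    × (∀ (f : Poly) → NonZeroPoly f → PolyVanishesAt f a →
    ∃ λ (r : ℚ) → eval f r ≡ 0ℚ)
theorem1p4 a recurrent = from-normalForm (recurrent-normalForm recurrent)
  where
  from-normalForm : Normalisation.NormalForm ℚ-field ℚ-fraction a → _
  from-normalForm nf = nonzero-annihilator {a} (annihilating nf) , rational-root {a} (root nf) (root-spec nf)
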